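{- Let $T$ be a tree on $n\geq 2$ vertices. If $n\leq 15$, then $\xi^{ac}(T)\leq\xi^{ac}(S_n)$, with equality if and only if $T=S_n$. If $n\geq 16$, then $\xi^{ac}(T)\leq\xi^{ac}\!\left(TB_{n,\lceil (n-1)/3\rceil}\right)$, with equality if and only if $T=TB_{n,\lceil (n-1)/3\rceil}$.
   Context: $S_n$ is the star on $n$ vertices. For a connected graph, $\varepsilon(u)=\max_v d(u,v)$ is the eccentricity, $M(u)$ is the product of the degrees of all neighbors of $u$, and $\xi^{ac}(G)=\sum_{u\in V(G)}\frac{M(u)}{\varepsilon(u)}$ (defined for graphs with at least two vertices). A tree of diameter $4$ has a unique central vertex (vertex of minimum eccentricity). A tree is degree balanced if its diameter is $4$ and all neighbors of its central vertex have degrees differing pairwise by at most one; $TB_{n,k}$ denotes the (unique up to isomorphism) degree balanced tree on $n$ vertices whose central vertex has degree $k$. -}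

module Defs where

open import Data.Bool using (Bool; true; false; if_then_else_; _∧_; _∨_)
open import Data.Nat using (ℕ; zero; suc; _+_; _*_; _∸_; _⊔_; _≤_)
open import Data.Fin using (Fin; toℕ)
open import Data.List using (List; []; _∷_; _++_; [_]; map; foldr; allFin; length)
open import Data.Nat.ListAction using (sum; product)
open import Data.List.Relation.Unary.Linked using (Linked)
open import Data.List.Relation.Unary.Unique.Propositional using (Unique)
open import Data.Product using (Σ; _×_; ∃)
open import Data.Integer using (+_)
open import Data.Rational using (ℚ; 0ℚ) renaming (_+_ to _+ℚ_; _/_ to _/ℚ_)
open import Data.Empty using (⊥)
open import Function.Bundles using (_↔_; Inverse)
open import Relation.Binary.PropositionalEquality using (_≡_)

record Graph (n : ℕ) : Set where
  field
    adj    : Fin n → Fin n → Bool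
    sym    : ∀ i j → adj i j ≡ adj j i
    irrefl : ∀ i → adj i i ≡ false

open Graph public

module _ {n : ℕ} (G : Graph n) where

  Adj : Fin n → Fin n → Set
  Adj i j = adj G i j ≡ true

  data Walk : Fin n → Fin n → ℕ → Set where
    here : ∀ {u} → Walk u u 0
    step : ∀ {u w v k} → Adj u w → Walk w v k → Walk u v (suc k)

  Connected : Set
  Connected = ∀ u v → ∃ λ k → Walk u v k

  HasCycle : Set
  HasCycle = Σ (Fin n) λ x → Σ (List (Fin n)) λ xs →
               (2 ≤ length xs) × Unique (x ∷ xs) × Linked Adj (x ∷ xs ++ [ x ])

  IsTree : Set
  IsTree = Connected × (HasCycle → ⊥)

  deg : Fin n → ℕ
  deg u = sum (map (λ v → if adj G u v then 1 else 0) (allFin n))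

  M : Fin n → ℕ
  M u = product (map (λ v → if adj G u v then deg v else 1) (allFin n))

  reach : ℕ → Fin n → Fin n → Bool
  reach zero u v = eqF u v
    where
    eqF : Fin n → Fin n → Bool
    eqF a b = Data.Nat._≡ᵇ_ (toℕ a) (toℕ b)
  reach (suc k) u v =
    reach k u v ∨ foldr _∨_ false (map (λ w → reach k u w ∧ adj G w v) (allFin n))

  -- least k (searched in 0..n) with reach k u v; for connected graphs
  -- this is the usual distance d(u,v) (which is ≤ n - 1)
  dist : Fin n → Fin n → ℕ
  dist u v = go 0 n
    where
    go : ℕ → ℕ → ℕ
    go k zero = k
    go k (suc f) = if reach k u v then k else go (suc k) f

  ecc : Fin n → ℕ
  ecc u = foldr _⊔_ 0 (map (dist u) (allFin n))

  diameter : ℕ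
  diameter = foldr _⊔_ 0 (map ecc (allFin n))

  -- ξ^{ac}(G) = Σ_u M(u)/ε(u).  The denominator is written suc (ε(u) ∸ 1),
  -- which equals ε(u) whenever ε(u) ≥ 1 (true for connected G with n ≥ 2).
  xi : ℚ
  xi = foldr _+ℚ_ 0ℚ (map (λ u → (+ M u) /ℚ suc (ecc u ∸ 1)) (allFin n))

  DegreeBalanced : ℕ → Set
  DegreeBalanced k = (diameter ≡ 4) × Σ (Fin n) λ c →
    (∀ v → ecc c ≤ ecc v) × (deg c ≡ k) ×
    (∀ u v → Adj c u → Adj c v → deg u ≤ deg v + 1)

_≅_ : ∀ {n} → Graph n → Graph n → Set
_≅_ {n} G H = Σ (Fin n ↔ Fin n) λ f →
  ∀ i j → adj H (Inverse.to f i) (Inverse.to f j) ≡ adj G i j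

isZero : ∀ {n} → Fin n → Bool
isZero i = Data.Nat._≡ᵇ_ (toℕ i) 0

star : (n : ℕ) → Graph n
star n = record { adj = a ; sym = s ; irrefl = ir }
  where
  open import Data.Bool using (not)
  open import Relation.Binary.PropositionalEquality using (refl)
  a : Fin n → Fin n → Bool
  a i j = (isZero i ∧ not (isZero j)) ∨ (isZero j ∧ not (isZero i))
  s : ∀ i j → a i j ≡ a j i
  s i j with isZero i | isZero j
  ... | true  | true  = refl
  ... | true  | false = refl
  ... | false | true  = refl
  ... | false | false = refl
  ir : ∀ i → a i i ≡ false
  ir i with isZero i
  ... | true  = refl
  ... | false = refl

{-# OPTIONS --safe #-}

-- Let s = n - 1. If some vertex c is within distance 2 of all others, let ds be the degrees of its
-- neighbours: they have sum s, and 12 ξ is an explicit function of ds, namely 12 + 6 s² for a star,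
-- something smaller for a double star, and Φ ds = 6 ∏ d + 4 k² + 3 ∑ d (d - 1) in diameter 4, where
-- k is the length of ds. For s ≤ 14, Φ ds < 12 + 6 s². For s ≥ 15, a list ds that is not made of 3s
-- and at most two 2s (or one 4) has a product smaller than the maximum by a factor 8/9, which the
-- quadratic terms cannot make up for; s ≤ 21 is settled by running through all partitions.
--
-- Otherwise all eccentricities are at least 3, so 12 ξ ≤ 4 ∑ M(u). If A and B are the two colour
-- classes, then growing the tree leaf by leaf gives
--   ∑_{u ∈ A} M(u) ≤ ∏_{b ∈ B} deg b + ∑_{b ∈ B} deg b (deg b - 1),
-- and ∑_{b ∈ B} deg b = s, |A| + |B| = s + 1. As only one of the two products can come close to the
-- largest product of integers with sum s, this stays below the value of the extremal tree.

module Submission where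

open import Defs
open import Data.Bool using (Bool; true; false; if_then_else_; _∧_; _∨_; not; T) renaming (_≟_ to _≟ᵇ_)
open import Data.Bool.Properties using (∨-zeroʳ; ∨-comm; ∨-identityʳ; ∧-identityʳ; not-involutive)
open import Data.Empty using (⊥; ⊥-elim)
open import Data.Fin using (Fin; zero; suc; toℕ; _↑ˡ_; _↑ʳ_; splitAt)
open import Data.Fin.Properties using (_≟_; toℕ-injective; injective⇒≤; any?; all?; ¬∀⟶∃¬; splitAt-↑ˡ; splitAt-↑ʳ; splitAt⁻¹-↑ˡ; splitAt⁻¹-↑ʳ) renaming (suc-injective to Fin-suc-injective)
import Data.Integer as ℤ
import Data.Integer.Properties as ℤ
open import Data.List using (List; []; _∷_; _++_; [_]; map; foldr; allFin; length; replicate; lookup; reverse; filterᵇ)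
open import Data.List.Membership.Propositional using (_∈_; _∉_)
open import Data.List.Membership.Propositional.Properties using (∈-allFin; ∈-map⁺; ∈-map⁻; ∈-++⁺ˡ; ∈-++⁺ʳ; ∈-++⁻; ∈-∃++; ∈-lookup)
open import Data.List.Membership.Propositional.Properties.WithK using (unique∧set⇒bag)
open import Data.List.Properties using (map-cong; map-∘; map-tabulate; length-map; length-tabulate; length-replicate; ++-identityʳ; ∷-injectiveˡ; ∷-injectiveʳ; ≡-dec)
open import Data.List.Relation.Binary.BagAndSetEquality using (∼bag⇒↭)
open import Data.List.Relation.Binary.Permutation.Propositional using (_↭_; ↭-refl; ↭-sym; ↭-trans; prep; swap; ↭⇒↭ₛ)
open import Data.List.Relation.Binary.Permutation.Propositional.Properties using (map⁺; ↭-length; ∈-resp-↭; shift; ↭-map-inv; All-resp-↭; ++⁺ʳ; ↭-reverse)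
open import Data.List.Relation.Unary.All as All using (All; []; _∷_)
open import Data.List.Relation.Unary.AllPairs using ([]; _∷_)
open import Data.List.Relation.Unary.Any as Any using (here; there)
open import Data.List.Relation.Unary.Any.Properties using (lookup-index)
open import Data.List.Relation.Unary.Linked using (Linked; [-]; _∷_)
open import Data.List.Relation.Unary.Unique.Propositional using (Unique)
open import Data.List.Relation.Unary.Unique.Propositional.Properties using (allFin⁺) renaming (map⁺ to Unique-map⁺)
open import Data.Nat using (ℕ; zero; suc; _+_; _*_; _∸_; _^_; _≤_; _<_; _⊔_; _/_; _%_; _≡ᵇ_; _≤ᵇ_; _<ᵇ_; z≤n; s≤s; pred; ⌊_/2⌋; _≤?_; _<?_) renaming (_≟_ to _≟ℕ_)
open import Data.Nat.DivMod using (m/n≡1+[m∸n]/n)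
open import Data.Nat.ListAction using (sum; product)
open import Data.Nat.ListAction.Properties using (sum-↭; product-↭)
open import Data.Nat.Properties hiding (_≟_)
open import Data.Nat.Solver using (module +-*-Solver)
open import Data.Product using (Σ; _×_; _,_; proj₁; proj₂; ∃; ∃₂)
open import Data.Rational using (ℚ; 0ℚ; toℚᵘ) renaming (_+_ to _+ℚ_; _/_ to _/ℚ_; _≤_ to _≤ℚ_; _<_ to _<ℚ_)
import Data.Rational.Properties as ℚ
import Data.Rational.Unnormalised as ℚᵘ
import Data.Rational.Unnormalised.Properties as ℚᵘ
open import Data.Sum using (_⊎_; inj₁; inj₂; [_,_]′; map₂)
open import Function.Base using (_∘_; case_of_)
open import Function.Bundles using (_⇔_; mk⇔; _↔_; Inverse; mk↔ₛ′)
open import Relation.Binary.PropositionalEquality using (_≡_; _≢_; refl; trans; cong; cong₂; subst; subst₂; setoid; module ≡-Reasoning) renaming (sym to ≡-sym)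
open import Relation.Nullary using (¬_; Dec; yes; no; does; contradiction; ¬?; _×-dec_; _⊎-dec_)
open import Relation.Nullary.Decidable using (dec-true; dec-false)
open +-*-Solver using (solve; con; _:+_; _:*_; _:=_)

-- 12 is the least common multiple of the eccentricities 1, 2, 3, 4 that have to be treated exactly;
-- natural weights in place of 12 / ε move every comparison from ℚ to ℕ. The leading terms are 6 s²
-- for the star and about 6 · 3^(s/3) for the balanced tree; they cross between s = 14 and s = 15.
-- The obstacle is that trees of larger radius can have products of the same exponential order.
-- There the weight is 4 instead of 6, which leaves about a third of the extremal value for
-- everything else. The larger colour class has at least (s+1)/2 members with degree sum s, so its
-- product is at most 2^((s-1)/2). Since √2 is only slightly below the cube root of 3, this estimate
-- suffices for all s only from 26 on; smaller s are settled by evaluating a sharper bound for every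
-- pair of class sizes. Within diameter 4, a part 4 in place of 2, 2 gives the same product, so
-- there the quadratic terms decide.

private
  variable
    A B : Set
    n : ℕ

-- Sums and products over lists, duplicate-free lists, Booleans

∑ : List A → (A → ℕ) → ℕ
∑ xs f = sum (map f xs)

∏ : List A → (A → ℕ) → ℕ
∏ xs f = product (map f xs)

⟦_⟧ : Bool → ℕ
⟦ b ⟧ = if b then 1 else 0

∑-cong : ∀ (xs : List A) {f g} → (∀ {x} → x ∈ xs → f x ≡ g x) → ∑ xs f ≡ ∑ xs g
∑-cong []       e = refl
∑-cong (x ∷ xs) e = cong₂ _+_ (e (here refl)) (∑-cong xs (e ∘ there))

∏-cong : ∀ (xs : List A) {f g} → (∀ {x} → x ∈ xs → f x ≡ g x) → ∏ xs f ≡ ∏ xs g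
∏-cong []       e = refl
∏-cong (x ∷ xs) e = cong₂ _*_ (e (here refl)) (∏-cong xs (e ∘ there))

∏-mono : ∀ (xs : List A) {f g} → (∀ {x} → x ∈ xs → f x ≤ g x) → ∏ xs f ≤ ∏ xs g
∏-mono []       e = ≤-refl
∏-mono (x ∷ xs) e = *-mono-≤ (e (here refl)) (∏-mono xs (e ∘ there))

+-interchange : ∀ a b c d → (a + b) + (c + d) ≡ (a + c) + (b + d)
+-interchange = solve 4 (λ a b c d → (a :+ b) :+ (c :+ d) := (a :+ c) :+ (b :+ d)) refl

*-left-comm : ∀ a b c → a * (b * c) ≡ b * (a * c)
*-left-comm = solve 3 (λ a b c → a :* (b :* c) := b :* (a :* c)) refl

suc-pred-≥1 : ∀ {m} → 1 ≤ m → suc (pred m) ≡ m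
suc-pred-≥1 {suc m} _ = refl

∑-+ : ∀ (xs : List A) f g → ∑ xs (λ x → f x + g x) ≡ ∑ xs f + ∑ xs g
∑-+ []       f g = refl
∑-+ (x ∷ xs) f g = trans (cong (_+_ (f x + g x)) (∑-+ xs f g))
                         (+-interchange (f x) (g x) (∑ xs f) (∑ xs g))

∑-* : ∀ (xs : List A) a f → ∑ xs (λ x → a * f x) ≡ a * ∑ xs f
∑-* []       a f = ≡-sym (*-zeroʳ a)
∑-* (x ∷ xs) a f = trans (cong (_+_ (a * f x)) (∑-* xs a f)) (≡-sym (*-distribˡ-+ a (f x) _))

∑-zero : ∀ (xs : List A) {f} → (∀ {x} → x ∈ xs → f x ≡ 0) → ∑ xs f ≡ 0
∑-zero []       e = refl
∑-zero (x ∷ xs) e = cong₂ _+_ (e (here refl)) (∑-zero xs (e ∘ there))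

∏-one : ∀ (xs : List A) {f} → (∀ {x} → x ∈ xs → f x ≡ 1) → ∏ xs f ≡ 1
∏-one []       e = refl
∏-one (x ∷ xs) e = cong₂ _*_ (e (here refl)) (∏-one xs (e ∘ there))

∑-ones : ∀ (xs : List A) → ∑ xs (λ _ → 1) ≡ length xs
∑-ones []       = refl
∑-ones (x ∷ xs) = cong suc (∑-ones xs)

∑-swap : ∀ (xs : List A) (ys : List B) (f : A → B → ℕ) →
         ∑ xs (λ x → ∑ ys (f x)) ≡ ∑ ys (λ y → ∑ xs (λ x → f x y))
∑-swap []       ys f = ≡-sym (∑-zero ys (λ _ → refl))
∑-swap (x ∷ xs) ys f = trans (cong (∑ ys (f x) +_) (∑-swap xs ys f))
                             (≡-sym (∑-+ ys (f x) (λ y → ∑ xs (λ x → f x y))))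

∑-upper : ∀ (f : A → ℕ) {x xs} → x ∈ xs → f x ≤ ∑ xs f
∑-upper f (here refl) = m≤m+n _ _
∑-upper f {xs = y ∷ _} (there x∈) = ≤-trans (∑-upper f x∈) (m≤n+m _ (f y))

∑-upper₂ : ∀ (f : A → ℕ) {x y xs} → x ≢ y → x ∈ xs → y ∈ xs → f x + f y ≤ ∑ xs f
∑-upper₂ f x≢y (here refl) (here refl) = contradiction refl x≢y
∑-upper₂ f x≢y (here refl) (there y∈)  = +-monoʳ-≤ (f _) (∑-upper f y∈)
∑-upper₂ f x≢y (there x∈) (here refl)  = ≤-trans (≤-reflexive (+-comm (f _) (f _))) (+-monoʳ-≤ (f _) (∑-upper f x∈))
∑-upper₂ f x≢y (there {z} x∈) (there y∈) = ≤-trans (∑-upper₂ f x≢y x∈ y∈) (m≤n+m _ (f z))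

∑-↭ : ∀ {xs ys : List A} f → xs ↭ ys → ∑ xs f ≡ ∑ ys f
∑-↭ f p = sum-↭ (map⁺ f p)

∏-↭ : ∀ {xs ys : List A} f → xs ↭ ys → ∏ xs f ≡ ∏ ys f
∏-↭ f p = product-↭ (map⁺ f p)

∑-single : ∀ {xs : List A} {w f} → Unique xs → w ∈ xs →
           (∀ {x} → x ∈ xs → x ≢ w → f x ≡ 0) → ∑ xs f ≡ f w
∑-single {f = f} (x∉ ∷ _) (here refl) z =
  trans (cong (f _ +_) (∑-zero _ (λ y∈ → z (there y∈) (λ { refl → All.lookup x∉ y∈ refl }))))
        (+-identityʳ _)
∑-single (x∉ ∷ u) (there w∈) z =
  cong₂ _+_ (z (here refl) (All.lookup x∉ w∈)) (∑-single u w∈ (z ∘ there))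

∏-single : ∀ {xs : List A} {w f} → Unique xs → w ∈ xs →
           (∀ {x} → x ∈ xs → x ≢ w → f x ≡ 1) → ∏ xs f ≡ f w
∏-single {f = f} (x∉ ∷ _) (here refl) z =
  trans (cong (f _ *_) (∏-one _ (λ y∈ → z (there y∈) (λ { refl → All.lookup x∉ y∈ refl }))))
        (*-identityʳ _)
∏-single {f = f} (x∉ ∷ u) (there w∈) z =
  trans (cong₂ _*_ (z (here refl) (All.lookup x∉ w∈)) (∏-single u w∈ (z ∘ there)))
        (*-identityˡ _)

∑-filterᵇ : ∀ (p : A → Bool) f xs → ∑ (filterᵇ p xs) f ≡ ∑ xs (λ x → if p x then f x else 0)
∑-filterᵇ p f []       = refl
∑-filterᵇ p f (x ∷ xs) with p x
... | true  = cong (f x +_) (∑-filterᵇ p f xs)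
... | false = ∑-filterᵇ p f xs

∏-filterᵇ : ∀ (p : A → Bool) f xs → ∏ (filterᵇ p xs) f ≡ ∏ xs (λ x → if p x then f x else 1)
∏-filterᵇ p f []       = refl
∏-filterᵇ p f (x ∷ xs) with p x
... | true  = cong (f x *_) (∏-filterᵇ p f xs)
... | false = trans (∏-filterᵇ p f xs) (≡-sym (*-identityˡ _))

length-filterᵇ : ∀ (p : A → Bool) xs → length (filterᵇ p xs) ≡ ∑ xs (⟦_⟧ ∘ p)
length-filterᵇ p []       = refl
length-filterᵇ p (x ∷ xs) with p x
... | true  = cong suc (length-filterᵇ p xs)
... | false = length-filterᵇ p xs

∈-filterᵇ⁺ : ∀ (p : A → Bool) {x xs} → x ∈ xs → p x ≡ true → x ∈ filterᵇ p xs
∈-filterᵇ⁺ p {x} (here refl) e rewrite e = here refl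
∈-filterᵇ⁺ p {x} {y ∷ _} (there x∈) e with p y
... | true  = there (∈-filterᵇ⁺ p x∈ e)
... | false = ∈-filterᵇ⁺ p x∈ e

∈-filterᵇ⁻ : ∀ (p : A → Bool) {x} xs → x ∈ filterᵇ p xs → x ∈ xs × p x ≡ true
∈-filterᵇ⁻ p (y ∷ xs) x∈ with p y in e
∈-filterᵇ⁻ p (y ∷ xs) (here refl) | true = here refl , e
∈-filterᵇ⁻ p (y ∷ xs) (there x∈)  | true with x∈′ , e′ ← ∈-filterᵇ⁻ p xs x∈ = there x∈′ , e′
∈-filterᵇ⁻ p (y ∷ xs) x∈ | false with x∈′ , e′ ← ∈-filterᵇ⁻ p xs x∈ = there x∈′ , e′

Unique-filterᵇ : ∀ (p : A → Bool) {xs} → Unique xs → Unique (filterᵇ p xs)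
Unique-filterᵇ p {[]}     []       = []
Unique-filterᵇ p {x ∷ xs} (x∉ ∷ u) with p x
... | true  = All.tabulate (λ y∈ → All.lookup x∉ (proj₁ (∈-filterᵇ⁻ p xs y∈))) ∷ Unique-filterᵇ p u
... | false = Unique-filterᵇ p u

Unique-↭ : ∀ {xs ys : List A} → Unique xs → Unique ys →
           (∀ {x} → x ∈ xs → x ∈ ys) → (∀ {x} → x ∈ ys → x ∈ xs) → xs ↭ ys
Unique-↭ u v f g = ∼bag⇒↭ (unique∧set⇒bag u v (mk⇔ f g))

Unique⇒lookup-injective : ∀ {xs : List A} → Unique xs → ∀ {i j} → lookup xs i ≡ lookup xs j → i ≡ j
Unique⇒lookup-injective (x∉ ∷ u) {zero}  {zero}  e = refl
Unique⇒lookup-injective (x∉ ∷ u) {zero}  {suc j} e = contradiction e (All.lookup x∉ (∈-lookup j))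
Unique⇒lookup-injective (x∉ ∷ u) {suc i} {zero}  e = contradiction (≡-sym e) (All.lookup x∉ (∈-lookup i))
Unique⇒lookup-injective (x∉ ∷ u) {suc i} {suc j} e = cong suc (Unique⇒lookup-injective u e)

Unique⇒length≤ : ∀ {xs : List (Fin n)} → Unique xs → length xs ≤ n
Unique⇒length≤ u = injective⇒≤ (Unique⇒lookup-injective u)

bool-ext : ∀ {a b : Bool} → (a ≡ true → b ≡ true) → (b ≡ true → a ≡ true) → a ≡ b
bool-ext {true}  {b}     f g = ≡-sym (f refl)
bool-ext {false} {true}  f g = g refl
bool-ext {false} {false} f g = refl

true≢false : ∀ {b : Bool} → b ≡ true → b ≡ false → ⊥
true≢false refl ()

¬true⇒false : ∀ {b : Bool} → ¬ b ≡ true → b ≡ false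
¬true⇒false {true}  ¬e = contradiction refl ¬e
¬true⇒false {false} ¬e = refl

∨-split : ∀ a {b} → a ∨ b ≡ true → a ≡ true ⊎ b ≡ true
∨-split true  e = inj₁ refl
∨-split false e = inj₂ e

∧-split : ∀ a {b} → a ∧ b ≡ true → a ≡ true × b ≡ true
∧-split true e = refl , e

any-true⁻ : ∀ (p : A → Bool) xs → foldr _∨_ false (map p xs) ≡ true → ∃ λ x → x ∈ xs × p x ≡ true
any-true⁻ p (x ∷ xs) e with ∨-split (p x) e
... | inj₁ e′ = x , here refl , e′
... | inj₂ e′ with y , y∈ , q ← any-true⁻ p xs e′ = y , there y∈ , q

any-true⁺ : ∀ (p : A → Bool) {x xs} → x ∈ xs → p x ≡ true → foldr _∨_ false (map p xs) ≡ true
any-true⁺ p (here refl) e rewrite e = refl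
any-true⁺ p {xs = y ∷ _} (there x∈) e rewrite any-true⁺ p x∈ e = ∨-zeroʳ (p y)

-- Distance and eccentricity

-- The search loop of dist is local to its definition; unification recovers it here.
mutual
  search : ∀ {n} → Graph n → Fin n → Fin n → ℕ → ℕ → ℕ
  search = _

  dist-search : ∀ m (G : Graph (suc m)) u v →
                dist G u v ≡ (if reach G 0 u v then 0 else search G u v 1 m)
  dist-search m with suc m | 1
  ... | n | k = λ G u v → refl

module _ {n : ℕ} (G : Graph n) where

  Adj-sym : ∀ {u v} → Adj G u v → Adj G v u
  Adj-sym {u} {v} e = trans (sym G v u) e

  Adj-≢ : ∀ {u v} → Adj G u v → u ≢ v
  Adj-≢ {u} e refl = true≢false e (irrefl G u)

  snoc : ∀ {u w v k} → Walk G u w k → Adj G w v → Walk G u v (suc k)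
  snoc here       e = step e here
  snoc (step d p) e = step d (snoc p e)

  unsnoc : ∀ {u v k} → Walk G u v (suc k) → ∃ λ w → Walk G u w k × Adj G w v
  unsnoc (step e here) = _ , here , e
  unsnoc (step e p@(step _ _)) with w , q , d ← unsnoc p = w , step e q , d

  reach⇒walk : ∀ k {u v} → reach G k u v ≡ true → ∃ λ j → j ≤ k × Walk G u v j
  reach⇒walk zero {u} {v} e with toℕ-injective {i = u} {j = v} (≡ᵇ⇒≡ _ _ (subst T (≡-sym e) _))
  ... | refl = 0 , z≤n , here
  reach⇒walk (suc k) {u} {v} e with ∨-split (reach G k u v) e
  ... | inj₁ e′ with j , j≤ , p ← reach⇒walk k e′ = j , m≤n⇒m≤1+n j≤ , p
  ... | inj₂ e′ with w , _ , e″ ← any-true⁻ _ (allFin n) e′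
                with r , a ← ∧-split (reach G k u w) e″
                with j , j≤ , p ← reach⇒walk k r = suc j , s≤s j≤ , snoc p a

  walk⇒reach : ∀ {k j u v} → j ≤ k → Walk G u v j → reach G k u v ≡ true
  walk⇒reach {zero} {u = u} z≤n here = ≡ᵇ-refl (toℕ u)
    where
    ≡ᵇ-refl : ∀ m → (m ≡ᵇ m) ≡ true
    ≡ᵇ-refl zero    = refl
    ≡ᵇ-refl (suc m) = ≡ᵇ-refl m
  walk⇒reach {suc k} {zero} z≤n p rewrite walk⇒reach {k} z≤n p = refl
  walk⇒reach {suc k} {suc j} {u} {v} (s≤s j≤k) p with w , q , a ← unsnoc p =
    trans (cong (reach G k u v ∨_)
             (any-true⁺ _ (∈-allFin w) (cong₂ _∧_ (walk⇒reach j≤k q) a)))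
          (∨-zeroʳ (reach G k u v))

  -- The index never passes k, because the search certainly stops there; running out of fuel before
  -- also returns an index of at most k.
  search-≤ : ∀ {k u v} → reach G k u v ≡ true → ∀ f {i} → i ≤ k → search G u v i f ≤ k
  search-≤ r zero    i≤k = i≤k
  search-≤ {k} {u} {v} r (suc f) {i} i≤k with reach G i u v in e
  ... | true  = i≤k
  ... | false = search-≤ r f (≤∧≢⇒< i≤k (λ { refl → true≢false r e }))

  dist-≤ : ∀ {k u v} → Walk G u v k → dist G u v ≤ k
  dist-≤ p = search-≤ (walk⇒reach ≤-refl p) n z≤n

  search-≥ : ∀ {k u v} → (∀ {i} → i < k → ¬ Walk G u v i) →
             ∀ f {i} → k ≤ i + f → k ≤ search G u v i f
  search-≥ {k} ¬w zero {i} k≤ = subst (k ≤_) (+-identityʳ i) k≤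
  search-≥ {k} {u} {v} ¬w (suc f) {i} k≤ with reach G i u v in e
  ... | true with j , j≤i , p ← reach⇒walk i e = ≮⇒≥ (λ i<k → ¬w (≤-<-trans j≤i i<k) p)
  ... | false = search-≥ ¬w f (subst (k ≤_) (+-suc i f) k≤)

  -- The search gives up at n, so a lower bound k is visible only if k ≤ n. This is why the later
  -- lower bounds on eccentricities exhibit sufficiently many distinct vertices.
  dist-≥ : ∀ {k u v} → k ≤ n → (∀ {i} → i < k → ¬ Walk G u v i) → k ≤ dist G u v
  dist-≥ k≤n ¬w = search-≥ ¬w n k≤n

private
  ⊔-fold-upper : ∀ (f : A → ℕ) {x xs} → x ∈ xs → f x ≤ foldr _⊔_ 0 (map f xs)
  ⊔-fold-upper f (here refl) = m≤m⊔n _ _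
  ⊔-fold-upper f {xs = y ∷ _} (there x∈) = ≤-trans (⊔-fold-upper f x∈) (m≤n⊔m (f y) _)

  ⊔-fold-least : ∀ (f : A → ℕ) xs {m} → (∀ x → f x ≤ m) → foldr _⊔_ 0 (map f xs) ≤ m
  ⊔-fold-least f []       b = z≤n
  ⊔-fold-least f (x ∷ xs) b = ⊔-lub (b x) (⊔-fold-least f xs b)

module _ {n : ℕ} (G : Graph n) where

  dist≤ecc : ∀ u v → dist G u v ≤ ecc G u
  dist≤ecc u v = ⊔-fold-upper (dist G u) (∈-allFin v)

  ecc-lub : ∀ {u m} → (∀ v → dist G u v ≤ m) → ecc G u ≤ m
  ecc-lub {u} = ⊔-fold-least (dist G u) (allFin n)

  ecc≤diameter : ∀ u → ecc G u ≤ diameter G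
  ecc≤diameter u = ⊔-fold-upper (ecc G) (∈-allFin u)

  diameter-lub : ∀ {m} → (∀ u → ecc G u ≤ m) → diameter G ≤ m
  diameter-lub = ⊔-fold-least (ecc G) (allFin n)

  ecc-≤ : ∀ {u m} → (∀ v → ∃ λ k → k ≤ m × Walk G u v k) → ecc G u ≤ m
  ecc-≤ w = ecc-lub λ v → let k , k≤m , p = w v in ≤-trans (dist-≤ G p) k≤m

  ecc-≥ : ∀ {u k} v → k ≤ n → (∀ {i} → i < k → ¬ Walk G u v i) → k ≤ ecc G u
  ecc-≥ {u} v k≤n ¬w = ≤-trans (dist-≥ G k≤n ¬w) (dist≤ecc u v)

-- Bounds for 12 ξ

over12 : ℕ → ℚ
over12 a = (ℤ.+ a) /ℚ 12

/-mono : ∀ a b p q → a * suc q ≤ b * suc p → (ℤ.+ a) /ℚ suc p ≤ℚ (ℤ.+ b) /ℚ suc q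
/-mono a b p q h = ℚ.toℚᵘ-cancel-≤
  (ℚᵘ.≤-respˡ-≃ (ℚᵘ.≃-sym (ℚ.toℚᵘ-fromℚᵘ (ℚᵘ.mkℚᵘ (ℤ.+ a) p)))
   (ℚᵘ.≤-respʳ-≃ (ℚᵘ.≃-sym (ℚ.toℚᵘ-fromℚᵘ (ℚᵘ.mkℚᵘ (ℤ.+ b) q)))
     (ℚᵘ.*≤* (subst₂ ℤ._≤_ (ℤ.pos-* a (suc q)) (ℤ.pos-* b (suc p)) (ℤ.+≤+ h)))))

-- `_/ℚ_` normalises, so the sum is formed with unnormalised fractions, where its denominator is 144
-- = 12 · 12.
/12-+ : ∀ a b → over12 a +ℚ over12 b ≡ over12 (a + b)
/12-+ a b = ℚ.toℚᵘ-injective (begin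
  toℚᵘ (over12 a +ℚ over12 b)               ≈⟨ ℚ.toℚᵘ-homo-+ (over12 a) (over12 b) ⟩
  toℚᵘ (over12 a) ℚᵘ.+ toℚᵘ (over12 b)    ≈⟨ ℚᵘ.+-cong (ℚ.toℚᵘ-fromℚᵘ (frac a)) (ℚ.toℚᵘ-fromℚᵘ (frac b)) ⟩
  frac a ℚᵘ.+ frac b                          ≈⟨ ℚᵘ.*≡* (add (ℤ.+ a) (ℤ.+ b)) ⟩
  frac (a + b)                                ≈⟨ ℚᵘ.≃-sym (ℚ.toℚᵘ-fromℚᵘ (frac (a + b))) ⟩
  toℚᵘ (over12 (a + b))                     ∎)
  where
  frac : ℕ → ℚᵘ.ℚᵘ
  frac a = ℚᵘ.mkℚᵘ (ℤ.+ a) 11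
  open import Relation.Binary.Reasoning.Setoid ℚᵘ.≃-setoid
  add : ∀ x y → (x ℤ.* ℤ.+ 12 ℤ.+ y ℤ.* ℤ.+ 12) ℤ.* ℤ.+ 12 ≡ (x ℤ.+ y) ℤ.* ℤ.+ 144
  add x y = trans (cong (ℤ._* ℤ.+ 12) (≡-sym (ℤ.*-distribʳ-+ (ℤ.+ 12) x y))) (ℤ.*-assoc (x ℤ.+ y) (ℤ.+ 12) (ℤ.+ 12))

/12-< : ∀ {a b} → a < b → over12 a <ℚ over12 b
/12-< {a} {b} h = ℚ.toℚᵘ-cancel-<
  (ℚᵘ.<-respˡ-≃ (ℚᵘ.≃-sym (ℚ.toℚᵘ-fromℚᵘ (ℚᵘ.mkℚᵘ (ℤ.+ a) 11)))
   (ℚᵘ.<-respʳ-≃ (ℚᵘ.≃-sym (ℚ.toℚᵘ-fromℚᵘ (ℚᵘ.mkℚᵘ (ℤ.+ b) 11)))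
     (ℚᵘ.*<* (subst₂ ℤ._<_ (ℤ.pos-* a 12) (ℤ.pos-* b 12) (ℤ.+<+ (*-monoˡ-< 12 h))))))

module _ {n : ℕ} (G : Graph n) (w : Fin n → ℕ) where

  private
    term : Fin n → ℚ
    term u = (ℤ.+ M G u) /ℚ suc (ecc G u ∸ 1)

    scale-≤ : ∀ {a b c d} m → a * b ≤ c * d → (a * m) * b ≤ (c * m) * d
    scale-≤ {a} {b} {c} {d} m h = subst₂ _≤_ (rearr m a b) (rearr m c d) (*-monoʳ-≤ m h)
      where
      rearr : ∀ m a b → m * (a * b) ≡ (a * m) * b
      rearr = solve 3 (λ m a b → m :* (a :* b) := (a :* m) :* b) refl

  -- `w` replaces 12 / ε, so a lower bound on each eccentricity is enough for an upper bound on ξ: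
  -- weight 6 belongs to ε ≥ 2 and weight 4 to ε ≥ 3. With the common denominator 12 a sum of
  -- naturals remains.
  xi-upper : (∀ u → 12 ≤ w u * suc (ecc G u ∸ 1)) → xi G ≤ℚ over12 (∑ (allFin n) λ u → w u * M G u)
  xi-upper h = go (allFin n)
    where
    go : ∀ us → foldr _+ℚ_ 0ℚ (map term us) ≤ℚ over12 (∑ us λ u → w u * M G u)
    go []       = ℚ.≤-refl
    go (u ∷ us) = subst (_ ≤ℚ_) (/12-+ (w u * M G u) _)
      (ℚ.+-mono-≤ (/-mono (M G u) (w u * M G u) (ecc G u ∸ 1) 11
         (subst (_≤ (w u * M G u) * suc (ecc G u ∸ 1)) (trans (*-identityʳ (12 * M G u)) (*-comm 12 (M G u)))
           (scale-≤ {12} {1} {w u} {suc (ecc G u ∸ 1)} (M G u) (h u)))) (go us))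

  xi-lower : (∀ u → w u * suc (ecc G u ∸ 1) ≤ 12) → over12 (∑ (allFin n) λ u → w u * M G u) ≤ℚ xi G
  xi-lower h = go (allFin n)
    where
    go : ∀ us → over12 (∑ us λ u → w u * M G u) ≤ℚ foldr _+ℚ_ 0ℚ (map term us)
    go []       = ℚ.≤-refl
    go (u ∷ us) = subst (_≤ℚ _) (/12-+ (w u * M G u) _)
      (ℚ.+-mono-≤ (/-mono (w u * M G u) (M G u) 11 (ecc G u ∸ 1)
         (subst ((w u * M G u) * suc (ecc G u ∸ 1) ≤_) (trans (*-identityʳ (12 * M G u)) (*-comm 12 (M G u)))
           (scale-≤ {w u} {suc (ecc G u ∸ 1)} {12} {1} (M G u) (h u)))) (go us))

-- Trees grown one leaf at a time

module _ {n : ℕ} (G : Graph n) where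

  data NonBacktracking : List (Fin n) → Set where
    edge : ∀ {x y} → Adj G x y → NonBacktracking (x ∷ y ∷ [])
    turn : ∀ {x y z zs} → Adj G x y → x ≢ z →
           NonBacktracking (y ∷ z ∷ zs) → NonBacktracking (x ∷ y ∷ z ∷ zs)

  private
    linked-prefix : ∀ {x} ys {zs} → NonBacktracking (ys ++ x ∷ zs) → Linked (Adj G) (ys ++ [ x ])
    linked-prefix []               p           = [-]
    linked-prefix (y ∷ [])         (edge a)    = a ∷ [-]
    linked-prefix (y ∷ [])         (turn a _ p) = a ∷ [-]
    linked-prefix (y ∷ y′ ∷ [])    (turn a _ p) = a ∷ linked-prefix (y′ ∷ []) p
    linked-prefix (y ∷ y′ ∷ _ ∷ _) (turn a _ p) = a ∷ linked-prefix (y′ ∷ _ ∷ _) p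

    unique-prefix : ∀ ys {x : Fin n} {zs} → Unique (ys ++ x ∷ zs) → x ∉ ys × Unique ys
    unique-prefix []       u        = (λ ()) , []
    unique-prefix (y ∷ ys) {x} (y∉ ∷ u) with x∉ , u′ ← unique-prefix ys u =
      (λ { (here refl) → All.lookup y∉ (∈-++⁺ʳ ys (here refl)) refl ; (there x∈) → x∉ x∈ }) ,
      (All.tabulate (λ z∈ → All.lookup y∉ (∈-++⁺ˡ z∈)) ∷ u′)

    -- The piece of the walk up to the return to x is a loop, an edge traversed back and forth, or a
    -- cycle, according to whether zero, one or more vertices lie in between.
    no-return : (HasCycle G → ⊥) → ∀ {x xs} → Unique xs → NonBacktracking (x ∷ xs) → x ∉ xs
    no-return acyclic {x} u p x∈ with ∈-∃++ x∈
    ... | [] , _ , refl with p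
    ...   | edge a    = Adj-≢ G a refl
    ...   | turn a _ _ = Adj-≢ G a refl
    no-return acyclic {x} u p x∈ | (y ∷ []) , _ , refl with turn _ x≢x _ ← p = x≢x refl
    no-return acyclic {x} u p x∈ | ys@(_ ∷ _ ∷ _) , _ , refl with x∉ , u′ ← unique-prefix ys u =
      acyclic (x , ys , s≤s (s≤s z≤n) , All.tabulate (λ { z∈ refl → x∉ z∈ }) ∷ u′ , linked-prefix (x ∷ ys) p)

  -- In an acyclic graph a condition on three consecutive vertices already excludes all repetitions.
  -- Short closed walks around a centre can then be refuted by writing them down, without building a
  -- `HasCycle` each time.
  nonBacktracking⇒Unique : (HasCycle G → ⊥) → ∀ {xs} → NonBacktracking xs → Unique xs
  nonBacktracking⇒Unique acyclic (edge a) = (Adj-≢ G a ∷ []) ∷ [] ∷ []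
  nonBacktracking⇒Unique acyclic p@(turn a _ q) with u ← nonBacktracking⇒Unique acyclic q =
    All.tabulate (λ { z∈ refl → no-return acyclic u p z∈ }) ∷ u

  -- The list records an order of attachment, newest vertex first. A new vertex has exactly one
  -- neighbour among those present, so induction along the list adds one leaf at a time.
  data Grown : List (Fin n) → Set where
    root : ∀ r → Grown [ r ]
    grow : ∀ {x w L} → Grown L → x ∉ L → w ∈ L → Adj G x w →
           (∀ {v} → v ∈ L → Adj G x v → v ≡ w) → Grown (x ∷ L)

  Grown⇒Unique : ∀ {L} → Grown L → Unique L
  Grown⇒Unique (root r)           = [] ∷ []
  Grown⇒Unique (grow g x∉ _ _ _) = All.tabulate (λ { z∈ refl → x∉ z∈ }) ∷ Grown⇒Unique g

  data Path (L : List (Fin n)) : Fin n → Fin n → List (Fin n) → Set where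
    stop : ∀ {a} → a ∈ L → Path L a a [ a ]
    cons : ∀ {a b c p} → a ∈ L → a ∉ p → Adj G a c → Path L c b p → Path L a b (a ∷ p)

  private
    path-⊆ : ∀ {L a b p} → Path L a b p → ∀ {v} → v ∈ p → v ∈ L
    path-⊆ (stop a∈)       (here refl) = a∈
    path-⊆ (cons a∈ _ _ p) (here refl) = a∈
    path-⊆ (cons a∈ _ _ p) (there v∈)  = path-⊆ p v∈

    path-weaken : ∀ {L x a b p} → Path L a b p → Path (x ∷ L) a b p
    path-weaken (stop a∈)        = stop (there a∈)
    path-weaken (cons a∈ a∉ e p) = cons (there a∈) a∉ e (path-weaken p)

    path-snoc : ∀ {L a b c p} → Path L a b p → c ∉ p → c ∈ L → Adj G b c → Path L a c (p ++ [ c ])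
    path-snoc (stop a∈) c∉ c∈ e = cons a∈ (λ { (here refl) → c∉ (here refl) }) e (stop c∈)
    path-snoc {p = a ∷ p} (cons a∈ a∉ d q) c∉ c∈ e =
      cons a∈ (λ a∈′ → case ∈-++⁻ p a∈′ of λ { (inj₁ a∈p) → a∉ a∈p ; (inj₂ (here refl)) → c∉ (here refl) }) d
        (path-snoc q (c∉ ∘ there) c∈ e)

    path-unique : ∀ {L a b p} → Path L a b p → Unique p
    path-unique (stop _)        = [] ∷ []
    path-unique (cons _ a∉ _ p) = All.tabulate (λ { z∈ refl → a∉ z∈ }) ∷ path-unique p

    path-linked : ∀ {L x y a b p} → Adj G x a → Path L a b p → Adj G b y → Linked (Adj G) (x ∷ p ++ [ y ])
    path-linked d (stop _)       e = d ∷ e ∷ [-]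
    path-linked d (cons _ _ f p) e = d ∷ path-linked f p e

    path-length : ∀ {L a b p} → Path L a b p → a ≢ b → 2 ≤ length p
    path-length (stop _)                  a≢b = contradiction refl a≢b
    path-length (cons _ _ _ (stop _))       _ = s≤s (s≤s z≤n)
    path-length (cons _ _ _ (cons _ _ _ _)) _ = s≤s (s≤s z≤n)

    path-exists : ∀ {L} → Grown L → ∀ {a b} → a ∈ L → b ∈ L → ∃ (Path L a b)
    path-exists (root r) (here refl) (here refl) = _ , stop (here refl)
    path-exists (grow g x∉ w∈ e _) (here refl) (here refl) = _ , stop (here refl)
    path-exists (grow g x∉ w∈ e _) (here refl) (there b∈) with _ , p ← path-exists g w∈ b∈ =
      _ , cons (here refl) (λ x∈ → x∉ (path-⊆ p x∈)) e (path-weaken p)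
    path-exists (grow g x∉ w∈ e _) (there a∈) (here refl) with _ , p ← path-exists g a∈ w∈ =
      _ , path-snoc (path-weaken p) (λ x∈ → x∉ (path-⊆ p x∈)) (here refl) (Adj-sym G e)
    path-exists (grow g x∉ w∈ e _) (there a∈) (there b∈) with _ , p ← path-exists g a∈ b∈ =
      _ , path-weaken p

  open import Data.List.Membership.DecPropositional (_≟_ {n}) using (_∈?_)

  private
    exit-edge : ∀ {L u v k} → Walk G u v k → u ∈ L → v ∉ L → ∃₂ λ w x → w ∈ L × x ∉ L × Adj G x w
    exit-edge here v∈ v∉ = contradiction v∈ v∉
    exit-edge {L} (step {w = x} e p) u∈ v∉ with x ∈? L
    ... | yes x∈ = exit-edge p x∈ v∉
    ... | no  x∉ = _ , x , u∈ , x∉ , Adj-sym G e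

    -- Connectedness provides an edge leaving `L`. A second neighbour of the new vertex in `L` would
    -- be joined to the first by a path inside `L`, which closes to a cycle through the new vertex.
    grow-step : IsTree G → ∀ {L r v} → Grown L → r ∈ L → v ∉ L → ∃ λ x → Grown (x ∷ L)
    grow-step (conn , acyclic) {L} {r} {v} g r∈ v∉
      with w , x , w∈ , x∉ , e ← exit-edge (proj₂ (conn r v)) r∈ v∉ = x , grow g x∉ w∈ e only
      where
      only : ∀ {y} → y ∈ L → Adj G x y → y ≡ w
      only {y} y∈ d with y ≟ w
      ... | yes y≡w = y≡w
      ... | no  y≢w with _ , p ← path-exists g y∈ w∈ =
        ⊥-elim (acyclic (x , _ , path-length p y≢w ,
          All.tabulate (λ { z∈ refl → x∉ (path-⊆ p z∈) }) ∷ path-unique p , path-linked d p (Adj-sym G e)))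

  grow-all : IsTree G → Fin n → ∃ λ L → Grown L × (∀ v → v ∈ L)
  grow-all t r = loop n (root r) (here refl) (m≤m+n n 1)
    where
    loop : ∀ fuel {L} → Grown L → r ∈ L → n ≤ fuel + length L → ∃ λ L → Grown L × (∀ v → v ∈ L)
    loop fuel {L} g r∈ h with all? (_∈? L)
    ... | yes full = L , g , full
    ... | no ¬full with v , v∉ ← ¬∀⟶∃¬ n (_∈ L) (_∈? L) ¬full with fuel
    -- Without fuel the invariant says that `L` already has n distinct entries, and v would be one
    -- more.
    ...   | zero = contradiction
      (≤-trans (Unique⇒length≤ (All.tabulate (λ { z∈ refl → v∉ z∈ }) ∷ Grown⇒Unique g)) h) 1+n≰n
    ...   | suc fuel with x , g′ ← grow-step t g r∈ v∉ =
      loop fuel g′ (there r∈) (subst (n ≤_) (≡-sym (+-suc fuel (length L))) h)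

  -- Two predicates instead of one colouring: exchanging the arguments exchanges the classes, so
  -- whatever is proved for one class is available for the other.
  record Bipartition (a b : Fin n → Bool) : Set where
    field
      side : ∀ v → (a v ≡ true × b v ≡ false) ⊎ (a v ≡ false × b v ≡ true)
      a⇒b  : ∀ {u v} → Adj G u v → a u ≡ true → b v ≡ true
      b⇒a  : ∀ {u v} → Adj G u v → b u ≡ true → a v ≡ true

  flip-Bipartition : ∀ {a b} → Bipartition a b → Bipartition b a
  flip-Bipartition bp = record
    { side = λ v → case side v of λ { (inj₁ (p , q)) → inj₂ (q , p) ; (inj₂ (p , q)) → inj₁ (q , p) }
    ; a⇒b = b⇒a ; b⇒a = a⇒b }
    where open Bipartition bp

  private
    colour : ∀ {L} → Grown L → ∃ λ (c : Fin n → Bool) → ∀ {u v} → u ∈ L → v ∈ L → Adj G u v → c v ≡ not (c u)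
    colour (root r) = (λ _ → true) , λ { (here refl) (here refl) e → contradiction refl (Adj-≢ G e) }
    colour (grow {x} {w} {L} g x∉ w∈ e only) with c , proper ← colour g = c′ , proper′
      where
      c′ : Fin n → Bool
      c′ v with v ≟ x
      ... | yes _ = not (c w)
      ... | no  _ = c v
      proper′ : ∀ {u v} → u ∈ x ∷ L → v ∈ x ∷ L → Adj G u v → c′ v ≡ not (c′ u)
      proper′ {u} {v} u∈ v∈ d with u ≟ x | v ≟ x
      ... | yes refl | yes refl = contradiction refl (Adj-≢ G d)
      ... | no  u≢   | no  v≢   = proper (Any.tail u≢ u∈) (Any.tail v≢ v∈) d
      ... | yes refl | no  v≢ with refl ← only (Any.tail v≢ v∈) d = ≡-sym (not-involutive (c w))
      ... | no  u≢   | yes refl with refl ← only (Any.tail u≢ u∈) (Adj-sym G d) = refl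

  bipartition : IsTree G → Fin n → ∃₂ Bipartition
  bipartition t r with L , g , full ← grow-all t r with c , proper ← colour g = c , not ∘ c , record
    { side = λ v → sides (c v)
    ; a⇒b  = λ {u} {v} e p → trans (cong not (proper (full u) (full v) e)) (cong (not ∘ not) p)
    ; b⇒a  = λ {u} {v} e p → trans (proper (full u) (full v) e) p }
    where
    sides : ∀ b → (b ≡ true × not b ≡ false) ⊎ (b ≡ false × not b ≡ true)
    sides true  = inj₁ (refl , refl)
    sides false = inj₂ (refl , refl)

module _ {n : ℕ} (G : Graph n) {a b : Fin n → Bool} (bp : Bipartition G a b) where

  open Bipartition bp

  private
    a-b : ∀ {v} → a v ≡ true → b v ≡ false
    a-b {v} p with side v
    ... | inj₁ (_ , q) = q
    ... | inj₂ (q , _) = ⊥-elim (true≢false p q)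

    not-aa : ∀ {u v} → a u ≡ true → a v ≡ true → adj G u v ≡ false
    not-aa p q = ¬true⇒false λ e → true≢false (a⇒b e p) (a-b q)

    not-bb : ∀ {u v} → b u ≡ true → b v ≡ true → adj G u v ≡ false
    not-bb p q = ¬true⇒false λ e → true≢false q (a-b (b⇒a e p))

  degIn : List (Fin n) → Fin n → ℕ
  degIn L u = ∑ L λ v → ⟦ adj G u v ⟧

  private
    leaf-∑ : ∀ {x w L} (f : Fin n → ℕ) → Unique L → w ∈ L → Adj G x w → (∀ {v} → v ∈ L → Adj G x v → v ≡ w) →
             ∑ L (λ v → if adj G x v then f v else 0) ≡ f w
    leaf-∑ {x} {w} {L} f u w∈ e only = trans
      (∑-single u w∈ λ {v} v∈ v≢w → cong (λ t → if t then f v else 0) (¬true⇒false (λ d → v≢w (only v∈ d))))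
      (cong (λ t → if t then f w else 0) e)

    leaf-∏ : ∀ {x w L} (f : Fin n → ℕ) → Unique L → w ∈ L → Adj G x w → (∀ {v} → v ∈ L → Adj G x v → v ≡ w) →
             ∏ L (λ v → if adj G x v then f v else 1) ≡ f w
    leaf-∏ {x} {w} {L} f u w∈ e only = trans
      (∏-single u w∈ λ {v} v∈ v≢w → cong (λ t → if t then f v else 1) (¬true⇒false (λ d → v≢w (only v∈ d))))
      (cong (λ t → if t then f w else 1) e)

  -- Every edge has exactly one end in class `b`, so the sum counts edges, and each new leaf
  -- contributes one edge and one vertex.
  edge-count : ∀ {L} → Grown G L → suc (∑ L λ v → if b v then degIn L v else 0) ≡ length L
  edge-count (root r) with b r
  ... | true  rewrite irrefl G r = refl
  ... | false = refl
  edge-count (grow {x} {w} {L} g x∉ w∈ e only) with side x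
  ... | inj₂ (ax , bx) rewrite bx | irrefl G x = cong suc (trans (cong₂ _+_
          (leaf-∑ (λ _ → 1) (Grown⇒Unique G g) w∈ e only)
          (∑-cong L λ {v} _ → same v))
        (edge-count g))
    where
    same : ∀ v → (if b v then ⟦ adj G v x ⟧ + degIn L v else 0) ≡ (if b v then degIn L v else 0)
    same v with b v in bv
    ... | true  rewrite not-bb bv bx = refl
    ... | false = refl
  ... | inj₁ (ax , bx) rewrite bx = cong suc (trans (∑-cong L λ {v} _ → split v)
      (trans (∑-+ L (λ v → if adj G x v then 1 else 0) (λ v → if b v then degIn L v else 0))
        (trans (cong (_+ _) (leaf-∑ (λ _ → 1) (Grown⇒Unique G g) w∈ e only)) (edge-count g))))
    where
    split : ∀ v → (if b v then ⟦ adj G v x ⟧ + degIn L v else 0)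
                  ≡ ⟦ adj G x v ⟧ + (if b v then degIn L v else 0)
    split v rewrite sym G v x with b v in bv | adj G x v in d
    ... | true  | _     = refl
    ... | false | false = refl
    ... | false | true  = ⊥-elim (true≢false (a⇒b d ax) bv)

  module _ (δ : Fin n → ℕ) (δ≥1 : ∀ v → 1 ≤ δ v) where

    prodIn : List (Fin n) → Fin n → ℕ
    prodIn L u = ∏ L λ v → if adj G u v then δ v else 1

    private
      -- For δ = `deg` and `L` all vertices, S is the sum of M over class a, while D, P and Q are
      -- the sum, the product and the sum of squares of the degrees in class b.
      S P D Q : List (Fin n) → ℕ
      S L = ∑ L λ u → if a u then prodIn L u else 0
      D L = ∑ L λ v → if b v then δ v else 0
      P L = ∏ L λ v → if b v then δ v else 1
      Q L = ∑ L λ v → if b v then δ v * degIn L v else 0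

      prodIn≤P : ∀ L {u} → a u ≡ true → prodIn L u ≤ P L
      prodIn≤P L {u} au = ∏-mono L λ {v} _ → le v
        where
        le : ∀ v → (if adj G u v then δ v else 1) ≤ (if b v then δ v else 1)
        le v with adj G u v in e | b v in bv
        ... | true  | true  = ≤-refl
        ... | true  | false = ⊥-elim (true≢false (a⇒b e au) bv)
        ... | false | true  = δ≥1 v
        ... | false | false = ≤-refl

    -- With the weights δ kept fixed while the tree grows, a new leaf in class a adds the same amount
    -- to both sides, and a new leaf in class b multiplies one prodIn on the left but all of P on the right.
    prodIn-sum-≤ : ∀ {L} → Grown G L → S L + D L ≤ P L + Q L
    prodIn-sum-≤ (root r) with side r
    ... | inj₁ (ar , br) rewrite ar | br | irrefl G r = ≤-refl
    ... | inj₂ (ar , br) rewrite ar | br | irrefl G r | *-zeroʳ (δ r) | *-identityʳ (δ r) = ≤-refl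
    prodIn-sum-≤ (grow {x} {w} {L} g x∉ w∈ e only) with side x
    ... | inj₁ (ax , bx) rewrite ax | bx | irrefl G x = begin
        1 * prodIn L x + ∑ L (λ u → if a u then (if adj G u x then δ x else 1) * prodIn L u else 0) + D L
          ≡⟨ cong (_+ D L) (cong₂ _+_ (trans (*-identityˡ _) (leaf-∏ δ (Grown⇒Unique G g) w∈ e only)) (∑-cong L λ {u} _ → same u)) ⟩
        δ w + S L + D L
          ≡⟨ +-assoc (δ w) (S L) (D L) ⟩
        δ w + (S L + D L)
          ≤⟨ +-monoʳ-≤ (δ w) (prodIn-sum-≤ g) ⟩
        δ w + (P L + Q L)
          ≡⟨ rearr (δ w) (P L) (Q L) ⟩
        1 * P L + (δ w + Q L)
          ≡⟨ cong (1 * P L +_) (≡-sym (trans (∑-cong L λ {v} _ → split v) (trans (∑-+ L _ _) (cong (_+ Q L) (leaf-∑ δ (Grown⇒Unique G g) w∈ e only))))) ⟩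
        1 * P L + ∑ L (λ v → if b v then δ v * (⟦ adj G v x ⟧ + degIn L v) else 0) ∎
      where
      open ≤-Reasoning
      rearr : ∀ x y z → x + (y + z) ≡ 1 * y + (x + z)
      rearr = solve 3 (λ x y z → x :+ (y :+ z) := con 1 :* y :+ (x :+ z)) refl
      same : ∀ u → (if a u then (if adj G u x then δ x else 1) * prodIn L u else 0) ≡ (if a u then prodIn L u else 0)
      same u with a u in au
      ... | true  rewrite not-aa au ax = *-identityˡ _
      ... | false = refl
      split : ∀ v → (if b v then δ v * (⟦ adj G v x ⟧ + degIn L v) else 0)
                    ≡ (if adj G x v then δ v else 0) + (if b v then δ v * degIn L v else 0)
      split v rewrite sym G v x with b v in bv | adj G x v in d
      ... | true  | true  = *-suc (δ v) (degIn L v)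
      ... | true  | false = refl
      ... | false | false = refl
      ... | false | true  = ⊥-elim (true≢false (a⇒b d ax) bv)
    ... | inj₂ (ax , bx) rewrite ax | bx | irrefl G x = begin
        ∑ L (λ u → if a u then (if adj G u x then δ x else 1) * prodIn L u else 0) + (δ x + D L)
          ≡⟨ cong (_+ (δ x + D L)) (trans (∑-cong L λ {u} _ → split u)
               (trans (∑-+ L _ _) (cong (_+ S L) (leaf-∑ (λ u → pred (δ x) * prodIn L u) (Grown⇒Unique G g) w∈ e only)))) ⟩
        pred (δ x) * prodIn L w + S L + (δ x + D L)
          ≡⟨ rearr (pred (δ x) * prodIn L w) (S L) (δ x) (D L) ⟩
        pred (δ x) * prodIn L w + δ x + (S L + D L)
          ≤⟨ +-mono-≤ (+-monoˡ-≤ (δ x) (*-monoʳ-≤ (pred (δ x)) (prodIn≤P L (b⇒a e bx)))) (prodIn-sum-≤ g) ⟩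
        pred (δ x) * P L + δ x + (P L + Q L)
          ≡⟨ rearr′ (pred (δ x)) (P L) (δ x) (Q L) ⟩
        suc (pred (δ x)) * P L + (δ x * 1 + Q L)
          ≡⟨ cong₂ (λ i j → i * P L + (δ x * j + Q L)) suc-pred-δ (≡-sym (leaf-∑ (λ _ → 1) (Grown⇒Unique G g) w∈ e only)) ⟩
        δ x * P L + (δ x * degIn L x + Q L)
          ≡⟨ cong (λ q → δ x * P L + (δ x * degIn L x + q)) (∑-cong L λ {v} _ → same v) ⟩
        δ x * P L + (δ x * degIn L x + ∑ L (λ v → if b v then δ v * (⟦ adj G v x ⟧ + degIn L v) else 0)) ∎
      where
      open ≤-Reasoning
      suc-pred-δ : suc (pred (δ x)) ≡ δ x
      suc-pred-δ = suc-pred-≥1 (δ≥1 x)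
      rearr : ∀ x y z t → x + y + (z + t) ≡ x + z + (y + t)
      rearr = +-interchange
      rearr′ : ∀ x y z t → x * y + z + (y + t) ≡ suc x * y + (z * 1 + t)
      rearr′ = solve 4 (λ x y z t → x :* y :+ z :+ (y :+ t) := (con 1 :+ x) :* y :+ (z :* con 1 :+ t)) refl
      same : ∀ v → (if b v then δ v * degIn L v else 0) ≡ (if b v then δ v * (⟦ adj G v x ⟧ + degIn L v) else 0)
      same v with b v in bv
      ... | true  rewrite not-bb bv bx = refl
      ... | false = refl
      split : ∀ u → (if a u then (if adj G u x then δ x else 1) * prodIn L u else 0)
                    ≡ (if adj G x u then pred (δ x) * prodIn L u else 0) + (if a u then prodIn L u else 0)
      split u rewrite sym G u x with a u in au | adj G x u in d
      ... | true  | true  = trans (cong (_* prodIn L u) (≡-sym suc-pred-δ)) (+-comm (prodIn L u) _)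
      ... | true  | false = *-identityˡ _
      ... | false | false = refl
      ... | false | true  = ⊥-elim (true≢false (b⇒a d bx) au)

-- Degrees in the two colour classes

module _ {n : ℕ} (G : Graph n) where

  classDegrees : (Fin n → Bool) → List ℕ
  classDegrees a = map (deg G) (filterᵇ a (allFin n))

module _ {n : ℕ} (G : Graph n) (t : IsTree G) (deg≥1 : ∀ v → 1 ≤ deg G v) (r : Fin n)
         {a b : Fin n → Bool} (bp : Bipartition G a b) where

  private
    spanning = grow-all G t r
    L = proj₁ spanning
    g = proj₁ (proj₂ spanning)
    L↭ : L ↭ allFin n
    L↭ = Unique-↭ (Grown⇒Unique G g) (allFin⁺ n) (λ _ → ∈-allFin _) (λ _ → proj₂ (proj₂ spanning) _)

    degIn≡deg : ∀ v → degIn G bp L v ≡ deg G v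
    degIn≡deg v = ∑-↭ _ L↭

    length-allFin : length (allFin n) ≡ n
    length-allFin = length-tabulate (λ i → i)

  sum-classDegrees : suc (sum (classDegrees G b)) ≡ n
  sum-classDegrees = begin
    suc (∑ (filterᵇ b (allFin n)) (deg G))                  ≡⟨ cong suc (∑-filterᵇ b (deg G) (allFin n)) ⟩
    suc (∑ (allFin n) (λ v → if b v then deg G v else 0))  ≡⟨ cong suc (∑-↭ _ (↭-sym L↭)) ⟩
    suc (∑ L (λ v → if b v then deg G v else 0))           ≡⟨ cong suc (∑-cong L λ {v} _ → cong (λ d → if b v then d else 0) (≡-sym (degIn≡deg v))) ⟩
    suc (∑ L (λ v → if b v then degIn G bp L v else 0))    ≡⟨ edge-count G bp g ⟩
    length L                                               ≡⟨ ↭-length L↭ ⟩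
    length (allFin n)                                      ≡⟨ length-allFin ⟩
    n ∎
    where open ≡-Reasoning

  -- `prodIn-sum-≤` for the complete tree with δ = `deg`. The degree sum stands on the left and
  -- squares on the right, which avoids the subtraction in d (d - 1).
  class-M-≤ : ∑ (filterᵇ a (allFin n)) (M G) + sum (classDegrees G b) ≤
              product (classDegrees G b) + ∑ (classDegrees G b) (λ d → d * d)
  class-M-≤ = subst₂ _≤_
    (cong₂ _+_
      (trans (∑-cong L λ {u} _ → cong (λ m → if a u then m else 0) (∏-↭ (λ v → if adj G u v then deg G v else 1) L↭))
        (trans (∑-↭ _ L↭) (≡-sym (∑-filterᵇ a (M G) (allFin n)))))
      (trans (∑-↭ _ L↭) (≡-sym (∑-filterᵇ b (deg G) (allFin n)))))
    (cong₂ _+_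
      (trans (∏-↭ _ L↭) (≡-sym (∏-filterᵇ b (deg G) (allFin n))))
      (trans (∑-cong L λ {v} _ → cong (λ d → if b v then deg G v * d else 0) (degIn≡deg v))
        (trans (∑-↭ _ L↭) (trans (≡-sym (∑-filterᵇ b (λ v → deg G v * deg G v) (allFin n)))
          (cong sum (map-∘ (filterᵇ b (allFin n))))))))
    (prodIn-sum-≤ G bp (deg G) deg≥1 g)

  length-classDegrees : length (classDegrees G a) + length (classDegrees G b) ≡ n
  length-classDegrees = begin
    length (classDegrees G a) + length (classDegrees G b)
      ≡⟨ cong₂ _+_ (trans (length-map (deg G) (filterᵇ a (allFin n))) (length-filterᵇ a (allFin n))) (trans (length-map (deg G) (filterᵇ b (allFin n))) (length-filterᵇ b (allFin n))) ⟩
    ∑ (allFin n) (λ v → ⟦ a v ⟧) + ∑ (allFin n) (λ v → ⟦ b v ⟧)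
      ≡⟨ ≡-sym (∑-+ (allFin n) _ _) ⟩
    ∑ (allFin n) (λ v → ⟦ a v ⟧ + ⟦ b v ⟧)
      ≡⟨ ∑-cong (allFin n) (λ {v} _ → one v) ⟩
    ∑ (allFin n) (λ v → 1)
      ≡⟨ ∑-ones (allFin n) ⟩
    length (allFin n)
      ≡⟨ length-allFin ⟩
    n ∎
    where
    open ≡-Reasoning
    open Bipartition bp
    one : ∀ v → ⟦ a v ⟧ + ⟦ b v ⟧ ≡ 1
    one v with side v
    ... | inj₁ (p , q) rewrite p | q = refl
    ... | inj₂ (p , q) rewrite p | q = refl

  ∑-class : ∀ f → ∑ (allFin n) f ≡ ∑ (filterᵇ a (allFin n)) f + ∑ (filterᵇ b (allFin n)) f
  ∑-class f = trans (∑-cong (allFin n) λ {v} _ → split v)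
    (trans (∑-+ (allFin n) (λ v → if a v then f v else 0) (λ v → if b v then f v else 0))
      (cong₂ _+_ (≡-sym (∑-filterᵇ a f (allFin n))) (≡-sym (∑-filterᵇ b f (allFin n)))))
    where
    open Bipartition bp
    split : ∀ v → f v ≡ (if a v then f v else 0) + (if b v then f v else 0)
    split v with side v
    ... | inj₁ (p , q) rewrite p | q = ≡-sym (+-identityʳ _)
    ... | inj₂ (p , q) rewrite p | q = refl

-- Positive integers with a given sum

pairSum : List ℕ → ℕ
pairSum ds = ∑ ds λ d → d * pred d

-- 12 ξ for a tree of diameter 4 in which the neighbours of the centre have degrees ds
Φ : List ℕ → ℕ
Φ ds = 6 * product ds + 4 * (length ds * length ds) + 3 * pairSum ds

starValue : ℕ → ℕ
starValue s = 12 + 6 * (s * s)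

Positive : List ℕ → Set
Positive = All (1 ≤_)

-- For s ≥ 2 these are 3s and at most two 2s, the degrees around the centre of the extremal tree.
-- The recursion must not reach 1, hence the separate clause 4 = 2 + 2.
balanced : ℕ → List ℕ
balanced 0 = []
balanced 1 = 1 ∷ []
balanced 2 = 2 ∷ []
balanced 3 = 3 ∷ []
balanced 4 = 2 ∷ 2 ∷ []
balanced (suc (suc (suc s@(suc (suc _))))) = 3 ∷ balanced s

-- three times the largest product of positive integers with sum s (if s ≥ 2)
top : ℕ → ℕ
top 0 = 3
top 1 = 4
top 2 = 6
top (suc (suc (suc s))) = 3 * top s

Φ-↭ : ∀ {ds es} → ds ↭ es → Φ ds ≡ Φ es
Φ-↭ p = cong₂ _+_ (cong₂ (λ x k → 6 * x + 4 * (k * k)) (product-↭ p) (↭-length p)) (cong (3 *_) (∑-↭ _ p))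

square-sum : ∀ ds → ∑ ds (λ d → d * d) ≡ pairSum ds + sum ds
square-sum []       = refl
square-sum (d ∷ ds) = trans (cong₂ _+_ (square d) (square-sum ds))
  (+-interchange (d * pred d) d (pairSum ds) (sum ds))
  where
  square : ∀ d → d * d ≡ d * pred d + d
  square zero    = refl
  square (suc d) = trans (*-suc (suc d) d) (+-comm (suc d) (suc d * d))

length≤sum : ∀ {ds} → Positive ds → length ds ≤ sum ds
length≤sum []        = z≤n
length≤sum (p ∷ pos) = +-mono-≤ p (length≤sum pos)

-- By convexity the sum of d (d - 1) is largest when the whole excess e of sum over length sits in
-- one part e + 1. Splitting off a part `suc t` loses the cross term 2 t e′.
pairSum-≤ : ∀ {ds} e → Positive ds → sum ds ≡ e + length ds → pairSum ds ≤ e * suc e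
pairSum-≤ e [] _ = z≤n
pairSum-≤ {suc t ∷ ds} e (_ ∷ pos) eq = begin
  suc t * t + pairSum ds  ≤⟨ +-monoʳ-≤ (suc t * t) (pairSum-≤ e′ pos eq′) ⟩
  suc t * t + e′ * suc e′ ≤⟨ m≤m+n _ (2 * (t * e′)) ⟩
  suc t * t + e′ * suc e′ + 2 * (t * e′) ≡⟨ expand t e′ ⟩
  (t + e′) * suc (t + e′) ≡⟨ cong (λ e → e * suc e) (≡-sym e≡) ⟩
  e * suc e ∎
  where
  open ≤-Reasoning
  e′ = sum ds ∸ length ds
  eq′ : sum ds ≡ e′ + length ds
  eq′ = ≡-sym (m∸n+n≡m (length≤sum pos))
  e≡ : e ≡ t + e′
  e≡ = +-cancelʳ-≡ (length ds) e (t + e′) (suc-injective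
    (trans (≡-sym (+-suc e (length ds))) (trans (≡-sym eq) (cong suc (trans (cong (t +_) eq′) (≡-sym (+-assoc t e′ (length ds))))))))
  expand : ∀ t e → suc t * t + e * suc e + 2 * (t * e) ≡ (t + e) * suc (t + e)
  expand = solve 2 (λ t e → (con 1 :+ t) :* t :+ e :* (con 1 :+ e) :+ con 2 :* (t :* e) := (t :+ e) :* (con 1 :+ (t :+ e))) refl

-- For fixed q the ratio d q^d / (q+1)^d is largest at d = q and d = q + 1.
module _ (q′ : ℕ) where
  private
    q = suc q′

    Cap : ℕ → Set
    Cap d = d * (q ^ d * suc q ^ q) ≤ q ^ suc q * suc q ^ d

    cap-q : Cap q
    cap-q = ≤-reflexive (≡-sym (*-assoc q (q ^ q) (suc q ^ q)))

    cap-up : ∀ {d} → q ≤ d → Cap d → Cap (suc d)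
    cap-up {d} q≤d h = begin
      suc d * (q * q ^ d * suc q ^ q)   ≡⟨ r₁ (suc d) q (q ^ d) (suc q ^ q) ⟩
      suc d * q * (q ^ d * suc q ^ q)   ≤⟨ *-monoˡ-≤ _ (subst₂ _≤_ (+-comm (d * q) q) (≡-sym (*-suc d q)) (≤-trans (+-monoʳ-≤ (d * q) q≤d) (≤-reflexive (+-comm (d * q) d)))) ⟩
      d * suc q * (q ^ d * suc q ^ q)   ≡⟨ r₂ d (suc q) (q ^ d * suc q ^ q) ⟩
      suc q * (d * (q ^ d * suc q ^ q)) ≤⟨ *-monoʳ-≤ (suc q) h ⟩
      suc q * (q ^ suc q * suc q ^ d)   ≡⟨ *-left-comm (suc q) (q ^ suc q) (suc q ^ d) ⟩
      q ^ suc q * (suc q * suc q ^ d)   ∎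
      where
      open ≤-Reasoning
      r₁ : ∀ a b c d → a * (b * c * d) ≡ a * b * (c * d)
      r₁ = solve 4 (λ a b c d → a :* (b :* c :* d) := a :* b :* (c :* d)) refl
      r₂ : ∀ a b c → a * b * c ≡ b * (a * c)
      r₂ = solve 3 (λ a b c → a :* b :* c := b :* (a :* c)) refl

    cap-down : ∀ {d} → d ≤ q → Cap (suc d) → Cap d
    cap-down {d} d≤q h = *-cancelˡ-≤ (suc q) (begin
      suc q * (d * (q ^ d * suc q ^ q)) ≡⟨ r₂ (suc q) d (q ^ d * suc q ^ q) ⟩
      d * suc q * (q ^ d * suc q ^ q)   ≤⟨ *-monoˡ-≤ _ (subst₂ _≤_ (≡-sym (*-suc d q)) refl (+-monoˡ-≤ (d * q) d≤q)) ⟩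
      suc d * q * (q ^ d * suc q ^ q)   ≡⟨ r₁ (suc d) q (q ^ d) (suc q ^ q) ⟩
      suc d * (q * q ^ d * suc q ^ q)   ≤⟨ h ⟩
      q ^ suc q * (suc q * suc q ^ d)   ≡⟨ *-left-comm (q ^ suc q) (suc q) (suc q ^ d) ⟩
      suc q * (q ^ suc q * suc q ^ d)   ∎)
      where
      open ≤-Reasoning
      r₁ : ∀ a b c d → a * b * (c * d) ≡ a * (b * c * d)
      r₁ = solve 4 (λ a b c d → a :* b :* (c :* d) := a :* (b :* c :* d)) refl
      r₂ : ∀ a b c → a * (b * c) ≡ b * a * c
      r₂ = solve 3 (λ a b c → a :* (b :* c) := b :* a :* c) refl

    cap-above : ∀ j → Cap (j + q)
    cap-above zero    = cap-q
    cap-above (suc j) = cap-up (m≤n+m q j) (cap-above j)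

    cap-below : ∀ j {d} → j + d ≡ q → Cap d
    cap-below zero    refl = cap-q
    cap-below (suc j) {d} e = cap-down (≤-trans (m≤n+m d (suc j)) (≤-reflexive e)) (cap-below j (trans (+-suc j d) e))

    cap : ∀ d → Cap d
    cap d with ≤-total q d
    ... | inj₁ q≤d = subst Cap (m∸n+n≡m q≤d) (cap-above (d ∸ q))
    ... | inj₂ d≤q = cap-below (q ∸ d) (m∸n+n≡m d≤q)

  -- The bounds `cap` multiplied over all parts. For k parts with sum s it says that the product is
  -- at most q^((q+1)k - s) · (q+1)^(s - qk), written without negative exponents; parts q and q + 1
  -- attain it.
  product-cap : ∀ ds → product ds * (q ^ sum ds * suc q ^ (q * length ds)) ≤ q ^ (suc q * length ds) * suc q ^ sum ds
  product-cap [] rewrite *-zeroʳ q′ = ≤-refl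
  product-cap (d ∷ ds) = subst₂ _≤_ lhs rhs (*-mono-≤ (cap d) (product-cap ds))
    where
    r₆ : ∀ a b c d e f → a * (b * c) * (d * (e * f)) ≡ a * d * (b * e * (c * f))
    r₆ = solve 6 (λ a b c d e f → a :* (b :* c) :* (d :* (e :* f)) := a :* d :* (b :* e :* (c :* f))) refl
    r₄ : ∀ a b c d → a * b * (c * d) ≡ a * c * (b * d)
    r₄ = solve 4 (λ a b c d → a :* b :* (c :* d) := a :* c :* (b :* d)) refl
    lhs : d * (q ^ d * suc q ^ q) * (product ds * (q ^ sum ds * suc q ^ (q * length ds))) ≡
          d * product ds * (q ^ (d + sum ds) * suc q ^ (q * suc (length ds)))
    lhs = trans (r₆ d (q ^ d) (suc q ^ q) (product ds) (q ^ sum ds) (suc q ^ (q * length ds)))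
      (cong₂ (λ x y → d * product ds * (x * y)) (≡-sym (^-distribˡ-+-* q d (sum ds)))
        (trans (≡-sym (^-distribˡ-+-* (suc q) q (q * length ds))) (cong (suc q ^_) (≡-sym (*-suc q (length ds))))))
    rhs : q ^ suc q * suc q ^ d * (q ^ (suc q * length ds) * suc q ^ sum ds) ≡
          q ^ (suc q * suc (length ds)) * suc q ^ (d + sum ds)
    rhs = trans (r₄ (q ^ suc q) (suc q ^ d) (q ^ (suc q * length ds)) (suc q ^ sum ds))
      (cong₂ _*_ (trans (≡-sym (^-distribˡ-+-* q (suc q) (suc q * length ds))) (cong (q ^_) (≡-sym (*-suc (suc q) (length ds)))))
        (≡-sym (^-distribˡ-+-* (suc q) d (sum ds))))

-- Exhaustion over partitions

-- Lists the partitions of rem with parts ≤ m by decreasing parts, prepending them to acc.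
everyPartition : (List ℕ → Bool) → (fuel rem m : ℕ) → List ℕ → Bool
everyPartition ok zero       rem m       acc = false
everyPartition ok (suc fuel) rem zero    acc = if rem ≡ᵇ 0 then ok acc else true
everyPartition ok (suc fuel) rem (suc m) acc =
  (if rem <ᵇ suc m then true else everyPartition ok fuel (rem ∸ suc m) (suc m) (suc m ∷ acc))
  ∧ everyPartition ok fuel rem m acc

-- The search meets only the sorted arrangement of `ds`, so the conclusion speaks of some
-- rearrangement. Lack of fuel counts as failure, so a successful run certifies that the fuel was
-- sufficient. If the bound `suc m` occurs in `ds` it is moved to the front and removed, otherwise
-- the bound can be lowered.
everyPartition-sound : ∀ ok fuel {rem m acc} → everyPartition ok fuel rem m acc ≡ true →
  ∀ ds → Positive ds → All (_≤ m) ds → sum ds ≡ rem → ∃ λ es → es ↭ ds ++ acc × ok es ≡ true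
everyPartition-sound ok (suc fuel) {m = zero} h [] pos le refl = _ , ↭-refl , h
everyPartition-sound ok (suc fuel) {m = zero} h (_ ∷ _) (1≤d ∷ _) (d≤0 ∷ _) e = contradiction (≤-trans 1≤d d≤0) λ ()
everyPartition-sound ok (suc fuel) {rem} {suc m} {acc} h ds pos le e with Any.any? (suc m ≟ℕ_) ds
... | no m∉ = everyPartition-sound ok fuel (proj₂ (∧-split (if rem <ᵇ suc m then true else _) h)) ds pos
        (All.tabulate λ {d} d∈ → ≤-pred (≤∧≢⇒< (All.lookup le d∈) λ { refl → m∉ d∈ })) e
... | yes m∈ with xs , ys , refl ← ∈-∃++ m∈
             with eq ← trans (≡-sym (sum-↭ (shift (suc m) xs ys))) e
             with h₁ , _ ← ∧-split (if rem <ᵇ suc m then true else _) h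
             with rem <ᵇ suc m in lt
...   | true = contradiction (≤-trans (<ᵇ⇒< rem (suc m) (subst T (≡-sym lt) _)) (≤-trans (m≤m+n (suc m) _) (≤-reflexive eq))) 1+n≰n
...   | false with es , p , q ← everyPartition-sound ok fuel h₁ (xs ++ ys)
                 (All.tail (All-resp-↭ (shift (suc m) xs ys) pos)) (All.tail (All-resp-↭ (shift (suc m) xs ys) le))
                 (trans (≡-sym (m+n∸m≡n (suc m) _)) (cong (_∸ suc m) eq))
        = es , ↭-trans p (↭-trans (shift (suc m) (xs ++ ys) acc) (++⁺ʳ acc (↭-sym (shift (suc m) xs ys)))) , q

allBelow : (ℕ → Bool) → ℕ → Bool
allBelow p zero    = true
allBelow p (suc m) = p m ∧ allBelow p m

allBelow-sound : ∀ p m → allBelow p m ≡ true → ∀ {i} → i < m → p i ≡ true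
allBelow-sound p (suc m) h {i} (s≤s i≤m) with ∧-split (p m) h | i ≟ℕ m
... | hm , _  | yes refl = hm
... | _  , h′ | no  i≢m  = allBelow-sound p m h′ (≤∧≢⇒< i≤m i≢m)

private
  <ᵇ-sound : ∀ {a b} → (a <ᵇ b) ≡ true → a < b
  <ᵇ-sound {a} {b} e = <ᵇ⇒< a b (subst T (≡-sym e) _)

  parts≤sum : ∀ ds → All (_≤ sum ds) ds
  parts≤sum []       = []
  parts≤sum (d ∷ ds) = m≤m+n d (sum ds) ∷ All.map (λ h → ≤-trans h (m≤n+m (sum ds) d)) (parts≤sum ds)

  ++-[]-↭ : ∀ {es ds : List ℕ} → es ↭ ds ++ [] → es ↭ ds
  ++-[]-↭ {es} {ds} p = subst (es ↭_) (++-identityʳ ds) p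

private
  checkAll : (ℕ → List ℕ → Bool) → ℕ → ℕ → Bool
  -- Each recursive call lowers the remainder or the bound on parts, so fuel 50 covers remainder and
  -- bound 21, the largest used.
  checkAll ok m = allBelow (λ i → everyPartition (ok (m + i)) 50 (m + i) (m + i) [])

  checkAll-sound : ∀ ok m r → checkAll ok m r ≡ true → ∀ ds → Positive ds → ∀ {s} → sum ds ≡ s →
                   m ≤ s → s < m + r → ∃ λ es → es ↭ ds × ok s es ≡ true
  checkAll-sound ok m r h ds pos {s} eq m≤s s<m+r =
    let es , p , q = everyPartition-sound (ok s) 50
          (subst (λ s → everyPartition (ok s) 50 s s [] ≡ true) (m+[n∸m]≡n m≤s)
            (allBelow-sound (λ i → everyPartition (ok (m + i)) 50 (m + i) (m + i) []) r h
              (+-cancelˡ-< m _ _ (subst (_< m + r) (≡-sym (m+[n∸m]≡n m≤s)) s<m+r))))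
          ds pos (subst (λ s → All (_≤ s) ds) eq (parts≤sum ds)) eq
    in es , ++-[]-↭ p , q

  okStar : ℕ → List ℕ → Bool
  okStar s es = Φ es <ᵇ starValue s

  -- The enumeration prepends decreasing parts and so delivers increasing lists, whereas `balanced`
  -- is decreasing; hence `reverse`.
  okBalanced : ℕ → List ℕ → Bool
  okBalanced s es = (Φ es <ᵇ Φ (balanced s)) ∨ does (≡-dec _≟ℕ_ es (reverse (balanced s)))

  checkStar : checkAll okStar 0 15 ≡ true
  checkStar = refl

  checkBalanced : checkAll okBalanced 15 7 ≡ true
  checkBalanced = refl

Φ<starValue : ∀ ds → Positive ds → ∀ {s} → sum ds ≡ s → s ≤ 14 → Φ ds < starValue s
Φ<starValue ds pos {s} eq s≤14 =
  let es , p , h = checkAll-sound okStar 0 15 checkStar ds pos eq z≤n (s≤s s≤14)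
  in subst (_< starValue s) (Φ-↭ p) (<ᵇ-sound h)

private
  Φ-small : ∀ ds → Positive ds → ∀ {s} → sum ds ≡ s → 15 ≤ s → s ≤ 21 →
            Φ ds < Φ (balanced s) ⊎ ds ↭ balanced s
  Φ-small ds pos {s} eq 15≤s s≤21 = conclude (checkAll-sound okBalanced 15 7 checkBalanced ds pos eq 15≤s (s≤s s≤21))
    where
    does-true : ∀ {A : Set} (d : Dec A) → does d ≡ true → A
    does-true (yes a) _ = a
    conclude : (∃ λ es → es ↭ ds × okBalanced s es ≡ true) → Φ ds < Φ (balanced s) ⊎ ds ↭ balanced s
    conclude (es , p , h) with ∨-split (Φ es <ᵇ Φ (balanced s)) h
    ... | inj₁ lt = inj₁ (subst (_< Φ (balanced s)) (Φ-↭ p) (<ᵇ-sound lt))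
    ... | inj₂ e  = inj₂ (↭-trans (↭-sym p) (subst (_↭ balanced s) (≡-sym (does-true (≡-dec _≟ℕ_ es (reverse (balanced s))) e)) (↭-reverse (balanced s))))

-- The largest product for a given sum

private
  -- Increasing d by 3 triples top and at most triples c * d, so three base cases suffice.
  linear≤top : ∀ {c a t d} → c * suc d ≤ a * top (t + suc d) → 1 ≤ d → c * (4 + d) ≤ a * top (t + (4 + d))
  linear≤top {c} {a} {t} {suc d} h _ = begin
    c * (5 + d)                 ≤⟨ *-monoʳ-≤ c (≤-trans (m≤m+n _ (1 + 2 * d)) (≤-reflexive (r d))) ⟩
    c * (3 * (2 + d))           ≡⟨ *-left-comm c 3 (2 + d) ⟩
    3 * (c * (2 + d))           ≤⟨ *-monoʳ-≤ 3 h ⟩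
    3 * (a * top (t + (2 + d))) ≡⟨ *-left-comm 3 a _ ⟩
    a * (3 * top (t + (2 + d))) ≡⟨ cong (λ x → a * top x) (≡-sym (r″ t d)) ⟩
    a * top (t + (5 + d))       ∎
    where
    open ≤-Reasoning
    r : ∀ d → (5 + d) + (1 + 2 * d) ≡ 3 * (2 + d)
    r = solve 1 (λ d → (con 5 :+ d) :+ (con 1 :+ con 2 :* d) := con 3 :* (con 2 :+ d)) refl
    r″ : ∀ t d → t + (5 + d) ≡ 3 + (t + (2 + d))
    r″ = solve 2 (λ t d → t :+ (con 5 :+ d) := con 3 :+ (t :+ (con 2 :+ d))) refl

  mul-top-base : ∀ t → t < 3 → ∀ d → 1 ≤ d → top t * d ≤ 1 * top (t + d)
  mul-top-base 0 _ 1 _ = ≤ᵇ⇒≤ 3 4 _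
  mul-top-base 0 _ 2 _ = ≤ᵇ⇒≤ 6 6 _
  mul-top-base 0 _ 3 _ = ≤ᵇ⇒≤ 9 9 _
  mul-top-base 0 _ 4 _ = ≤ᵇ⇒≤ 12 12 _
  mul-top-base 1 _ 1 _ = ≤ᵇ⇒≤ 4 6 _
  mul-top-base 1 _ 2 _ = ≤ᵇ⇒≤ 8 9 _
  mul-top-base 1 _ 3 _ = ≤ᵇ⇒≤ 12 12 _
  mul-top-base 1 _ 4 _ = ≤ᵇ⇒≤ 16 18 _
  mul-top-base 2 _ 1 _ = ≤ᵇ⇒≤ 6 9 _
  mul-top-base 2 _ 2 _ = ≤ᵇ⇒≤ 12 12 _
  mul-top-base 2 _ 3 _ = ≤ᵇ⇒≤ 18 18 _
  mul-top-base 2 _ 4 _ = ≤ᵇ⇒≤ 24 27 _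
  mul-top-base (suc (suc (suc t))) (s≤s (s≤s (s≤s ()))) _ _
  mul-top-base t t<3 (suc (suc (suc e@(suc (suc d))))) _ =
    linear≤top {top t} {1} {t} {suc d} (mul-top-base t t<3 e (s≤s z≤n)) (s≤s z≤n)

  -- Adding 3 to s triples both sides; adding 3 to d ≥ 2 triples the right side and at most triples
  -- the left. So a table over s < 3 and small d suffices. It runs up to d = 4 because 4 exceeds
  -- three times 1.
  mul-top : ∀ {d} → 1 ≤ d → ∀ s → d * top s ≤ top (d + s)
  mul-top {d} 1≤d 0 = subst₂ _≤_ (*-comm 3 d) (trans (*-identityˡ _) (cong top (+-comm 0 d))) (mul-top-base 0 (≤ᵇ⇒≤ 1 3 _) d 1≤d)
  mul-top {d} 1≤d 1 = subst₂ _≤_ (*-comm 4 d) (trans (*-identityˡ _) (cong top (+-comm 1 d))) (mul-top-base 1 (≤ᵇ⇒≤ 2 3 _) d 1≤d)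
  mul-top {d} 1≤d 2 = subst₂ _≤_ (*-comm 6 d) (trans (*-identityˡ _) (cong top (+-comm 2 d))) (mul-top-base 2 (≤ᵇ⇒≤ 3 3 _) d 1≤d)
  mul-top {d} 1≤d (suc (suc (suc s))) = subst₂ _≤_ (*-left-comm 3 d (top s)) (cong top (≡-sym (r′ d s))) (*-monoʳ-≤ 3 (mul-top 1≤d s))
    where
    r′ : ∀ d s → d + (3 + s) ≡ 3 + (d + s)
    r′ = solve 2 (λ d s → d :+ (con 3 :+ s) := con 3 :+ (d :+ s)) refl

-- Induction by `mul-top`. The factor 3 is for sums of residue 1 modulo 3, whose largest product is
-- 4/3 · 3^((s-1)/3) for s ≥ 4: after scaling, the recursion starts from the integer `top 1 = 4`,
-- too large only at s = 1 itself.
3product≤top : ∀ ds → Positive ds → 3 * product ds ≤ top (sum ds)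
3product≤top []       []        = ≤-refl
3product≤top (d ∷ ds) (p ∷ pos) = begin
  3 * (d * product ds) ≡⟨ *-left-comm 3 d (product ds) ⟩
  d * (3 * product ds) ≤⟨ *-monoʳ-≤ d (3product≤top ds pos) ⟩
  d * top (sum ds)     ≤⟨ mul-top p (sum ds) ⟩
  top (d + sum ds)     ∎
  where
  open ≤-Reasoning

-- Multiply 2 d ≤ 2^d over all parts. This is the estimate for a class with many members, whose
-- average degree is below 2.
2^sum-cap : ∀ ds → product ds * 2 ^ length ds ≤ 2 ^ sum ds
2^sum-cap []       = ≤-refl
2^sum-cap (d ∷ ds) = subst₂ _≤_ (r d 2 (product ds) (2 ^ length ds)) (≡-sym (^-distribˡ-+-* 2 d (sum ds)))
  (*-mono-≤ (2d≤2^d d) (2^sum-cap ds))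
  where
  2d≤2^d : ∀ d → d * 2 ≤ 2 ^ d
  2d≤2^d 0             = z≤n
  2d≤2^d 1             = ≤-refl
  2d≤2^d (suc (suc d)) = ≤-trans (≤-trans (m≤m+n _ (d * 2)) (≤-reflexive (id d))) (*-monoʳ-≤ 2 (2d≤2^d (suc d)))
    where
    id : ∀ d → (2 + d) * 2 + d * 2 ≡ 2 * ((1 + d) * 2)
    id = solve 1 (λ d → (con 2 :+ d) :* con 2 :+ d :* con 2 := con 2 :* ((con 1 :+ d) :* con 2)) refl
  r : ∀ a b c d → a * b * (c * d) ≡ a * c * (b * d)
  r = solve 4 (λ a b c d → a :* b :* (c :* d) := a :* c :* (b :* d)) refl

top≡3product : ∀ s → 2 ≤ s → top s ≡ 3 * product (balanced s)
top≡3product 1 (s≤s ())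
top≡3product 2 _ = refl
top≡3product 3 _ = refl
top≡3product 4 _ = refl
top≡3product (suc (suc (suc s@(suc (suc _))))) _ = cong (3 *_) (top≡3product s (s≤s (s≤s z≤n)))

sum-balanced : ∀ s → sum (balanced s) ≡ s
sum-balanced 0 = refl
sum-balanced 1 = refl
sum-balanced 2 = refl
sum-balanced 3 = refl
sum-balanced 4 = refl
sum-balanced (suc (suc (suc s@(suc (suc _))))) = cong (3 +_) (sum-balanced s)

2top≤Φ : ∀ s → 2 ≤ s → 2 * top s ≤ Φ (balanced s)
2top≤Φ s 2≤s = ≤-trans (≤-reflexive (trans (cong (2 *_) (top≡3product s 2≤s)) (≡-sym (*-assoc 2 3 (product (balanced s))))))
  (≤-trans (m≤m+n (6 * product (balanced s)) _) (m≤m+n _ (3 * pairSum (balanced s))))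

-- Growth of top

private
  step-by-3 : ∀ (P : ℕ → Set) → P 0 → P 1 → P 2 → (∀ t → P t → P (3 + t)) → ∀ t → P t
  step-by-3 P p₀ p₁ p₂ st 0 = p₀
  step-by-3 P p₀ p₁ p₂ st 1 = p₁
  step-by-3 P p₀ p₁ p₂ st 2 = p₂
  step-by-3 P p₀ p₁ p₂ st (suc (suc (suc t))) = st t (step-by-3 P p₀ p₁ p₂ st t)

  -- `top` triples when its argument grows by 3, so it is enough that squares at most triple; the
  -- growth inequalities then follow from base cases.
  square-grows : ∀ c {s} → 2 * c ≤ s → (c + s) * (c + s) ≤ 3 * (s * s)
  square-grows c {s} 2c≤s = begin
    (c + s) * (c + s)             ≡⟨ r c s ⟩
    c * c + (2 * c * s + s * s)   ≤⟨ +-mono-≤ (*-mono-≤ c≤s c≤s) (+-monoˡ-≤ (s * s) (*-monoˡ-≤ s 2c≤s)) ⟩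
    s * s + (s * s + s * s)       ≡⟨ cong (λ x → s * s + (s * s + x)) (≡-sym (+-identityʳ (s * s))) ⟩
    3 * (s * s)                   ∎
    where
    open ≤-Reasoning
    c≤s : c ≤ s
    c≤s = ≤-trans (m≤m+n c (c + 0)) 2c≤s
    r : ∀ c s → (c + s) * (c + s) ≡ c * c + (2 * c * s + s * s)
    r = solve 2 (λ c s → (c :+ s) :* (c :+ s) := c :* c :+ (con 2 :* c :* s :+ s :* s)) refl

  starValue-step : ∀ s → 6 ≤ s → starValue s < 2 * top s → starValue (3 + s) < 2 * top (3 + s)
  starValue-step s 6≤s h = begin-strict
    12 + 6 * ((3 + s) * (3 + s))   ≤⟨ +-mono-≤ (≤ᵇ⇒≤ 12 36 _) (*-monoʳ-≤ 6 (square-grows 3 6≤s)) ⟩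
    36 + 6 * (3 * (s * s))         ≡⟨ cong (36 +_) (*-left-comm 6 3 (s * s)) ⟩
    36 + 3 * (6 * (s * s))         ≡⟨ ≡-sym (*-distribˡ-+ 3 12 (6 * (s * s))) ⟩
    3 * starValue s                <⟨ *-monoʳ-< 3 h ⟩
    3 * (2 * top s)                ≡⟨ *-left-comm 3 2 (top s) ⟩
    2 * (3 * top s)                ∎
    where open ≤-Reasoning

  18s²-step : ∀ s → 6 ≤ s → 18 * (s * s) < top s → 18 * ((3 + s) * (3 + s)) < 3 * top s
  18s²-step s 6≤s h = begin-strict
    18 * ((3 + s) * (3 + s))   ≤⟨ *-monoʳ-≤ 18 (square-grows 3 6≤s) ⟩
    18 * (3 * (s * s))         ≡⟨ *-left-comm 18 3 (s * s) ⟩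
    3 * (18 * (s * s))         <⟨ *-monoʳ-< 3 h ⟩
    3 * top s                  ∎
    where open ≤-Reasoning

  -- Period 6 suits both functions: the power of two is multiplied by 8 and `top` by 9, while the
  -- square at most triples.
  powers-step : ∀ s x → 12 ≤ s → 6 * x + 6 * (s * s) < top s →
                6 * (2 * (2 * (2 * x))) + 6 * ((6 + s) * (6 + s)) < 3 * (3 * top s)
  powers-step s x 12≤s h = begin-strict
    6 * (2 * (2 * (2 * x))) + 6 * ((6 + s) * (6 + s))  ≤⟨ +-monoʳ-≤ (6 * (2 * (2 * (2 * x)))) (*-monoʳ-≤ 6 (square-grows 6 12≤s)) ⟩
    6 * (2 * (2 * (2 * x))) + 6 * (3 * (s * s))        ≤⟨ m≤m+n _ (6 * x + 36 * (s * s)) ⟩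
    6 * (2 * (2 * (2 * x))) + 6 * (3 * (s * s)) + (6 * x + 36 * (s * s)) ≡⟨ r x (s * s) ⟩
    3 * (3 * (6 * x + 6 * (s * s)))                    <⟨ *-monoʳ-< 3 (*-monoʳ-< 3 h) ⟩
    3 * (3 * top s)                                    ∎
    where
    open ≤-Reasoning
    r : ∀ x y → 6 * (2 * (2 * (2 * x))) + 6 * (3 * y) + (6 * x + 36 * y) ≡ 3 * (3 * (6 * x + 6 * y))
    r = solve 2 (λ x y → con 6 :* (con 2 :* (con 2 :* (con 2 :* x))) :+ con 6 :* (con 3 :* y) :+ (con 6 :* x :+ con 36 :* y)
          := con 3 :* (con 3 :* (con 6 :* x :+ con 6 :* y))) refl

  starValue<2top′ : ∀ t → starValue (15 + t) < 2 * top (15 + t)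
  starValue<2top′ = step-by-3 _ (≤ᵇ⇒≤ 1363 1458 _) (≤ᵇ⇒≤ 1549 1944 _) (≤ᵇ⇒≤ 1747 2916 _)
    λ t h → starValue-step (15 + t) (≤-trans (≤ᵇ⇒≤ 6 15 _) (m≤m+n 15 t)) h

  18s²<top′ : ∀ t → 18 * ((22 + t) * (22 + t)) < top (22 + t)
  18s²<top′ = step-by-3 _ (≤ᵇ⇒≤ 8713 8748 _) (≤ᵇ⇒≤ 9523 13122 _) (≤ᵇ⇒≤ 10369 19683 _)
    λ t h → 18s²-step (22 + t) (≤-trans (≤ᵇ⇒≤ 6 22 _) (m≤m+n 22 t)) h

  powers<top′ : ∀ t → 6 * 2 ^ ⌊ 25 + t /2⌋ + 6 * ((26 + t) * (26 + t)) < top (26 + t)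
  powers<top′ 0 = ≤ᵇ⇒≤ 28633 39366 _
  powers<top′ 1 = ≤ᵇ⇒≤ 53527 59049 _
  powers<top′ 2 = ≤ᵇ⇒≤ 53857 78732 _
  powers<top′ 3 = ≤ᵇ⇒≤ 103351 118098 _
  powers<top′ 4 = ≤ᵇ⇒≤ 103705 177147 _
  powers<top′ 5 = ≤ᵇ⇒≤ 202375 236196 _
  powers<top′ (suc (suc (suc (suc (suc (suc t)))))) =
    powers-step (26 + t) (2 ^ ⌊ 25 + t /2⌋) (≤-trans (≤ᵇ⇒≤ 12 26 _) (m≤m+n 26 t)) (powers<top′ t)

starValue<Φ : ∀ {s} → 15 ≤ s → starValue s < Φ (balanced s)
starValue<Φ {s} 15≤s = <-≤-trans (subst (λ s → starValue s < 2 * top s) (m+[n∸m]≡n 15≤s) (starValue<2top′ (s ∸ 15)))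
  (2top≤Φ s (≤-trans (≤ᵇ⇒≤ 2 15 _) 15≤s))

-- At s = 21 this fails, 7938 against 6561; hence the partitions are run through up to 21.
18s²<top : ∀ {s} → 22 ≤ s → 18 * (s * s) < top s
18s²<top {s} h = subst (λ s → 18 * (s * s) < top s) (m+[n∸m]≡n h) (18s²<top′ (s ∸ 22))

powers<top : ∀ {s} → 26 ≤ s → 6 * 2 ^ ⌊ pred s /2⌋ + 6 * (s * s) < top s
powers<top {s} h = subst (λ s → 6 * 2 ^ ⌊ pred s /2⌋ + 6 * (s * s) < top s) (m+[n∸m]≡n h) (powers<top′ (s ∸ 26))

threes : ℕ → List ℕ
threes i = replicate i 3

private
  -- Up to order and parts 3 these are the only lists whose product is not at least a factor 9/8 below the maximum.
  prefix : Fin 4 → List ℕ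
  prefix zero                   = []
  prefix (suc zero)             = 2 ∷ []
  prefix (suc (suc zero))       = 2 ∷ 2 ∷ []
  prefix (suc (suc (suc zero))) = 4 ∷ []

  -- As `top` is three times the maximum, this puts the product at 8/9 of the maximum or less. The
  -- ratio 8/9 is the loss from 2 · 2 · 2, or 2 · 4, instead of 3 · 3.
  Bad : List ℕ → Set
  Bad ds = 27 * product ds ≤ 8 * top (sum ds)

  Good : List ℕ → Set
  Good ds = ∃₂ λ j i → ds ↭ prefix j ++ threes i

  -- The remaining parts are 1 and those from 5 on; for the latter `linear≤top` reduces to 5, 6, 7.
  -- The numerals are the two sides evaluated.
  prefix-bad : ∀ j d → 1 ≤ d → d ≢ 2 → d ≢ 3 → d ≢ 4 → 27 * product (prefix j) * d ≤ 8 * top (sum (prefix j) + d)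
  prefix-bad _ 2 _ ne _ _ = contradiction refl ne
  prefix-bad _ 3 _ _ ne _ = contradiction refl ne
  prefix-bad _ 4 _ _ _ ne = contradiction refl ne
  prefix-bad zero 1 _ _ _ _ = ≤ᵇ⇒≤ 27 32 _
  prefix-bad zero 5 _ _ _ _ = ≤ᵇ⇒≤ 135 144 _
  prefix-bad zero 6 _ _ _ _ = ≤ᵇ⇒≤ 162 216 _
  prefix-bad zero 7 _ _ _ _ = ≤ᵇ⇒≤ 189 288 _
  prefix-bad (suc zero) 1 _ _ _ _ = ≤ᵇ⇒≤ 54 72 _
  prefix-bad (suc zero) 5 _ _ _ _ = ≤ᵇ⇒≤ 270 288 _
  prefix-bad (suc zero) 6 _ _ _ _ = ≤ᵇ⇒≤ 324 432 _
  prefix-bad (suc zero) 7 _ _ _ _ = ≤ᵇ⇒≤ 378 648 _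
  prefix-bad (suc (suc zero)) 1 _ _ _ _ = ≤ᵇ⇒≤ 108 144 _
  prefix-bad (suc (suc zero)) 5 _ _ _ _ = ≤ᵇ⇒≤ 540 648 _
  prefix-bad (suc (suc zero)) 6 _ _ _ _ = ≤ᵇ⇒≤ 648 864 _
  prefix-bad (suc (suc zero)) 7 _ _ _ _ = ≤ᵇ⇒≤ 756 1296 _
  prefix-bad (suc (suc (suc zero))) 1 _ _ _ _ = ≤ᵇ⇒≤ 108 144 _
  prefix-bad (suc (suc (suc zero))) 5 _ _ _ _ = ≤ᵇ⇒≤ 540 648 _
  prefix-bad (suc (suc (suc zero))) 6 _ _ _ _ = ≤ᵇ⇒≤ 648 864 _
  prefix-bad (suc (suc (suc zero))) 7 _ _ _ _ = ≤ᵇ⇒≤ 756 1296 _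
  prefix-bad j (suc (suc (suc e@(suc (suc (suc (suc (suc d)))))))) _ _ _ _ =
    linear≤top {27 * product (prefix j)} {8} {sum (prefix j)} {4 + d}
      (prefix-bad j e (s≤s z≤n) (λ ()) (λ ()) (λ ())) (s≤s z≤n)

  product-threes : ∀ ps i → product (ps ++ threes i) ≡ product ps * 3 ^ i
  product-threes []       zero    = refl
  product-threes []       (suc i) = trans (cong (3 *_) (product-threes [] i)) (*-left-comm 3 1 (3 ^ i))
  product-threes (p ∷ ps) i = trans (cong (p *_) (product-threes ps i)) (≡-sym (*-assoc p (product ps) (3 ^ i)))

  top-threes : ∀ ps i → top (sum (ps ++ threes i)) ≡ top (sum ps) * 3 ^ i
  top-threes ps zero    = trans (cong (top ∘ sum) (++-identityʳ ps)) (≡-sym (*-identityʳ _))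
  top-threes ps (suc i) = trans (cong top (sum-↭ (shift 3 ps (threes i))))
    (trans (cong (3 *_) (top-threes ps i)) (*-left-comm 3 (top (sum ps)) (3 ^ i)))

  Bad-↭ : ∀ {ds es} → ds ↭ es → Bad es → Bad ds
  Bad-↭ p h = subst₂ (λ x y → 27 * x ≤ 8 * top y) (≡-sym (product-↭ p)) (≡-sym (sum-↭ p)) h

  bad-threes : ∀ ps i → Bad ps → Bad (ps ++ threes i)
  bad-threes ps i h = subst₂ _≤_
    (trans (*-assoc 27 (product ps) (3 ^ i)) (cong (27 *_) (≡-sym (product-threes ps i))))
    (trans (*-assoc 8 (top (sum ps)) (3 ^ i)) (cong (8 *_) (≡-sym (top-threes ps i))))
    (*-monoˡ-≤ (3 ^ i) h)

  classify-cons : ∀ d → 1 ≤ d → ∀ j i → Bad (d ∷ prefix j ++ threes i) ⊎ Good (d ∷ prefix j ++ threes i)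
  classify-cons 3 _ j i = inj₂ (j , suc i , ↭-sym (shift 3 (prefix j) (threes i)))
  classify-cons 2 _ zero i = inj₂ (suc zero , i , ↭-refl)
  classify-cons 2 _ (suc zero) i = inj₂ (suc (suc zero) , i , ↭-refl)
  classify-cons 2 _ (suc (suc zero)) i = inj₁ (bad-threes (2 ∷ 2 ∷ 2 ∷ []) i (≤ᵇ⇒≤ 216 216 _))
  classify-cons 2 _ (suc (suc (suc zero))) i = inj₁ (bad-threes (2 ∷ 4 ∷ []) i (≤ᵇ⇒≤ 216 216 _))
  classify-cons 4 _ zero i = inj₂ (suc (suc (suc zero)) , i , ↭-refl)
  classify-cons 4 _ (suc zero) i = inj₁ (bad-threes (4 ∷ 2 ∷ []) i (≤ᵇ⇒≤ 216 216 _))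
  classify-cons 4 _ (suc (suc zero)) i = inj₁ (bad-threes (4 ∷ 2 ∷ 2 ∷ []) i (≤ᵇ⇒≤ 432 432 _))
  classify-cons 4 _ (suc (suc (suc zero))) i = inj₁ (bad-threes (4 ∷ 4 ∷ []) i (≤ᵇ⇒≤ 432 432 _))
  classify-cons 1 p j i = inj₁ (bad-threes (1 ∷ prefix j) i (subst₂ _≤_
    (r 27 (product (prefix j)) 1) (cong (λ s → 8 * top s) (+-comm (sum (prefix j)) 1)) (prefix-bad j 1 p (λ ()) (λ ()) (λ ()))))
    where
    r : ∀ a b c → a * b * c ≡ a * (c * b)
    r = solve 3 (λ a b c → a :* b :* c := a :* (c :* b)) refl
  classify-cons d@(suc (suc (suc (suc (suc _))))) p j i = inj₁ (bad-threes (d ∷ prefix j) i (subst₂ _≤_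
    (r 27 (product (prefix j)) d) (cong (λ s → 8 * top s) (+-comm (sum (prefix j)) d)) (prefix-bad j d p (λ ()) (λ ()) (λ ()))))
    where
    r : ∀ a b c → a * b * c ≡ a * (c * b)
    r = solve 3 (λ a b c → a :* b :* c := a :* (c :* b)) refl

  -- A bad list stays bad when a part is prepended, since by `mul-top` the maximum grows at least by
  -- the same factor. So parts have to be tested only against good lists, and there the 3s split off
  -- because they scale the product and `top` alike.
  classify : ∀ ds → Positive ds → Bad ds ⊎ Good ds
  classify []       []        = inj₂ (zero , 0 , ↭-refl)
  classify (d ∷ ds) (p ∷ pos) with classify ds pos
  ... | inj₁ bad = inj₁ (begin
        27 * (d * product ds)  ≡⟨ *-left-comm 27 d (product ds) ⟩
        d * (27 * product ds)  ≤⟨ *-monoʳ-≤ d bad ⟩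
        d * (8 * top (sum ds)) ≡⟨ *-left-comm d 8 (top (sum ds)) ⟩
        8 * (d * top (sum ds)) ≤⟨ *-monoʳ-≤ 8 (mul-top p (sum ds)) ⟩
        8 * top (d + sum ds)   ∎)
    where
    open ≤-Reasoning
  ... | inj₂ (j , i , q) with classify-cons d p j i
  ...   | inj₁ bad            = inj₁ (Bad-↭ (prep d q) bad)
  ...   | inj₂ (j′ , i′ , q′) = inj₂ (j′ , i′ , ↭-trans (prep d q) q′)

  balanced-threes : ∀ j → j ≢ suc (suc (suc zero)) → ∀ i → prefix j ++ threes i ↭ balanced (sum (prefix j ++ threes i))
  balanced-threes zero _ 0 = ↭-refl
  balanced-threes zero _ 1 = ↭-refl
  balanced-threes zero ne (suc (suc i)) = prep 3 (balanced-threes zero ne (suc i))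
  balanced-threes (suc zero) _ 0 = ↭-refl
  balanced-threes (suc zero) ne (suc i) = ↭-trans (shift 3 (2 ∷ []) (threes i)) (prep 3 (balanced-threes (suc zero) ne i))
  balanced-threes (suc (suc zero)) _ 0 = ↭-refl
  balanced-threes (suc (suc zero)) ne (suc i) = ↭-trans (shift 3 (2 ∷ 2 ∷ []) (threes i)) (prep 3 (balanced-threes (suc (suc zero)) ne i))
  balanced-threes (suc (suc (suc zero))) ne _ = contradiction refl ne

  -- The products agree, so the quadratic terms decide: the additional neighbour gains 8 i + 12 in 4
  -- k², while splitting the 4 costs 24 in three times `pairSum`. Hence i ≥ 2.
  four-worse : ∀ i → 2 ≤ i → Φ (4 ∷ threes i) < Φ (2 ∷ 2 ∷ threes i)
  four-worse 1 (s≤s ())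
  four-worse (suc (suc i)) _ = ≤-trans (m≤m+n _ (3 + 8 * i)) (≤-reflexive (id (product ts) (length ts) (pairSum ts) i len))
    where
    ts = threes (suc (suc i))
    len : length ts ≡ 2 + i
    len = length-replicate (suc (suc i))
    id : ∀ p l q i → l ≡ 2 + i →
      suc (6 * (4 * p) + 4 * ((1 + l) * (1 + l)) + 3 * (12 + q)) + (3 + 8 * i)
      ≡ 6 * (2 * (2 * p)) + 4 * ((2 + l) * (2 + l)) + 3 * (2 + (2 + q))
    id p _ q i refl = solve 3 (λ p q i →
      con 1 :+ (con 6 :* (con 4 :* p) :+ con 4 :* ((con 3 :+ i) :* (con 3 :+ i)) :+ con 3 :* (con 12 :+ q)) :+ (con 3 :+ con 8 :* i)
      := con 6 :* (con 2 :* (con 2 :* p)) :+ con 4 :* ((con 4 :+ i) :* (con 4 :+ i)) :+ con 3 :* (con 2 :+ (con 2 :+ q))) refl p q i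

  -- With e = s - k, `pairSum-≤` leaves 4 k² + 3 e (e + 1), and for k ≥ 1 the mixed term 8 k e of 4
  -- (k + e)² absorbs the linear part.
  quadratic-≤ : ∀ ds → Positive ds → 4 * (length ds * length ds) + 3 * pairSum ds ≤ 4 * (sum ds * sum ds)
  quadratic-≤ [] _ = z≤n
  quadratic-≤ ds@(_ ∷ _) pos = begin
    4 * (k * k) + 3 * pairSum ds   ≤⟨ +-monoʳ-≤ (4 * (k * k)) (*-monoʳ-≤ 3 (pairSum-≤ e pos s≡)) ⟩
    4 * (k * k) + 3 * (e * suc e)  ≤⟨ m≤m+n _ (5 * e + 8 * (pred k * e) + e * e) ⟩
    4 * (k * k) + 3 * (e * suc e) + (5 * e + 8 * (pred k * e) + e * e) ≡⟨ id (pred k) e ⟩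
    4 * ((e + k) * (e + k))        ≡⟨ cong (λ s → 4 * (s * s)) (≡-sym s≡) ⟩
    4 * (sum ds * sum ds)          ∎
    where
    open ≤-Reasoning
    k = length ds
    e = sum ds ∸ k
    s≡ : sum ds ≡ e + k
    s≡ = ≡-sym (m∸n+n≡m (length≤sum pos))
    id : ∀ k e → 4 * (suc k * suc k) + 3 * (e * suc e) + (5 * e + 8 * (k * e) + e * e) ≡ 4 * ((e + suc k) * (e + suc k))
    id = solve 2 (λ k e → con 4 :* ((con 1 :+ k) :* (con 1 :+ k)) :+ con 3 :* (e :* (con 1 :+ e)) :+ (con 5 :* e :+ con 8 :* (k :* e) :+ e :* e)
           := con 4 :* ((e :+ (con 1 :+ k)) :* (e :+ (con 1 :+ k)))) refl

  Φ-large : ∀ ds → Positive ds → 22 ≤ sum ds → Φ ds < Φ (balanced (sum ds)) ⊎ ds ↭ balanced (sum ds)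
  Φ-large ds pos 22≤s with classify ds pos
  -- The factor 9 clears the ratio 8/9. Of the 18 `top` on the right the product takes at most 16,
  -- and the quadratic terms, at most 36 s², fit into the other 2 by `18s²<top`.
  ... | inj₁ bad = inj₁ (<-≤-trans (*-cancelˡ-< 9 _ _ (begin-strict
        9 * Φ ds ≡⟨ cong (9 *_) (+-assoc (6 * product ds) _ _) ⟩
        9 * (6 * product ds + (4 * (length ds * length ds) + 3 * pairSum ds))
          ≤⟨ *-monoʳ-≤ 9 (+-monoʳ-≤ (6 * product ds) (quadratic-≤ ds pos)) ⟩
        9 * (6 * product ds + 4 * (sum ds * sum ds)) ≡⟨ r (product ds) (sum ds * sum ds) ⟩
        2 * (27 * product ds) + 2 * (18 * (sum ds * sum ds)) <⟨ +-mono-≤-< (*-monoʳ-≤ 2 bad) (*-monoʳ-< 2 (18s²<top 22≤s)) ⟩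
        2 * (8 * top (sum ds)) + 2 * top (sum ds) ≡⟨ r′ (top (sum ds)) ⟩
        9 * (2 * top (sum ds)) ∎)) (2top≤Φ (sum ds) (≤-trans (≤ᵇ⇒≤ 2 22 _) 22≤s)))
    where
    open ≤-Reasoning
    r : ∀ p q → 9 * (6 * p + 4 * q) ≡ 2 * (27 * p) + 2 * (18 * q)
    r = solve 2 (λ p q → con 9 :* (con 6 :* p :+ con 4 :* q) := con 2 :* (con 27 :* p) :+ con 2 :* (con 18 :* q)) refl
    r′ : ∀ p → 2 * (8 * p) + 2 * p ≡ 9 * (2 * p)
    r′ = solve 1 (λ p → con 2 :* (con 8 :* p) :+ con 2 :* p := con 9 :* (con 2 :* p)) refl
  ... | inj₂ (j , i , q) with j ≟ suc (suc (suc zero))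
  ...   | no  j≢ = inj₂ (↭-trans q (subst (λ s → prefix j ++ threes i ↭ balanced s) (≡-sym (sum-↭ q)) (balanced-threes j j≢ i)))
  ...   | yes refl = inj₁ (subst₂ _<_ (≡-sym (Φ-↭ q))
            (trans (Φ-↭ (balanced-threes (suc (suc zero)) (λ ()) i)) (cong (Φ ∘ balanced) (≡-sym (sum-↭ q))))
            (four-worse i (2≤i i (subst (22 ≤_) (sum-↭ q) 22≤s))))
    where
    2≤i : ∀ i → 22 ≤ sum (4 ∷ threes i) → 2 ≤ i
    2≤i 0 h = contradiction h (λ { (s≤s (s≤s (s≤s (s≤s ())))) })
    2≤i 1 h = contradiction h (λ { (s≤s (s≤s (s≤s (s≤s (s≤s (s≤s (s≤s ()))))))) })
    2≤i (suc (suc i)) _ = s≤s (s≤s z≤n)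

Φ-maximal : ∀ ds → Positive ds → 15 ≤ sum ds → Φ ds < Φ (balanced (sum ds)) ⊎ ds ↭ balanced (sum ds)
Φ-maximal ds pos 15≤s with sum ds ≤? 21
... | yes s≤21 = Φ-small ds pos refl 15≤s s≤21
... | no  s≰21 = Φ-large ds pos (≰⇒> s≰21)

-- Degree lists of the two colour classes against the extremal value

target : ℕ → ℕ
target s = if s ≤ᵇ 14 then starValue s else Φ (balanced s)

private
  quot : ℕ → ℕ → ℕ
  quot s k = pred (s / suc k)

  cap-value : ℕ → ℕ → ℕ
  cap-value s k = (s / suc k) ^ (suc k ∸ s % suc k) * suc (s / suc k) ^ (s % suc k)

  -- `cap-value` is the product of `suc k` nearly equal parts. Instead of deriving it from
  -- `product-cap` by arithmetic with exponents, each case is evaluated: a product of at least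
  -- `suc (cap-value s k)` would violate `product-cap`.
  cap-correct : ℕ → ℕ → Bool
  cap-correct s k = (suc q ^ (suc (suc q) * suc k) * suc (suc q) ^ s) <ᵇ
                    (suc (cap-value s k) * (suc q ^ s * suc (suc q) ^ (suc q * suc k)))
    where q = quot s k

  cap-sound : ∀ ds {s} k → sum ds ≡ s → length ds ≡ suc k → cap-correct s k ≡ true → product ds ≤ cap-value s k
  cap-sound ds k refl len ok = ≤-pred (*-cancelʳ-< (suc q ^ sum ds * suc (suc q) ^ (suc q * suc k)) _ _
    (≤-<-trans (subst (λ l → product ds * (suc q ^ sum ds * suc (suc q) ^ (suc q * l)) ≤ suc q ^ (suc (suc q) * l) * suc (suc q) ^ sum ds)
                  len (product-cap q ds)) (<ᵇ-sound ok)))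
    where q = quot (sum ds) k

  -- The classes have `suc i` and `suc j` members, s + 1 together, so the excess of the degree sum s
  -- over the size of one class is the index of the other. This is why `j * suc j` accompanies the
  -- product for i. For s < 26 both indices are below 25.
  entry : ℕ → ℕ → Bool
  entry i j = if 26 ≤ᵇ s then true else
      (cap-correct s i ∧ (cap-correct s j ∧
       (4 * ((cap-value s i + j * suc j) + (cap-value s j + i * suc i)) <ᵇ target s)))
    where s = suc (i + j)

  entries : allBelow (λ i → allBelow (entry i) 25) 25 ≡ true
  entries = refl

  far-small : ∀ as bs i j → Positive as → Positive bs → sum as ≡ suc (i + j) → sum bs ≡ suc (i + j) →
    length as ≡ suc i → length bs ≡ suc j → suc (i + j) < 26 →
    4 * ((product as + pairSum as) + (product bs + pairSum bs)) < target (suc (i + j))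
  far-small as bs i j pa pb sa sb la lb s<26 = ≤-<-trans
    (*-monoʳ-≤ 4 (+-mono-≤
      (+-mono-≤ (cap-sound as i sa la (proj₁ e)) (pairSum-≤ j pa (trans sa (trans (+-comm (suc i) j) (cong (j +_) (≡-sym la))))))
      (+-mono-≤ (cap-sound bs j sb lb (proj₁ (proj₂ e))) (pairSum-≤ i pb (trans sb (trans (≡-sym (+-suc i j)) (cong (i +_) (≡-sym lb))))))))
    (<ᵇ-sound (proj₂ (proj₂ e)))
    where
    lookup-entry : entry i j ≡ true
    lookup-entry = allBelow-sound (entry i) 25
      (allBelow-sound (λ i → allBelow (entry i) 25) 25 entries (≤-<-trans (m≤m+n i j) (≤-pred s<26)))
      (≤-<-trans (m≤n+m j i) (≤-pred s<26))
    strip : ∀ {x} c {y} → c ≡ false → (if c then x else y) ≡ true → y ≡ true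
    strip false _ h = h
    not26 : (26 ≤ᵇ suc (i + j)) ≡ false
    not26 = ¬true⇒false λ h → contradiction (≤ᵇ⇒≤ 26 _ (subst T (≡-sym h) _)) (<⇒≱ s<26)
    e : cap-correct (suc (i + j)) i ≡ true × cap-correct (suc (i + j)) j ≡ true ×
        (4 * ((cap-value (suc (i + j)) i + j * suc j) + (cap-value (suc (i + j)) j + i * suc i)) <ᵇ target (suc (i + j))) ≡ true
    e = let h = strip {true} (26 ≤ᵇ suc (i + j)) not26 lookup-entry
            p , h′ = ∧-split (cap-correct (suc (i + j)) i) h
        in p , ∧-split (cap-correct (suc (i + j)) j) h′

  product≤2^ : ∀ ds e → sum ds ≡ e + length ds → product ds ≤ 2 ^ e
  product≤2^ ds e eq = *-cancelʳ-≤ (product ds) (2 ^ e) (2 ^ length ds) {{m^n≢0 2 (length ds)}}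
    (≤-trans (2^sum-cap ds) (≤-reflexive (trans (cong (2 ^_) eq) (^-distribˡ-+-* 2 e (length ds)))))

  -- `as` is the larger class: its excess j is at most half of i + j, so its product is at most 2^h.
  -- Only the product of `bs` is compared with `top`; after multiplication by 3 it takes 4 of the 6
  -- `top` available, and `powers<top` fits the rest into 2.
  far-large : ∀ as bs i j → Positive as → Positive bs → sum as ≡ suc (i + j) → sum bs ≡ suc (i + j) →
    length as ≡ suc i → length bs ≡ suc j → 26 ≤ suc (i + j) → j ≤ i →
    4 * ((product as + pairSum as) + (product bs + pairSum bs)) < 2 * top (suc (i + j))
  far-large as bs i j pa pb sa sb la lb 26≤s j≤i = *-cancelˡ-< 3 _ _ (begin-strict
    3 * (4 * ((product as + pairSum as) + (product bs + pairSum bs)))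
      ≤⟨ *-monoʳ-≤ 3 (*-monoʳ-≤ 4 (+-mono-≤
           (+-mono-≤ (≤-trans (product≤2^ as j sa′) (^-monoʳ-≤ 2 j≤h)) (pairSum-≤ j pa sa′))
           (+-monoʳ-≤ (product bs) (pairSum-≤ i pb sb′)))) ⟩
    3 * (4 * ((2 ^ h + j * suc j) + (product bs + i * suc i)))
      -- The added term completes `j * suc j + i * suc i` to the square of s = i + j + 1.
      ≤⟨ m≤m+n _ (12 * (2 * (i * j) + suc (i + j))) ⟩
    3 * (4 * ((2 ^ h + j * suc j) + (product bs + i * suc i))) + 12 * (2 * (i * j) + suc (i + j))
      ≡⟨ r (2 ^ h) j (product bs) i ⟩
    4 * (3 * product bs) + 2 * (6 * 2 ^ h + 6 * (suc (i + j) * suc (i + j)))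
      <⟨ +-mono-≤-< (*-monoʳ-≤ 4 (subst (λ s → 3 * product bs ≤ top s) sb (3product≤top bs pb))) (*-monoʳ-< 2 (powers<top 26≤s)) ⟩
    4 * top (suc (i + j)) + 2 * top (suc (i + j))
      ≡⟨ r′ (top (suc (i + j))) ⟩
    3 * (2 * top (suc (i + j))) ∎)
    where
    open ≤-Reasoning
    h = ⌊ i + j /2⌋
    j≤h : j ≤ h
    j≤h = subst (_≤ h) (≡-sym (n≡⌊n+n/2⌋ j)) (⌊n/2⌋-mono (+-monoˡ-≤ j j≤i))
    sa′ : sum as ≡ j + length as
    sa′ = trans sa (trans (+-comm (suc i) j) (cong (j +_) (≡-sym la)))
    sb′ : sum bs ≡ i + length bs
    sb′ = trans sb (trans (≡-sym (+-suc i j)) (cong (i +_) (≡-sym lb)))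
    r : ∀ x j p i → 3 * (4 * ((x + j * suc j) + (p + i * suc i))) + 12 * (2 * (i * j) + suc (i + j))
        ≡ 4 * (3 * p) + 2 * (6 * x + 6 * (suc (i + j) * suc (i + j)))
    r = solve 4 (λ x j p i → con 3 :* (con 4 :* ((x :+ j :* (con 1 :+ j)) :+ (p :+ i :* (con 1 :+ i)))) :+ con 12 :* (con 2 :* (i :* j) :+ (con 1 :+ (i :+ j)))
          := con 4 :* (con 3 :* p) :+ con 2 :* (con 6 :* x :+ con 6 :* ((con 1 :+ (i :+ j)) :* (con 1 :+ (i :+ j))))) refl
    r′ : ∀ x → 4 * x + 2 * x ≡ 3 * (2 * x)
    r′ = solve 1 (λ x → con 4 :* x :+ con 2 :* x := con 3 :* (con 2 :* x)) refl

target-small : ∀ {s} → s ≤ 14 → target s ≡ starValue s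
target-small {s} h with s ≤ᵇ 14 in e
... | true  = refl
... | false = ⊥-elim (true≢false (≤ᵇ-complete h) e)
  where
  ≤ᵇ-complete : ∀ {a b} → a ≤ b → (a ≤ᵇ b) ≡ true
  ≤ᵇ-complete {a} {b} h with a ≤ᵇ b in e
  ... | true  = refl
  ... | false = ⊥-elim (subst T e (≤⇒≤ᵇ h))

target-large : ∀ {s} → 15 ≤ s → target s ≡ Φ (balanced s)
target-large {s} h with s ≤ᵇ 14 in e
... | false = refl
... | true  = contradiction (≤ᵇ⇒≤ s 14 (subst T (≡-sym e) _)) (<⇒≱ h)

far-bound : ∀ as bs {s} → Positive as → Positive bs → sum as ≡ s → sum bs ≡ s → length as + length bs ≡ suc s →
  4 * ((product as + pairSum as) + (product bs + pairSum bs)) < target s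
far-bound [] (b ∷ bs) pa (1≤b ∷ pb) refl sb l = contradiction (≤-trans 1≤b (≤-trans (m≤m+n b (sum bs)) (≤-reflexive sb))) λ ()
far-bound (a ∷ as) [] (1≤a ∷ pa) pb sa refl l = contradiction (≤-trans 1≤a (≤-trans (m≤m+n a (sum as)) (≤-reflexive sa))) λ ()
far-bound as@(_ ∷ as′) bs@(_ ∷ bs′) {s} pa pb sa sb l
  with refl ← trans (≡-sym (suc-injective l)) (+-suc (length as′) (length bs′)) with s <? 26
... | yes s<26 = far-small as bs (length as′) (length bs′) pa pb sa sb refl refl s<26
... | no  s≮26 = <-≤-trans (order (≤-total (length bs′) (length as′)))
        (subst (2 * top s ≤_) (≡-sym (target-large (≤-trans (≤ᵇ⇒≤ 15 26 _) 26≤s))) (2top≤Φ s (≤-trans (≤ᵇ⇒≤ 2 26 _) 26≤s)))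
  where
  26≤s = ≮⇒≥ s≮26
  i = length as′
  j = length bs′
  order : j ≤ i ⊎ i ≤ j → 4 * ((product as + pairSum as) + (product bs + pairSum bs)) < 2 * top s
  order (inj₁ j≤i) = far-large as bs i j pa pb sa sb refl refl 26≤s j≤i
  order (inj₂ i≤j) = subst₂ _<_ (cong (4 *_) (+-comm (product bs + pairSum bs) (product as + pairSum as)))
    (cong (λ s → 2 * top (suc s)) (+-comm j i))
    (far-large bs as j i pb pa (trans sb (cong suc (+-comm i j))) (trans sa (cong suc (+-comm i j))) refl refl
      (subst (λ s → 26 ≤ suc s) (+-comm i j) 26≤s) i≤j)

-- Trees in which no vertex is within distance 2 of all others

module _ {n : ℕ} (G : Graph n) where

  Adj⇒deg≥1 : ∀ {u v} → Adj G u v → 1 ≤ deg G u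
  Adj⇒deg≥1 {u} {v} e = subst (λ b → ⟦ b ⟧ ≤ deg G u) e (∑-upper (λ v → ⟦ adj G u v ⟧) (∈-allFin v))

  walk-first : ∀ {u v k} → Walk G u v k → u ≢ v → ∃ (Adj G u)
  walk-first here       u≢v = contradiction refl u≢v
  walk-first (step e _) _   = _ , e

other-vertex : ∀ {n} → 2 ≤ n → (v : Fin n) → ∃ λ u → v ≢ u
other-vertex (s≤s (s≤s _)) zero    = suc zero , λ ()
other-vertex (s≤s (s≤s _)) (suc v) = zero , λ ()

connected⇒deg≥1 : ∀ {n} (G : Graph n) → Connected G → 2 ≤ n → ∀ v → 1 ≤ deg G v
connected⇒deg≥1 G conn 2≤n v with u , v≢u ← other-vertex 2≤n v
  with _ , e ← walk-first G (proj₂ (conn v u)) v≢u = Adj⇒deg≥1 G e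

Positive-map : ∀ {A : Set} (f : A → ℕ) xs → (∀ x → 1 ≤ f x) → Positive (map f xs)
Positive-map f []       h = []
Positive-map f (x ∷ xs) h = h x ∷ Positive-map f xs h

far-M-bound : ∀ {s} (G : Graph (suc s)) → IsTree G → 1 ≤ s → ∑ (allFin (suc s)) (λ u → 4 * M G u) < target s
far-M-bound {s} G t 1≤s with a , b , bp ← bipartition G t zero = begin-strict
  ∑ N (λ u → 4 * M G u)                                     ≡⟨ ∑-* N 4 (M G) ⟩
  4 * ∑ N (M G)                                             ≡⟨ cong (4 *_) (∑-class G t pos zero bp (M G)) ⟩
  4 * (∑ (filterᵇ a N) (M G) + ∑ (filterᵇ b N) (M G))         ≤⟨ *-monoʳ-≤ 4 (+-mono-≤ (half bp) (half bp′)) ⟩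
  4 * ((product bs + pairSum bs) + (product as + pairSum as)) <⟨ far-bound bs as
      (Positive-map (deg G) (filterᵇ b N) pos) (Positive-map (deg G) (filterᵇ a N) pos)
      (suc-injective (sum-classDegrees G t pos zero bp)) (suc-injective (sum-classDegrees G t pos zero bp′))
      (length-classDegrees G t pos zero bp′) ⟩
  target s ∎
  where
  open ≤-Reasoning
  N = allFin (suc s)
  bp′ = flip-Bipartition G bp
  as = classDegrees G a
  bs = classDegrees G b
  pos : ∀ v → 1 ≤ deg G v
  pos = connected⇒deg≥1 G (proj₁ t) (s≤s 1≤s)
  half : ∀ {a b} → Bipartition G a b → ∑ (filterᵇ a N) (M G) ≤ product (classDegrees G b) + pairSum (classDegrees G b)
  half {a} {b} bp = +-cancelʳ-≤ (sum ds) _ _ (≤-trans (class-M-≤ G t pos zero bp)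
    (≤-reflexive (trans (cong (product ds +_) (square-sum ds)) (≡-sym (+-assoc (product ds) (pairSum ds) (sum ds))))))
    where ds = classDegrees G b

-- Trees in which every vertex is within distance 2 of c

module _ {n : ℕ} (G : Graph n) (c : Fin n) where

  Near : Fin n → Set
  Near v = c ≡ v ⊎ Adj G c v ⊎ ∃ λ b → Adj G c b × Adj G b v

  Outer : Fin n → Set
  Outer x = x ≢ c × ¬ Adj G c x

  rim : List (Fin n)
  rim = filterᵇ (adj G c) (allFin n)

  rimDegrees : List ℕ
  rimDegrees = map (deg G) rim

module Centred {n : ℕ} (G : Graph n) (t : IsTree G) (c : Fin n) (near : ∀ v → Near G c v) where

  private
    N = allFin n
    uN = allFin⁺ n
    no-closed : ∀ {x xs} → NonBacktracking G (x ∷ xs) → x ∉ xs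
    no-closed p x∈ with x∉ ∷ _ ← nonBacktracking⇒Unique G (proj₂ t) p = All.lookup x∉ x∈ refl

  ∈-rim : ∀ {b} → Adj G c b → b ∈ rim G c
  ∈-rim e = ∈-filterᵇ⁺ (adj G c) (∈-allFin _) e

  rim-Adj : ∀ {b} → b ∈ rim G c → Adj G c b
  rim-Adj b∈ = proj₂ (∈-filterᵇ⁻ (adj G c) N b∈)

  Unique-rim : Unique (rim G c)
  Unique-rim = Unique-filterᵇ (adj G c) uN

  no-triangle : ∀ {u v} → Adj G c u → Adj G c v → ¬ Adj G u v
  no-triangle cu cv uv = no-closed
    (turn cu (Adj-≢ G cv) (turn uv (λ { refl → Adj-≢ G cu refl }) (edge (Adj-sym G cv))))
    (there (there (here refl)))

  rim-child-Outer : ∀ {b x} → Adj G c b → Adj G b x → x ≢ c → Outer G c x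
  rim-child-Outer cb bx x≢c = x≢c , λ cx → no-triangle cb cx bx

  Outer-hub : ∀ {x} → Outer G c x → ∃ λ b → Adj G c b × Adj G b x
  Outer-hub {x} (x≢c , ¬cx) with near x
  ... | inj₁ refl        = contradiction refl x≢c
  ... | inj₂ (inj₁ cx)   = contradiction cx ¬cx
  ... | inj₂ (inj₂ h)    = h

  -- A further neighbour y would also be within distance 2 of c, and each way of reaching it from c
  -- yields a closed non-backtracking walk through c or b.
  Outer-unique-neighbour : ∀ {x b y} → Outer G c x → Adj G c b → Adj G x b → Adj G x y → y ≡ b
  Outer-unique-neighbour {x} {b} {y} (x≢c , ¬cx) cb xb xy with y ≟ b
  ... | yes y≡b = y≡b
  ... | no  y≢b with near y
  ...   | inj₁ refl = contradiction (Adj-sym G xy) ¬cx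
  ...   | inj₂ (inj₁ cy) = ⊥-elim (no-closed
            (turn cb (λ { refl → x≢c refl }) (turn (Adj-sym G xb) (λ { refl → y≢b refl }) (turn xy x≢c (edge (Adj-sym G cy)))))
            (there (there (there (here refl)))))
  ...   | inj₂ (inj₂ (b′ , cb′ , b′y)) with b′ ≟ b
  ...     | yes refl = ⊥-elim (no-closed
              (turn (Adj-sym G xb) (λ { refl → y≢b refl }) (turn xy (λ { refl → Adj-≢ G xb refl }) (edge (Adj-sym G b′y))))
              (there (there (here refl))))
  ...     | no b′≢b = ⊥-elim (no-closed
              (turn cb (λ { refl → x≢c refl }) (turn (Adj-sym G xb) (λ { refl → y≢b refl })
                (turn xy (λ { refl → ¬cx cb′ }) (turn (Adj-sym G b′y) (λ { refl → ¬cx (Adj-sym G xy) }) (edge (Adj-sym G cb′))))))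
              (there (there (there (there (here refl))))))

  deg-Outer : ∀ {x} → Outer G c x → deg G x ≡ 1
  deg-Outer {x} o with b , cb , bx ← Outer-hub o = trans
    (∑-single uN (∈-allFin b) λ {y} _ y≢b → cong ⟦_⟧ (¬true⇒false λ xy → y≢b (Outer-unique-neighbour o cb (Adj-sym G bx) xy)))
    (cong ⟦_⟧ (Adj-sym G bx))

  M-Outer : ∀ {x b} → Outer G c x → Adj G c b → Adj G x b → M G x ≡ deg G b
  M-Outer {x} {b} o cb xb = trans
    (∏-single uN (∈-allFin b) λ {y} _ y≢b →
      cong (λ e → if e then deg G y else 1) (¬true⇒false λ xy → y≢b (Outer-unique-neighbour o cb xb xy)))
    (cong (λ e → if e then deg G b else 1) xb)

  M-rim : ∀ {b} → Adj G c b → M G b ≡ deg G c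
  M-rim {b} cb = trans (∏-single uN (∈-allFin c) λ {y} _ y≢c → one y y≢c)
    (cong (λ e → if e then deg G c else 1) (Adj-sym G cb))
    where
    one : ∀ y → y ≢ c → (if adj G b y then deg G y else 1) ≡ 1
    one y y≢c with adj G b y in e
    ... | true  = deg-Outer (rim-child-Outer cb e y≢c)
    ... | false = refl

  M-centre : M G c ≡ product (rimDegrees G c)
  M-centre = ≡-sym (∏-filterᵇ (adj G c) (deg G) N)

  length-rimDegrees : length (rimDegrees G c) ≡ deg G c
  length-rimDegrees = trans (length-map (deg G) (rim G c)) (length-filterᵇ (adj G c) N)

  -- A rim vertex b has deg b - 1 outer neighbours, all of value `F b`; its remaining neighbour is
  -- c. The sum of `F` added on the left compensates for counting c among the deg b neighbours.
  layered-sum : ∀ (F h : Fin n → ℕ) → (∀ {x b} → Outer G c x → Adj G c b → Adj G x b → h x ≡ F b) →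
    ∑ N h + ∑ (rim G c) F ≡ h c + ∑ (rim G c) h + ∑ (rim G c) (λ b → F b * deg G b)
  layered-sum F h outer = begin
    ∑ N h + ∑ (rim G c) F
      ≡⟨ cong (∑ N h +_) (≡-sym (at-c (∑ (rim G c) F))) ⟩
    ∑ N h + ∑ N (λ u → if eq u then ∑ (rim G c) F else 0)
      ≡⟨ ≡-sym (∑-+ N h _) ⟩
    ∑ N (λ u → h u + (if eq u then ∑ (rim G c) F else 0))
      ≡⟨ ∑-cong N (λ {u} _ → pointwise u) ⟩
    ∑ N (λ u → (if eq u then h c else 0) + (if adj G c u then h u else 0) + R u)
      ≡⟨ trans (∑-+ N _ R) (cong (_+ ∑ N R) (∑-+ N _ _)) ⟩
    ∑ N (λ u → if eq u then h c else 0) + ∑ N (λ u → if adj G c u then h u else 0) + ∑ N R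
      ≡⟨ cong₂ _+_ (cong₂ _+_ (at-c (h c)) (≡-sym (∑-filterᵇ (adj G c) h N))) ∑R ⟩
    h c + ∑ (rim G c) h + ∑ (rim G c) (λ b → F b * deg G b) ∎
    where
    open ≡-Reasoning
    eq : Fin n → Bool
    eq u = does (u ≟ c)
    -- The sum of `F` over the rim neighbours of u: all of it at c, nothing on the rim, the value of
    -- the hub at an outer vertex.
    R : Fin n → ℕ
    R u = ∑ (rim G c) λ b → F b * ⟦ adj G b u ⟧
    at-c : ∀ m → ∑ N (λ u → if eq u then m else 0) ≡ m
    at-c m = trans
      (∑-single uN (∈-allFin c) λ {u} _ u≢c → cong (λ b → if b then m else 0) (dec-false (u ≟ c) u≢c))
      (cong (λ b → if b then m else 0) (dec-true (c ≟ c) refl))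
    ∑R : ∑ N R ≡ ∑ (rim G c) (λ b → F b * deg G b)
    ∑R = trans (∑-swap N (rim G c) _) (∑-cong (rim G c) λ {b} _ → ∑-* N (F b) (λ u → ⟦ adj G b u ⟧))
    pointwise : ∀ u → h u + (if eq u then ∑ (rim G c) F else 0)
                      ≡ (if eq u then h c else 0) + (if adj G c u then h u else 0) + R u
    pointwise u with u ≟ c
    ... | yes refl rewrite irrefl G c = cong₂ _+_ (≡-sym (+-identityʳ (h c)))
            (∑-cong (rim G c) λ {b} b∈ → ≡-sym (trans (cong (λ e → F b * ⟦ e ⟧) (Adj-sym G (rim-Adj b∈))) (*-identityʳ (F b))))
    ... | no u≢c with adj G c u in cu
    ...   | true = cong (h u +_) (≡-sym (∑-zero (rim G c) λ {b} b∈ →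
              trans (cong (λ e → F b * ⟦ e ⟧) (¬true⇒false (no-triangle (rim-Adj b∈) cu))) (*-zeroʳ (F b))))
    ...   | false with o ← u≢c , (λ e → true≢false e cu) with b , cb , bu ← Outer-hub o = begin
              h u + 0                   ≡⟨ +-identityʳ (h u) ⟩
              h u                       ≡⟨ outer o cb (Adj-sym G bu) ⟩
              F b                       ≡⟨ ≡-sym (trans (cong (λ e → F b * ⟦ e ⟧) bu) (*-identityʳ (F b))) ⟩
              F b * ⟦ adj G b u ⟧       ≡⟨ ≡-sym (∑-single Unique-rim (∈-rim cb) λ {b′} b′∈ b′≢b →
                                             trans (cong (λ e → F b′ * ⟦ e ⟧) (¬true⇒false λ b′u →
                                               b′≢b (Outer-unique-neighbour o cb (Adj-sym G bu) (Adj-sym G b′u)))) (*-zeroʳ (F b′))) ⟩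
              R u                       ∎

  -- `layered-sum` with constant 1 counts the vertices: centre, rim, and deg b - 1 outer vertices
  -- for each b.
  sum-rimDegrees : suc (sum (rimDegrees G c)) ≡ n
  sum-rimDegrees = +-cancelʳ-≡ k _ _ (begin
    suc (∑ (rim G c) (deg G)) + k
      ≡⟨ cong suc (trans (+-comm _ k) (cong (k +_) (∑-cong (rim G c) λ _ → ≡-sym (*-identityˡ _)))) ⟩
    1 + k + ∑ (rim G c) (λ b → 1 * deg G b)
      ≡⟨ ≡-sym (layered-sum (λ _ → 1) (λ _ → 1) λ _ _ _ → refl) ⟩
    ∑ N (λ _ → 1) + k
      ≡⟨ cong (_+ k) (trans (∑-ones N) (length-tabulate (λ i → i))) ⟩
    n + k ∎)
    where
    open ≡-Reasoning
    k = ∑ (rim G c) (λ _ → 1)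

  -- M is the product of the rim degrees at c, deg c on the rim and the degree of the hub outside.
  -- The weight may vary on the rim, because in a double star one rim vertex is a second centre.
  weighted-M-sum : ∀ (w : Fin n → ℕ) w₂ → (∀ {x} → Outer G c x → w x ≡ w₂) →
    ∑ N (λ u → w u * M G u) ≡ w c * product (rimDegrees G c) + ∑ (rim G c) w * deg G c + w₂ * pairSum (rimDegrees G c)
  weighted-M-sum w w₂ w-outer = +-cancelʳ-≡ (∑ (rim G c) (λ b → w₂ * deg G b)) _ _ (begin
    ∑ N (λ u → w u * M G u) + ∑ (rim G c) (λ b → w₂ * deg G b)
      ≡⟨ layered-sum (λ b → w₂ * deg G b) (λ u → w u * M G u)
           (λ o cb xb → cong₂ _*_ (w-outer o) (M-Outer o cb xb)) ⟩
    w c * M G c + ∑ (rim G c) (λ b → w b * M G b) + ∑ (rim G c) (λ b → w₂ * deg G b * deg G b)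
      ≡⟨ cong₂ _+_ (cong₂ _+_ (cong (w c *_) M-centre) rim-part) square-part ⟩
    w c * product ds + ∑ (rim G c) w * deg G c + (w₂ * pairSum ds + w₂ * sum ds)
      ≡⟨ ≡-sym (+-assoc (w c * product ds + ∑ (rim G c) w * deg G c) _ _) ⟩
    w c * product ds + ∑ (rim G c) w * deg G c + w₂ * pairSum ds + w₂ * sum ds
      ≡⟨ cong (w c * product ds + ∑ (rim G c) w * deg G c + w₂ * pairSum ds +_) (≡-sym (∑-* (rim G c) w₂ (deg G))) ⟩
    w c * product ds + ∑ (rim G c) w * deg G c + w₂ * pairSum ds + ∑ (rim G c) (λ b → w₂ * deg G b) ∎)
    where
    open ≡-Reasoning
    ds = rimDegrees G c
    rim-part : ∑ (rim G c) (λ b → w b * M G b) ≡ ∑ (rim G c) w * deg G c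
    rim-part = trans (∑-cong (rim G c) λ {b} b∈ → trans (cong (w b *_) (M-rim (rim-Adj b∈))) (*-comm (w b) (deg G c)))
      (trans (∑-* (rim G c) (deg G c) w) (*-comm (deg G c) _))
    square-part : ∑ (rim G c) (λ b → w₂ * deg G b * deg G b) ≡ w₂ * pairSum ds + w₂ * sum ds
    square-part = begin
      ∑ (rim G c) (λ b → w₂ * deg G b * deg G b)   ≡⟨ ∑-cong (rim G c) (λ {b} _ → *-assoc w₂ (deg G b) (deg G b)) ⟩
      ∑ (rim G c) (λ b → w₂ * (deg G b * deg G b)) ≡⟨ ∑-* (rim G c) w₂ _ ⟩
      w₂ * ∑ (rim G c) (λ b → deg G b * deg G b)   ≡⟨ cong (λ l → w₂ * sum l) (map-∘ (rim G c)) ⟩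
      w₂ * ∑ ds (λ d → d * d)                      ≡⟨ cong (w₂ *_) (square-sum ds) ⟩
      w₂ * (pairSum ds + sum ds)                   ≡⟨ *-distribˡ-+ w₂ (pairSum ds) (sum ds) ⟩
      w₂ * pairSum ds + w₂ * sum ds                ∎

other-neighbour : ∀ {n} (G : Graph n) {p c} → 2 ≤ deg G p → ∃ λ x → Adj G p x × x ≢ c
other-neighbour {n} G {p} {c} 2≤d with any? (λ x → (adj G p x ≟ᵇ true) ×-dec ¬? (x ≟ c))
... | yes found = found
... | no ¬found = contradiction (≤-trans 2≤d (≤-trans (≤-reflexive single) (⟦⟧≤1 (adj G p c)))) 1+n≰n
  where
  single : deg G p ≡ ⟦ adj G p c ⟧
  single = ∑-single (allFin⁺ n) (∈-allFin c) λ {x} _ x≢c → cong ⟦_⟧ (¬true⇒false λ e → ¬found (x , e , x≢c))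
  ⟦⟧≤1 : ∀ b → ⟦ b ⟧ ≤ 1
  ⟦⟧≤1 true  = ≤-refl
  ⟦⟧≤1 false = z≤n

two-neighbours : ∀ {n} (G : Graph n) {b u v} → u ≢ v → Adj G b u → Adj G b v → 2 ≤ deg G b
two-neighbours {n} G {b} {u} {v} u≢v bu bv = subst₂ (λ x y → ⟦ x ⟧ + ⟦ y ⟧ ≤ deg G b) bu bv
  (∑-upper₂ (λ v → ⟦ adj G b v ⟧) u≢v (∈-allFin u) (∈-allFin v))

module Eccentricity {n : ℕ} (G : Graph n) (t : IsTree G) (c : Fin n) (near : ∀ v → Near G c v) where

  open Centred G t c near

  -- Every walk into x from elsewhere ends with the edge from p, and p is neither b nor adjacent to
  -- b.
  no-short-walk-to-Outer : ∀ {b p x} → Adj G c b → Adj G c p → b ≢ p → Adj G p x → x ≢ c →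
                           ∀ {i} → i < 3 → ¬ Walk G b x i
  no-short-walk-to-Outer {b} {p} {x} cb cp b≢p px x≢c i<3 walk with o ← rim-child-Outer cp px x≢c | i<3 | walk
  ... | _ | here                       = proj₂ o cb
  ... | _ | step bx here               = b≢p (Outer-unique-neighbour o cp (Adj-sym G px) (Adj-sym G bx))
  ... | _ | step by (step yx here) with refl ← Outer-unique-neighbour o cp (Adj-sym G px) (Adj-sym G yx) =
        no-triangle cb cp by
  ... | s≤s (s≤s (s≤s ())) | step _ (step _ (step _ _))

  private
    walks : ∀ v → ∃ λ k → k ≤ 2 × Walk G c v k
    walks v with near v
    ... | inj₁ refl               = 0 , z≤n , here
    ... | inj₂ (inj₁ e)           = 1 , s≤s z≤n , step e here
    ... | inj₂ (inj₂ (_ , e , d)) = 2 , ≤-refl , step e (step d here)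

  ecc-centre-≤ : ecc G c ≤ 2
  ecc-centre-≤ = ecc-≤ G walks

  extend-walks : ∀ {u b m} → Adj G u b → (∀ v → ∃ λ k → k ≤ m × Walk G b v k) → ∀ v → ∃ λ k → k ≤ suc m × Walk G u v k
  extend-walks e w v with k , k≤ , p ← w v = suc k , s≤s k≤ , step e p

  ecc-rim-≤ : ∀ {b} → Adj G c b → ecc G b ≤ 3
  ecc-rim-≤ cb = ecc-≤ G (extend-walks (Adj-sym G cb) walks)

  ecc-Outer-≤ : ∀ {x} → Outer G c x → ecc G x ≤ 4
  ecc-Outer-≤ o with b , cb , bx ← Outer-hub o =
    ecc-≤ G (extend-walks (Adj-sym G bx) (extend-walks (Adj-sym G cb) walks))

  layer : (f₀ f₁ f₂ : ℕ) → Fin n → ℕ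
  layer f₀ f₁ f₂ u = if does (u ≟ c) then f₀ else if adj G c u then f₁ else f₂

  -- The value of `layer` is an index of `P`, so one principle serves equations and inequalities
  -- between eccentricities and weights.
  layer-ind : ∀ {f₀ f₁ f₂} (P : Fin n → ℕ → Set) → P c f₀ → (∀ {b} → Adj G c b → P b f₁) →
              (∀ {x} → Outer G c x → P x f₂) → ∀ u → P u (layer f₀ f₁ f₂ u)
  layer-ind P p₀ p₁ p₂ u with u ≟ c
  ... | yes refl = p₀
  ... | no u≢c with adj G c u in e
  ...   | true  = p₁ e
  ...   | false = p₂ (u≢c , λ d → true≢false d e)

  layer-rim : ∀ {f₀ f₁ f₂ b} → Adj G c b → layer f₀ f₁ f₂ b ≡ f₁
  layer-rim {b = b} cb rewrite dec-false (b ≟ c) (λ { refl → Adj-≢ G cb refl }) | cb = refl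

  layer-Outer : ∀ {f₀ f₁ f₂ x} → Outer G c x → layer f₀ f₁ f₂ x ≡ f₂
  layer-Outer {x = x} (x≢c , ¬cx) rewrite dec-false (x ≟ c) x≢c | ¬true⇒false ¬cx = refl

  layer-centre : ∀ {f₀ f₁ f₂} → layer f₀ f₁ f₂ c ≡ f₀
  layer-centre rewrite dec-true (c ≟ c) refl = refl

  ∑-rim-layer : ∀ f₀ f₁ f₂ → ∑ (rim G c) (layer f₀ f₁ f₂) ≡ f₁ * deg G c
  ∑-rim-layer f₀ f₁ f₂ = trans (∑-cong (rim G c) λ b∈ → trans (layer-rim (rim-Adj b∈)) (≡-sym (*-identityʳ f₁)))
    (trans (∑-* (rim G c) f₁ (λ _ → 1)) (cong (f₁ *_) (trans (∑-filterᵇ (adj G c) (λ _ → 1) (allFin n)) refl)))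

  layer-M-sum : ∀ f₀ f₁ f₂ → let ds = rimDegrees G c in
    ∑ (allFin n) (λ u → layer f₀ f₁ f₂ u * M G u) ≡ f₀ * product ds + f₁ * (length ds * length ds) + f₂ * pairSum ds
  layer-M-sum f₀ f₁ f₂ = trans (weighted-M-sum (layer f₀ f₁ f₂) f₂ layer-Outer)
    (cong₂ (λ x y → x * product (rimDegrees G c) + y + f₂ * pairSum (rimDegrees G c)) layer-centre
      (trans (cong (_* deg G c) (∑-rim-layer f₀ f₁ f₂)) (trans (*-assoc f₁ (deg G c) (deg G c))
        (cong (λ k → f₁ * (k * k)) (≡-sym length-rimDegrees)))))

  module _ {p q} (cp : Adj G c p) (cq : Adj G c q) (p≢q : p ≢ q) (2≤p : 2 ≤ deg G p) (2≤q : 2 ≤ deg G q) where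

    private
      -- Of p and q at least one differs from b, and its outer neighbour lies at distance 3 from b
      -- and 4 from the outer neighbours of b. This is the witness for all lower bounds on and
      -- outside the rim.
      away : ∀ b → ∃ λ r → b ≢ r × Adj G c r × (∃ λ x → Adj G r x × x ≢ c)
      away b with b ≟ p
      ... | yes refl = q , p≢q , cq , other-neighbour G 2≤q
      ... | no  b≢p  = p , b≢p , cp , other-neighbour G 2≤p

      4≤n : 4 ≤ n
      4≤n with x , px , x≢c ← other-neighbour G {c = c} 2≤p with o ← rim-child-Outer cp px x≢c = Unique⇒length≤ {xs = c ∷ p ∷ q ∷ x ∷ []}
        ((Adj-≢ G cp ∷ Adj-≢ G cq ∷ (λ { refl → x≢c refl }) ∷ []) ∷ (p≢q ∷ Adj-≢ G px ∷ []) ∷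
         ((λ { refl → proj₂ o cq }) ∷ []) ∷ [] ∷ [])

    ecc-centre : ecc G c ≡ 2
    ecc-centre with x , px , x≢c ← other-neighbour G {c = c} 2≤p with o ← rim-child-Outer cp px x≢c =
      ≤-antisym ecc-centre-≤ (ecc-≥ G x (≤-trans (≤ᵇ⇒≤ 2 4 _) 4≤n) none)
      where
      none : ∀ {i} → i < 2 → ¬ Walk G c x i
      none _ here            = x≢c refl
      none _ (step cx here)  = proj₂ o cx
      none (s≤s (s≤s ())) (step _ (step _ _))

    ecc-rim : ∀ {b} → Adj G c b → ecc G b ≡ 3
    ecc-rim {b} cb with r , b≢r , cr , x , rx , x≢c ← away b =
      ≤-antisym (ecc-rim-≤ cb) (ecc-≥ G x (≤-trans (≤ᵇ⇒≤ 3 4 _) 4≤n) (no-short-walk-to-Outer cb cr b≢r rx x≢c))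

    ecc-Outer : ∀ {x} → Outer G c x → ecc G x ≡ 4
    ecc-Outer {x′} o with b , cb , bx′ ← Outer-hub o with r , b≢r , cr , x , rx , x≢c ← away b =
      ≤-antisym (ecc-Outer-≤ o) (ecc-≥ G x 4≤n none)
      where
      none : ∀ {i} → i < 4 → ¬ Walk G x′ x i
      none _ here = b≢r (Outer-unique-neighbour o cr (Adj-sym G rx) (Adj-sym G bx′))
      none (s≤s i<3) (step x′y p) with refl ← Outer-unique-neighbour o cb (Adj-sym G bx′) x′y =
        no-short-walk-to-Outer cb cr b≢r rx x≢c i<3 p

    ecc≡layer : ∀ u → ecc G u ≡ layer 2 3 4 u
    ecc≡layer = layer-ind (λ u e → ecc G u ≡ e) ecc-centre ecc-rim ecc-Outer

    ecc-centre-min : ∀ v → ecc G c ≤ ecc G v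
    ecc-centre-min v = subst₂ _≤_ (≡-sym ecc-centre) (≡-sym (ecc≡layer v))
      (layer-ind (λ _ e → 2 ≤ e) ≤-refl (λ _ → ≤ᵇ⇒≤ 2 3 _) (λ _ → ≤ᵇ⇒≤ 2 4 _) v)

    diameter≡4 : diameter G ≡ 4
    diameter≡4 with x , px , x≢c ← other-neighbour G {c = c} 2≤p = ≤-antisym
      (diameter-lub G λ u → subst (_≤ 4) (≡-sym (ecc≡layer u))
        (layer-ind (λ _ e → e ≤ 4) (≤ᵇ⇒≤ 2 4 _) (λ _ → ≤ᵇ⇒≤ 3 4 _) (λ _ → ≤-refl) u))
      (≤-trans (≤-reflexive (≡-sym (ecc-Outer (rim-child-Outer cp px x≢c)))) (ecc≤diameter G x))

    xi-diameter-4 : xi G ≡ over12 (Φ (rimDegrees G c))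
    xi-diameter-4 = trans (ℚ.≤-antisym (xi-upper G w λ u → ≤-reflexive (≡-sym (w-ecc u))) (xi-lower G w λ u → ≤-reflexive (w-ecc u)))
      (cong over12 (layer-M-sum 6 4 3))
      where
      -- 12 divided by the eccentricities 2, 3, 4. As these are exact, upper and lower bound
      -- coincide.
      w = layer 6 4 3
      w-ecc : ∀ u → w u * suc (ecc G u ∸ 1) ≡ 12
      w-ecc = layer-ind (λ u f → f * suc (ecc G u ∸ 1) ≡ 12)
        (cong (λ e → 6 * suc (e ∸ 1)) ecc-centre)
        (λ cb → cong (λ e → 4 * suc (e ∸ 1)) (ecc-rim cb))
        (λ o → cong (λ e → 3 * suc (e ∸ 1)) (ecc-Outer o))

  module _ {p q x} (cp : Adj G c p) (cq : Adj G c q) (p≢q : p ≢ q) (qx : Adj G q x) (x≢c : x ≢ c)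
           (leaves : ∀ {b} → Adj G c b → b ≢ q → deg G b ≡ 1) where

    private
      3≤n : 3 ≤ n
      3≤n = Unique⇒length≤ {xs = c ∷ p ∷ q ∷ []} ((Adj-≢ G cp ∷ Adj-≢ G cq ∷ []) ∷ (p≢q ∷ []) ∷ [] ∷ [])

      hub≡q : ∀ {y b} → Outer G c y → Adj G c b → Adj G b y → b ≡ q
      hub≡q {y} {b} o cb by with b ≟ q
      ... | yes b≡q = b≡q
      ... | no  b≢q = contradiction (≤-trans (two-neighbours G {u = c} (λ { refl → proj₁ o refl }) (Adj-sym G cb) by)
                                             (≤-reflexive (leaves cb b≢q))) 1+n≰n

      -- 12 / 2 at the two centres c and q, 12 / 3 at all leaves.
      w : Fin n → ℕ
      w u = if does (u ≟ q) then 6 else layer 6 4 4 u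

      ecc-c : 2 ≤ ecc G c
      ecc-c = ecc-≥ G x (≤-trans (≤ᵇ⇒≤ 2 3 _) 3≤n) none
        where
        none : ∀ {i} → i < 2 → ¬ Walk G c x i
        none _ here            = x≢c refl
        none _ (step cx here)  = proj₂ (rim-child-Outer cq qx x≢c) cx
        none (s≤s (s≤s ())) (step _ (step _ _))

      no-short-q-p : ∀ {i} → i < 2 → ¬ Walk G q p i
      no-short-q-p _ here           = p≢q refl
      no-short-q-p _ (step qp here) = no-triangle cq cp qp
      no-short-q-p (s≤s (s≤s ())) (step _ (step _ _))

      ecc-q : 2 ≤ ecc G q
      ecc-q = ecc-≥ G p (≤-trans (≤ᵇ⇒≤ 2 3 _) 3≤n) no-short-q-p

      ecc-other : ∀ {b} → Adj G c b → b ≢ q → 3 ≤ ecc G b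
      ecc-other cb b≢q = ecc-≥ G x 3≤n (no-short-walk-to-Outer cb cq b≢q qx x≢c)

      ecc-leaf : ∀ {y} → Outer G c y → 3 ≤ ecc G y
      ecc-leaf {y} o with b , cb , by ← Outer-hub o with refl ← hub≡q o cb by = ecc-≥ G p 3≤n none
        where
        none : ∀ {i} → i < 3 → ¬ Walk G y p i
        none _ here = proj₂ o cp
        none (s≤s i<2) (step yz walk) with refl ← Outer-unique-neighbour o cb (Adj-sym G by) yz = no-short-q-p i<2 walk

      scaled : ∀ {k e} m → k * suc m ≡ 12 → suc m ≤ e → 12 ≤ k * suc (e ∸ 1)
      scaled {k} {suc e} m eq (s≤s m≤e) = ≤-trans (≤-reflexive (≡-sym eq)) (*-monoʳ-≤ k (s≤s m≤e))

      w-ecc : ∀ u → 12 ≤ w u * suc (ecc G u ∸ 1)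
      w-ecc u with u ≟ q
      ... | yes refl = scaled {6} 1 refl ecc-q
      ... | no  u≢q = layer-ind (λ u f → u ≢ q → 12 ≤ f * suc (ecc G u ∸ 1))
              (λ _ → scaled {6} 1 refl ecc-c) (λ cb b≢q → scaled {4} 2 refl (ecc-other cb b≢q))
              (λ o _ → scaled {4} 2 refl (ecc-leaf o)) u u≢q

      w-c : w c ≡ 6
      w-c with c ≟ q
      ... | yes _ = refl
      ... | no  _ = layer-centre

      w-Outer : ∀ {y} → Outer G c y → w y ≡ 4
      w-Outer {y} o with y ≟ q
      ... | yes refl = contradiction cq (proj₂ o)
      ... | no  _    = layer-Outer o

      q∈ : q ∈ rim G c
      q∈ = ∈-rim cq

      k′ = pred (deg G c)
      d′ = pred (deg G q)

      ∑-rim-one : ∑ (rim G c) (λ _ → 1) ≡ deg G c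
      ∑-rim-one = ∑-filterᵇ (adj G c) (λ _ → 1) (allFin n)

      sum-w : ∑ (rim G c) w ≡ 4 * deg G c + 2
      sum-w = trans (∑-cong (rim G c) λ {b} b∈ → w-rim b (rim-Adj b∈))
        (trans (∑-+ (rim G c) (λ _ → 4 * 1) extra) (cong₂ _+_ (trans (∑-* (rim G c) 4 (λ _ → 1)) (cong (4 *_) ∑-rim-one))
          (trans (∑-single Unique-rim q∈ λ {b} _ b≢q → cong (λ e → if e then 2 else 0) (dec-false (b ≟ q) b≢q))
            (cong (λ e → if e then 2 else 0) (dec-true (q ≟ q) refl)))))
        where
        extra : Fin n → ℕ
        extra b = if does (b ≟ q) then 2 else 0
        w-rim : ∀ b → Adj G c b → w b ≡ 4 * 1 + extra b
        w-rim b cb with b ≟ q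
        ... | yes _ = refl
        ... | no  _ = layer-rim cb

      product-ds : product (rimDegrees G c) ≡ deg G q
      product-ds = ∏-single {f = deg G} Unique-rim q∈ λ b∈ b≢q → leaves (rim-Adj b∈) b≢q

      pairSum-ds : pairSum (rimDegrees G c) ≡ deg G q * d′
      pairSum-ds = trans (cong sum (≡-sym (map-∘ (rim G c))))
        (∑-single {f = λ b → deg G b * pred (deg G b)} Unique-rim q∈ λ b∈ b≢q → cong (λ d → d * pred d) (leaves (rim-Adj b∈) b≢q))

      sum-ds : sum (rimDegrees G c) ≡ d′ + deg G c
      sum-ds = trans (∑-cong (rim G c) λ {b} b∈ → trans (≡-sym (suc-pred-≥1 (Adj⇒deg≥1 G (Adj-sym G (rim-Adj b∈))))) (+-comm 1 (pred (deg G b))))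
        (trans (∑-+ (rim G c) (pred ∘ deg G) (λ _ → 1)) (cong₂ _+_ (∑-single {f = pred ∘ deg G} Unique-rim q∈ λ b∈ b≢q → cong pred (leaves (rim-Adj b∈) b≢q)) ∑-rim-one))

    -- With k′ leaves at c and d′ leaves at q both values are polynomials in k′ and d′, and the star
    -- exceeds the bound for the double star by a polynomial with positive coefficients, the summand
    -- added in `identity`.
    double-star-bound : ∃ λ m → m < starValue (sum (rimDegrees G c)) × xi G ≤ℚ over12 m
    double-star-bound = _ , small , xi-upper G w w-ecc
      where
      open ≤-Reasoning
      identity : ∀ k d → 6 * suc d + (4 * suc k + 2) * suc k + 4 * (suc d * d) + (6 + 2 * k + 2 * d + 2 * (k * k) + 2 * (d * d) + 12 * (k * d))
                 ≡ 12 + 6 * ((d + suc k) * (d + suc k))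
      identity = solve 2 (λ k d → con 6 :* (con 1 :+ d) :+ (con 4 :* (con 1 :+ k) :+ con 2) :* (con 1 :+ k) :+ con 4 :* ((con 1 :+ d) :* d)
          :+ (con 6 :+ con 2 :* k :+ con 2 :* d :+ con 2 :* (k :* k) :+ con 2 :* (d :* d) :+ con 12 :* (k :* d))
          := con 12 :+ con 6 :* ((d :+ (con 1 :+ k)) :* (d :+ (con 1 :+ k)))) refl
      k≡ : suc k′ ≡ deg G c
      k≡ = suc-pred-≥1 (Adj⇒deg≥1 G cq)
      d≡ : suc d′ ≡ deg G q
      d≡ = suc-pred-≥1 (Adj⇒deg≥1 G qx)
      small : ∑ (allFin n) (λ u → w u * M G u) < starValue (sum (rimDegrees G c))
      small = begin-strict
        ∑ (allFin n) (λ u → w u * M G u) ≡⟨ weighted-M-sum w 4 w-Outer ⟩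
        w c * product (rimDegrees G c) + ∑ (rim G c) w * deg G c + 4 * pairSum (rimDegrees G c)
          ≡⟨ cong₂ _+_ (cong₂ _+_ (cong₂ _*_ w-c product-ds) (cong (_* deg G c) sum-w)) (cong (4 *_) pairSum-ds) ⟩
        6 * deg G q + (4 * deg G c + 2) * deg G c + 4 * (deg G q * d′)
          ≡⟨ cong₂ (λ k d → 6 * d + (4 * k + 2) * k + 4 * (d * d′)) (≡-sym k≡) (≡-sym d≡) ⟩
        6 * suc d′ + (4 * suc k′ + 2) * suc k′ + 4 * (suc d′ * d′)
          <⟨ m<m+n _ (s≤s z≤n) ⟩
        6 * suc d′ + (4 * suc k′ + 2) * suc k′ + 4 * (suc d′ * d′) + (6 + 2 * k′ + 2 * d′ + 2 * (k′ * k′) + 2 * (d′ * d′) + 12 * (k′ * d′))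
          ≡⟨ identity k′ d′ ⟩
        starValue (d′ + suc k′)
          ≡⟨ cong starValue (trans (cong (d′ +_) k≡) (≡-sym sum-ds)) ⟩
        starValue (sum (rimDegrees G c)) ∎

-- Parent functions

module _ {n : ℕ} (G : Graph n) (par : Fin n → Fin n) (h : Fin n → ℕ)
         (up-down : ∀ {u v} → Adj G u v → (par u ≡ v × h v < h u) ⊎ (par v ≡ u × h u < h v)) where

  private
    -- Once a path without repetitions steps away from the root it can never turn back.
    descend : ∀ {u v e} ws → par v ≡ u → h u < h v → e ≢ u → Unique (u ∷ v ∷ ws) → e ∉ v ∷ ws →
              Linked (Adj G) (v ∷ ws ++ [ e ]) → h u < h e × par e ∈ v ∷ ws
    descend [] pv u<v e≢u uq e∉ (ve ∷ [-]) with up-down ve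
    ... | inj₁ (pv′ , _)   = contradiction (trans (≡-sym pv′) pv) e≢u
    ... | inj₂ (pe , v<e)  = <-trans u<v v<e , here pe
    descend (w ∷ ws) pv u<v e≢u ((_ ∷ u≢w ∷ _) ∷ uq) e∉ (vw ∷ l) with up-down vw
    ... | inj₁ (pv′ , _)   = contradiction (trans (≡-sym pv) pv′) u≢w
    ... | inj₂ (pw , v<w) with v<e , pe∈ ← descend ws pw v<w (λ { refl → e∉ (here refl) }) uq (e∉ ∘ there) l =
          <-trans u<v v<e , there pe∈

    -- Either the path climbs all the way to e, or it turns down once and keeps descending, and then
    -- the parent of e is a vertex after the first one.
    travel : ∀ {u v e} ws → e ≢ u → Unique (u ∷ v ∷ ws) → e ∉ v ∷ ws →
             Linked (Adj G) (u ∷ v ∷ ws ++ [ e ]) → h e < h u ⊎ par e ∈ v ∷ ws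
    travel ws e≢u uq e∉ (uv ∷ l) with up-down uv
    travel ws e≢u uq e∉ (uv ∷ l) | inj₂ (pv , u<v) = inj₂ (proj₂ (descend ws pv u<v e≢u uq e∉ l))
    travel [] e≢u uq e∉ (uv ∷ ve ∷ [-]) | inj₁ (_ , v<u) with up-down ve
    ... | inj₁ (_ , e<v) = inj₁ (<-trans e<v v<u)
    ... | inj₂ (pe , _)  = inj₂ (here pe)
    travel (w ∷ ws) e≢u (_ ∷ uq) e∉ (uv ∷ l) | inj₁ (_ , v<u) with travel ws (λ { refl → e∉ (here refl) }) uq (e∉ ∘ there) l
    ... | inj₁ e<v = inj₁ (<-trans e<v v<u)
    ... | inj₂ pe∈ = inj₂ (there pe∈)

  -- If the edge from x to y leads up, then y is the parent of x, and following the cycle back to x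
  -- would either climb to x or enter it from another parent. If it leads down, heights increase all
  -- the way round.
  parent⇒acyclic : HasCycle G → ⊥
  parent⇒acyclic (_ , _ ∷ [] , s≤s () , _)
  parent⇒acyclic (x , y ∷ w ∷ ws , _ , x∉ ∷ uq@(y∉ ∷ _) , xy ∷ l@(yw ∷ l′)) with up-down xy
  ... | inj₁ (px , y<x) with travel ws (All.lookup x∉ (here refl)) uq (λ x∈ → All.lookup x∉ (there x∈) refl) l
  ...   | inj₁ x<y = <-asym x<y y<x
  ...   | inj₂ px∈ = All.lookup y∉ px∈ (≡-sym px)
  parent⇒acyclic (x , y ∷ w ∷ ws , _ , x∉ ∷ uq@(y∉ ∷ _) , xy ∷ l@(yw ∷ l′)) | inj₂ (py , x<y) with up-down yw
  ... | inj₁ (py′ , _) = All.lookup x∉ (there (here refl)) (trans (≡-sym py) py′)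
  ... | inj₂ (pw , y<w) = <-asym x<y
          (proj₁ (descend ws pw y<w (All.lookup x∉ (here refl)) uq (λ x∈ → All.lookup x∉ (there x∈) refl) l′))

near⇒connected : ∀ {n} (G : Graph n) c → (∀ v → Near G c v) → Connected G
near⇒connected G c near u v = _ , Walk-++ (Walk-reverse (proj₂ (from-c u))) (proj₂ (from-c v))
  where
  from-c : ∀ v → ∃ λ k → Walk G c v k
  from-c v with near v
  ... | inj₁ refl               = 0 , here
  ... | inj₂ (inj₁ e)           = 1 , step e here
  ... | inj₂ (inj₂ (_ , e , d)) = 2 , step e (step d here)
  Walk-++ : ∀ {u v w i j} → Walk G u v i → Walk G v w j → Walk G u w (i + j)
  Walk-++ here       q = q
  Walk-++ (step e p) q = step e (Walk-++ p q)
  Walk-reverse : ∀ {u v k} → Walk G u v k → Walk G v u k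
  Walk-reverse here       = here
  Walk-reverse (step e p) = snoc G (Walk-reverse p) (Adj-sym G e)

-- Stars

StarAt : ∀ {n} → Graph n → Fin n → Set
StarAt G c = ∀ v → v ≢ c → Adj G c v

StarAt⇒near : ∀ {n} (G : Graph n) {c} → StarAt G c → ∀ v → Near G c v
StarAt⇒near G {c} star-c v with v ≟ c
... | yes refl = inj₁ refl
... | no  v≢c  = inj₂ (inj₁ (star-c v v≢c))

module _ {s : ℕ} (G : Graph (suc s)) (t : IsTree G) (c : Fin (suc s)) (star-c : StarAt G c) where

  private
    near = StarAt⇒near G star-c
    open Centred G t c near
    open Eccentricity G t c near

    no-Outer : ∀ {x} → ¬ Outer G c x
    no-Outer (x≢c , ¬cx) = ¬cx (star-c _ x≢c)

    deg-rim : ∀ {b} → Adj G c b → deg G b ≡ 1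
    deg-rim {b} cb = trans (∑-single (allFin⁺ (suc s)) (∈-allFin c) λ {y} _ y≢c →
        cong ⟦_⟧ (¬true⇒false λ by → no-Outer (rim-child-Outer cb by y≢c)))
      (cong ⟦_⟧ (Adj-sym G cb))

    ones : ∀ {ds} → All (_≡ 1) ds → product ds ≡ 1 × pairSum ds ≡ 0 × sum ds ≡ length ds
    ones []         = refl , refl , refl
    ones (refl ∷ a) with p , q , r ← ones a = trans (+-identityʳ _) p , q , cong suc r

    rim-ones : ∀ {xs} → (∀ {b} → b ∈ xs → deg G b ≡ 1) → All (_≡ 1) (map (deg G) xs)
    rim-ones {[]}     h = []
    rim-ones {x ∷ xs} h = h (here refl) ∷ rim-ones (h ∘ there)

    star-M-sum : ∑ (allFin (suc s)) (λ u → layer 12 6 6 u * M G u) ≡ starValue s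
    star-M-sum with p , q , r ← ones (rim-ones {rim G c} λ b∈ → deg-rim (rim-Adj b∈)) = trans (layer-M-sum 12 6 6)
      (trans (cong₂ _+_ (cong₂ _+_ (cong (12 *_) p) (cong (λ k → 6 * (k * k)) (trans (≡-sym r) (suc-injective sum-rimDegrees))))
        (cong (6 *_) q)) (+-identityʳ _))

  -- For s = 1 the leaf also has eccentricity 1, so 12 ξ is 24 while `starValue 1` is 18; a third
  -- vertex prevents this. The star as competitor enters through this bound, the star as maximiser
  -- through `star-lower`.
  star-upper : 2 ≤ s → xi G ≤ℚ over12 (starValue s)
  star-upper 2≤s = subst (λ m → xi G ≤ℚ over12 m) star-M-sum (xi-upper G (layer 12 6 6)
    (layer-ind (λ u f → 12 ≤ f * suc (ecc G u ∸ 1)) (m≤m*n 12 (suc (ecc G c ∸ 1)))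
      (λ {b} cb → at-rim (ecc G b) (rim-ecc cb)) (λ o → ⊥-elim (no-Outer o))))
    where
    at-rim : ∀ e → 2 ≤ e → 12 ≤ 6 * suc (e ∸ 1)
    at-rim (suc e) (s≤s 1≤e) = *-monoʳ-≤ 6 (s≤s 1≤e)
    third : ∀ {n} → 3 ≤ n → (u v : Fin n) → ∃ λ w → w ≢ u × w ≢ v
    third (s≤s (s≤s (s≤s _))) zero          zero          = suc zero , (λ ()) , λ ()
    third (s≤s (s≤s (s≤s _))) zero          (suc zero)    = suc (suc zero) , (λ ()) , λ ()
    third (s≤s (s≤s (s≤s _))) zero          (suc (suc _)) = suc zero , (λ ()) , λ ()
    third (s≤s (s≤s (s≤s _))) (suc zero)    zero          = suc (suc zero) , (λ ()) , λ ()
    third (s≤s (s≤s (s≤s _))) (suc (suc _)) zero          = suc zero , (λ ()) , λ ()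
    third (s≤s (s≤s (s≤s _))) (suc _)       (suc _)       = zero , (λ ()) , λ ()
    rim-ecc : ∀ {b} → Adj G c b → 2 ≤ ecc G b
    rim-ecc {b} cb with b′ , b′≢c , b′≢b ← third (s≤s 2≤s) c b = ecc-≥ G b′ (≤-trans 2≤s (n≤1+n s)) none
      where
      none : ∀ {i} → i < 2 → ¬ Walk G b b′ i
      none _ here           = b′≢b refl
      none _ (step e here)  = no-triangle cb (star-c b′ b′≢c) e
      none (s≤s (s≤s ())) (step _ (step _ _))

  star-lower : over12 (starValue s) ≤ℚ xi G
  star-lower = subst (λ m → over12 m ≤ℚ xi G) star-M-sum (xi-lower G (layer 12 6 6)
    (layer-ind (λ u f → f * suc (ecc G u ∸ 1) ≤ 12) (*-monoʳ-≤ 12 (s≤s (∸-monoˡ-≤ 1 (ecc-≤ G to))))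
      (λ {b} cb → *-monoʳ-≤ 6 (s≤s (∸-monoˡ-≤ 1 (ecc-≤ G (extend-walks (Adj-sym G cb) to))))) (λ o → ⊥-elim (no-Outer o))))
    where
    to : ∀ v → ∃ λ k → k ≤ 1 × Walk G c v k
    to v with v ≟ c
    ... | yes refl = 0 , z≤n , here
    ... | no  v≢c  = 1 , ≤-refl , step (star-c v v≢c) here

module _ (s : ℕ) where

  private
    H = star (suc s)

  star-StarAt : StarAt H zero
  star-StarAt zero    v≢ = contradiction refl v≢
  star-StarAt (suc v) _  = refl

  star-IsTree : IsTree H
  star-IsTree = near⇒connected H zero (StarAt⇒near H star-StarAt) , parent⇒acyclic H (λ _ → zero) height up-down
    where
    height : Fin (suc s) → ℕ
    height zero    = 0
    height (suc _) = 1
    up-down : ∀ {u v} → Adj H u v → (zero ≡ v × height v < height u) ⊎ (zero ≡ u × height u < height v)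
    up-down {zero}  {suc v} _ = inj₂ (refl , s≤s z≤n)
    up-down {suc u} {zero}  _ = inj₁ (refl , s≤s z≤n)

-- The isomorphism is the transposition of c and `zero`, its own inverse. Acyclicity enters through
-- `no-triangle`: two rim vertices are not adjacent.
StarAt⇒≅star : ∀ {s} (G : Graph (suc s)) → IsTree G → ∀ {c} → StarAt G c → G ≅ star (suc s)
StarAt⇒≅star {s} G t {c} star-c = mk↔ₛ′ τ τ τ-inv τ-inv , preserves
  where
  open Centred G t c (StarAt⇒near G star-c)
  τ : Fin (suc s) → Fin (suc s)
  τ v with v ≟ c
  ... | yes _ = zero
  ... | no  _ with v ≟ zero
  ...   | yes _ = c
  ...   | no  _ = v
  τ-c : τ c ≡ zero
  τ-c with c ≟ c
  ... | yes _ = refl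
  ... | no ne = contradiction refl ne
  τ-0 : τ zero ≡ c
  τ-0 with zero ≟ c
  ... | yes refl = refl
  ... | no  _ = refl
  τ-other : ∀ {v} → v ≢ c → v ≢ zero → τ v ≡ v
  τ-other {v} v≢c v≢0 with v ≟ c
  ... | yes e = contradiction e v≢c
  ... | no  _ with v ≟ zero
  ...   | yes e = contradiction e v≢0
  ...   | no  _ = refl
  τ-inv : ∀ v → τ (τ v) ≡ v
  τ-inv v with v ≟ c
  ... | yes refl = τ-0
  ... | no v≢c with v ≟ zero
  ...   | yes refl = τ-c
  ...   | no v≢0 = τ-other v≢c v≢0
  zero? : ∀ v → isZero (τ v) ≡ does (v ≟ c)
  zero? v with v ≟ c
  ... | yes _ = refl
  ... | no v≢c with v ≟ zero
  ...   | yes refl = nz {c} (λ { refl → v≢c refl })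
    where
    nz : ∀ {v : Fin (suc s)} → v ≢ zero → isZero v ≡ false
    nz {zero}  ne = contradiction refl ne
    nz {suc _} _  = refl
  zero? zero    | no _ | no v≢0 = contradiction refl v≢0
  zero? (suc v) | no _ | no v≢0 = refl
  preserves : ∀ i j → adj (star (suc s)) (τ i) (τ j) ≡ adj G i j
  preserves i j rewrite zero? i | zero? j with i ≟ c | j ≟ c
  ... | yes refl | yes refl = ≡-sym (irrefl G c)
  ... | yes refl | no  j≢c  = ≡-sym (star-c j j≢c)
  ... | no  i≢c  | yes refl = ≡-sym (Adj-sym G (star-c i i≢c))
  ... | no  i≢c  | no  j≢c  = ≡-sym (¬true⇒false (no-triangle (star-c i i≢c) (star-c j j≢c)))

-- Isomorphism invariance

module _ {n : ℕ} {G H : Graph n} (iso : G ≅ H) where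

  private
    f = proj₁ iso
    to = Inverse.to f
    from = Inverse.from f
    preserves = proj₂ iso

    to-from : ∀ v → to (from v) ≡ v
    to-from = Inverse.strictlyInverseˡ f
    from-to : ∀ v → from (to v) ≡ v
    from-to = Inverse.strictlyInverseʳ f

    to-injective : ∀ {u v} → to u ≡ to v → u ≡ v
    to-injective {u} {v} e = trans (≡-sym (from-to u)) (trans (cong from e) (from-to v))

    walk-to : ∀ {u v k} → Walk G u v k → Walk H (to u) (to v) k
    walk-to here       = here
    walk-to (step e p) = step (trans (preserves _ _) e) (walk-to p)

    walk-from : ∀ {u v k} → Walk H u v k → Walk G (from u) (from v) k
    walk-from here                        = here
    walk-from (step {u} {w} e p) = step (trans (≡-sym (preserves (from u) (from w)))
      (trans (cong₂ (adj H) (to-from u) (to-from w)) e)) (walk-from p)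

    reach-iso : ∀ k u v → reach H k (to u) (to v) ≡ reach G k u v
    reach-iso k u v = bool-ext
      (λ r → let j , j≤k , p = reach⇒walk H k r in walk⇒reach G j≤k (subst₂ (λ u v → Walk G u v j) (from-to u) (from-to v) (walk-from p)))
      (λ r → let j , j≤k , p = reach⇒walk G k r in walk⇒reach H j≤k (walk-to p))

    -- The two searches take the same branch at every index, since walks are carried over in both
    -- directions and so the results of `reach` agree.
    search-iso : ∀ u v f i → search H (to u) (to v) i f ≡ search G u v i f
    search-iso u v zero    i = refl
    search-iso u v (suc f) i = cong₂ (λ r x → if r then i else x) (reach-iso i u v) (search-iso u v f (suc i))

    dist-iso : ∀ u v → dist H (to u) (to v) ≡ dist G u v
    dist-iso u v = search-iso u v n 0

    ecc-iso : ∀ u → ecc H (to u) ≡ ecc G u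
    ecc-iso u = ≤-antisym
      (ecc-lub H λ v → subst (_≤ ecc G u) (trans (≡-sym (dist-iso u (from v))) (cong (dist H (to u)) (to-from v))) (dist≤ecc G u (from v)))
      (ecc-lub G λ v → subst (_≤ ecc H (to u)) (dist-iso u v) (dist≤ecc H (to u) (to v)))

    permuted : map to (allFin n) ↭ allFin n
    permuted = Unique-↭ (Unique-map⁺ to-injective (allFin⁺ n)) (allFin⁺ n) (λ _ → ∈-allFin _)
      (λ {v} _ → subst (_∈ map to (allFin n)) (to-from v) (∈-map⁺ to (∈-allFin (from v))))

    deg-iso : ∀ u → deg H (to u) ≡ deg G u
    deg-iso u = trans (≡-sym (∑-↭ (λ v → ⟦ adj H (to u) v ⟧) permuted)) (trans (cong sum (≡-sym (map-∘ (allFin n))))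
      (∑-cong (allFin n) λ {v} _ → cong ⟦_⟧ (preserves u v)))

    M-iso : ∀ u → M H (to u) ≡ M G u
    M-iso u = trans (≡-sym (∏-↭ (λ v → if adj H (to u) v then deg H v else 1) permuted)) (trans (cong product (≡-sym (map-∘ (allFin n))))
      (∏-cong (allFin n) λ {v} _ → cong₂ (λ e d → if e then d else 1) (preserves u v) (deg-iso v)))

    foldr-+-↭ : ∀ {xs ys} → xs ↭ ys → foldr _+ℚ_ 0ℚ xs ≡ foldr _+ℚ_ 0ℚ ys
    foldr-+-↭ _↭_.refl = refl
    foldr-+-↭ (prep x p) = cong (x +ℚ_) (foldr-+-↭ p)
    foldr-+-↭ (swap x y p) = trans (cong (λ z → x +ℚ (y +ℚ z)) (foldr-+-↭ p))
      (trans (≡-sym (ℚ.+-assoc x y _)) (trans (cong (_+ℚ _) (ℚ.+-comm x y)) (ℚ.+-assoc y x _)))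
    foldr-+-↭ (_↭_.trans p q) = trans (foldr-+-↭ p) (foldr-+-↭ q)

  xi-iso : xi G ≡ xi H
  xi-iso = trans (cong (foldr _+ℚ_ 0ℚ) (trans (map-cong (λ u → cong₂ (λ m e → (ℤ.+ m) /ℚ suc (e ∸ 1)) (≡-sym (M-iso u)) (≡-sym (ecc-iso u))) (allFin n))
      (map-∘ (allFin n)))) (foldr-+-↭ (map⁺ _ permuted))

-- The tree of radius 2 whose i-th neighbour of the centre carries the i-th entry of es many leaves

data Slot : List ℕ → Set where
  base  : ∀ {e es} → Slot (e ∷ es)
  leaf  : ∀ {e es} → Fin e → Slot (e ∷ es)
  later : ∀ {e es} → Slot es → Slot (e ∷ es)

slots : List ℕ → ℕ
slots es = sum (map suc es)

private
  fromSum : ∀ {e es} → Fin (suc e) ⊎ Slot es → Slot (e ∷ es)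
  fromSum (inj₁ zero)    = base
  fromSum (inj₁ (suc j)) = leaf j
  fromSum (inj₂ a)       = later a

-- Adjacency is structural on `Slot`, where branches are told apart by constructors; this bijection
-- carries it to `Fin`, as `Graph` demands.
slot : ∀ es → Fin (slots es) → Slot es
slot (e ∷ es) i = fromSum (map₂ (slot es) (splitAt (suc e) i))

index : ∀ es → Slot es → Fin (slots es)
index (e ∷ es) base      = zero ↑ˡ slots es
index (e ∷ es) (leaf j)  = suc j ↑ˡ slots es
index (e ∷ es) (later a) = suc e ↑ʳ index es a

slot-↑ˡ : ∀ e es i → slot (e ∷ es) (i ↑ˡ slots es) ≡ fromSum (inj₁ i)
slot-↑ˡ e es i = cong (fromSum ∘ map₂ (slot es)) (splitAt-↑ˡ (suc e) i (slots es))

slot-↑ʳ : ∀ e es i → slot (e ∷ es) (suc e ↑ʳ i) ≡ later (slot es i)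
slot-↑ʳ e es i = cong (fromSum ∘ map₂ (slot es)) (splitAt-↑ʳ (suc e) (slots es) i)

slot-index : ∀ es a → slot es (index es a) ≡ a
slot-index (e ∷ es) base      = slot-↑ˡ e es zero
slot-index (e ∷ es) (leaf j)  = slot-↑ˡ e es (suc j)
slot-index (e ∷ es) (later a) = trans (slot-↑ʳ e es (index es a)) (cong later (slot-index es a))

index-slot : ∀ es i → index es (slot es i) ≡ i
index-slot (e ∷ es) i with splitAt (suc e) i in eq
... | inj₁ zero    = splitAt⁻¹-↑ˡ eq
... | inj₁ (suc j) = splitAt⁻¹-↑ˡ {i = i} eq
... | inj₂ i′      = trans (cong (suc e ↑ʳ_) (index-slot es i′)) (splitAt⁻¹-↑ʳ {i = i} eq)

isBase : ∀ {es} → Slot es → Bool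
isBase base      = true
isBase (leaf _)  = false
isBase (later a) = isBase a

baseOf : ∀ {es} → Slot es → Slot es
baseOf base      = base
baseOf (leaf _)  = base
baseOf (later a) = later (baseOf a)

-- Directed from a base to its leaves, so that it also determines the parent function; `radialAdj`
-- makes it symmetric.
link : ∀ {es} → Slot es → Slot es → Bool
link base      (leaf _)  = true
link (later a) (later b) = link a b
link _         _         = false

link-base : ∀ {es} (a b : Slot es) → link a b ≡ true → isBase a ≡ true × isBase b ≡ false × baseOf b ≡ a
link-base base      (leaf _)  _ = refl , refl , refl
link-base (later a) (later b) e with p , q , r ← link-base a b e = p , q , cong later r

link-baseOf : ∀ {es} (b : Slot es) → isBase b ≡ false → link (baseOf b) b ≡ true × isBase (baseOf b) ≡ true
link-baseOf (leaf _)  _ = refl , refl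
link-baseOf (later b) e = link-baseOf b e

radialAdj : ∀ es → Fin (suc (slots es)) → Fin (suc (slots es)) → Bool
radialAdj es zero    zero    = false
radialAdj es zero    (suc j) = isBase (slot es j)
radialAdj es (suc i) zero    = isBase (slot es i)
radialAdj es (suc i) (suc j) = link (slot es i) (slot es j) ∨ link (slot es j) (slot es i)

radial : ∀ es → Graph (suc (slots es))
radial es = record { adj = radialAdj es ; sym = symm ; irrefl = irr }
  where
  symm : ∀ i j → radialAdj es i j ≡ radialAdj es j i
  symm zero    zero    = refl
  symm zero    (suc j) = refl
  symm (suc i) zero    = refl
  symm (suc i) (suc j) = ∨-comm (link (slot es i) (slot es j)) _
  no-loop : ∀ {es} (a : Slot es) → link a a ≡ false
  no-loop base      = refl
  no-loop (leaf _)  = refl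
  no-loop (later a) = no-loop a
  irr : ∀ i → radialAdj es i i ≡ false
  irr zero    = refl
  irr (suc i) = cong₂ _∨_ (no-loop (slot es i)) (no-loop (slot es i))

module _ (es : List ℕ) where

  private
    H = radial es

    vertex : Slot es → Fin (suc (slots es))
    vertex a = suc (index es a)

  radial-near : ∀ v → Near H zero v
  radial-near zero = inj₁ refl
  radial-near (suc i) with isBase (slot es i) in e
  ... | true  = inj₂ (inj₁ refl)
  ... | false with l , b ← link-baseOf (slot es i) e = inj₂ (inj₂ (vertex (baseOf (slot es i)) ,
      trans (cong isBase (slot-index es _)) b ,
      cong (_∨ link (slot es i) (slot es (index es (baseOf (slot es i))))) (trans (cong (λ a → link a (slot es i)) (slot-index es _)) l)))

  radial-IsTree : IsTree H
  radial-IsTree = near⇒connected H zero radial-near , parent⇒acyclic H par height up-down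
    where
    par : Fin (suc (slots es)) → Fin (suc (slots es))
    par zero    = zero
    par (suc i) = if isBase (slot es i) then zero else vertex (baseOf (slot es i))
    height : Fin (suc (slots es)) → ℕ
    height zero    = 0
    height (suc i) = if isBase (slot es i) then 1 else 2
    child : ∀ i j → link (slot es i) (slot es j) ≡ true → par (suc j) ≡ suc i × height (suc i) < height (suc j)
    child i j l with p , q , r ← link-base (slot es i) (slot es j) l rewrite p | q | r =
      cong suc (index-slot es i) , ≤-refl
    up-down : ∀ {u v} → Adj H u v → (par u ≡ v × height v < height u) ⊎ (par v ≡ u × height u < height v)
    up-down {zero}  {suc j} e rewrite e = inj₂ (refl , ≤-refl)
    up-down {suc i} {zero}  e rewrite e = inj₁ (refl , ≤-refl)
    up-down {suc i} {suc j} e with ∨-split (link (slot es i) (slot es j)) e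
    ... | inj₁ l = inj₂ (child i j l)
    ... | inj₂ l = inj₁ (child j i l)

private
  bases : ∀ es → List (Slot es)
  bases []       = []
  bases (e ∷ es) = base ∷ map later (bases es)

  ∈-bases : ∀ {es} (a : Slot es) → isBase a ≡ true → a ∈ bases es
  ∈-bases base      _ = here refl
  ∈-bases (later a) e = there (∈-map⁺ later (∈-bases a e))

  bases-isBase : ∀ es {a} → a ∈ bases es → isBase a ≡ true
  bases-isBase (e ∷ es) (here refl) = refl
  bases-isBase (e ∷ es) (there a∈) with b , b∈ , refl ← ∈-map⁻ later a∈ = bases-isBase es b∈

  Unique-bases : ∀ es → Unique (bases es)
  Unique-bases []       = []
  Unique-bases (e ∷ es) = All.tabulate (λ a∈ eq → case ∈-map⁻ later a∈ of λ { (_ , _ , refl) → contradiction eq λ () })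
    ∷ Unique-map⁺ (λ { refl → refl }) (Unique-bases es)

  ∑-allFin-suc : ∀ m (f : Fin (suc m) → ℕ) → ∑ (allFin (suc m)) f ≡ f zero + ∑ (allFin m) (f ∘ suc)
  ∑-allFin-suc m f = cong (f zero +_) (cong sum
    (trans (map-tabulate suc f) (≡-sym (map-tabulate (λ i → i) (f ∘ suc)))))

  ∑-allFin-+ : ∀ k m (f : Fin (k + m) → ℕ) →
               ∑ (allFin (k + m)) f ≡ ∑ (allFin k) (λ i → f (i ↑ˡ m)) + ∑ (allFin m) (λ i → f (k ↑ʳ i))
  ∑-allFin-+ zero    m f = refl
  ∑-allFin-+ (suc k) m f = trans (∑-allFin-suc (k + m) f) (trans (cong (f zero +_) (∑-allFin-+ k m (f ∘ suc)))
    (trans (≡-sym (+-assoc (f zero) _ _)) (cong (_+ ∑ (allFin m) (λ i → f (suc k ↑ʳ i))) (≡-sym (∑-allFin-suc k (λ i → f (i ↑ˡ m)))))))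

  leavesAt : ∀ es → Slot es → ℕ
  leavesAt es a = ∑ (allFin (slots es)) λ i → ⟦ link a (slot es i) ⟧

  leavesAt-base : ∀ e es → leavesAt (e ∷ es) base ≡ e
  leavesAt-base e es = begin
    leavesAt (e ∷ es) base
      ≡⟨ ∑-allFin-+ (suc e) (slots es) (λ i → ⟦ link base (slot (e ∷ es) i) ⟧) ⟩
    ∑ (allFin (suc e)) (λ i → ⟦ link base (slot (e ∷ es) (i ↑ˡ slots es)) ⟧) + ∑ (allFin (slots es)) (λ i → ⟦ link base (slot (e ∷ es) (suc e ↑ʳ i)) ⟧)
      ≡⟨ cong₂ _+_ (∑-cong (allFin (suc e)) λ {i} _ → cong (⟦_⟧ ∘ link base) (slot-↑ˡ e es i))
                   (∑-zero (allFin (slots es)) λ {i} _ → cong (⟦_⟧ ∘ link base) (slot-↑ʳ e es i)) ⟩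
    ∑ (allFin (suc e)) (λ i → ⟦ link {e ∷ es} base (fromSum (inj₁ i)) ⟧) + 0
      ≡⟨ +-identityʳ _ ⟩
    ∑ (allFin (suc e)) (λ i → ⟦ link {e ∷ es} base (fromSum (inj₁ i)) ⟧)
      ≡⟨ ∑-allFin-suc e (λ i → ⟦ link {e ∷ es} base (fromSum (inj₁ i)) ⟧) ⟩
    ∑ (allFin e) (λ _ → 1)
      ≡⟨ ∑-ones (allFin e) ⟩
    length (allFin e)
      ≡⟨ length-tabulate (λ i → i) ⟩
    e ∎
    where
    open ≡-Reasoning

  leavesAt-later : ∀ e es a → leavesAt (e ∷ es) (later a) ≡ leavesAt es a
  leavesAt-later e es a = trans (∑-allFin-+ (suc e) (slots es) (λ i → ⟦ link (later a) (slot (e ∷ es) i) ⟧))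
    (cong₂ _+_ (∑-zero (allFin (suc e)) λ {i} _ → trans (cong (⟦_⟧ ∘ link (later a)) (slot-↑ˡ e es i)) (none i))
               (∑-cong (allFin (slots es)) λ {i} _ → cong (⟦_⟧ ∘ link (later a)) (slot-↑ʳ e es i)))
    where
    none : ∀ i → ⟦ link (later a) (fromSum {e} {es} (inj₁ i)) ⟧ ≡ 0
    none zero    = refl
    none (suc i) = refl

  leavesAt-bases : ∀ es → map (leavesAt es) (bases es) ≡ es
  leavesAt-bases []       = refl
  leavesAt-bases (e ∷ es) = cong₂ _∷_ (leavesAt-base e es)
    (trans (≡-sym (map-∘ (bases es))) (trans (map-cong (leavesAt-later e es) (bases es)) (leavesAt-bases es)))

-- The rim, a filter over `Fin`, and `bases`, a recursion on `es`, are duplicate-free lists of the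
-- same vertices. The centre adds 1 to the number of leaves.
rimDegrees-radial : ∀ es → rimDegrees (radial es) zero ↭ map suc es
rimDegrees-radial es = subst (rimDegrees H zero ↭_) degrees (map⁺ (deg H) rim↭)
  where
  H = radial es
  vertex : Slot es → Fin (suc (slots es))
  vertex a = suc (index es a)
  vertex-inj : ∀ {a b} → vertex a ≡ vertex b → a ≡ b
  vertex-inj {a} {b} eq = trans (≡-sym (slot-index es a)) (trans (cong (slot es) (Fin-suc-injective eq)) (slot-index es b))
  open Centred H (radial-IsTree es) zero (radial-near es)
  rim↭ : rim H zero ↭ map vertex (bases es)
  rim↭ = Unique-↭ Unique-rim (Unique-map⁺ vertex-inj (Unique-bases es)) into out
    where
    into : ∀ {v} → v ∈ rim H zero → v ∈ map vertex (bases es)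
    into {zero}  v∈ = contradiction (rim-Adj v∈) λ ()
    into {suc i} v∈ = subst (λ j → suc j ∈ map vertex (bases es)) (index-slot es i) (∈-map⁺ vertex (∈-bases (slot es i) (rim-Adj v∈)))
    out : ∀ {v} → v ∈ map vertex (bases es) → v ∈ rim H zero
    out v∈ with a , a∈ , refl ← ∈-map⁻ vertex v∈ = ∈-rim (trans (cong isBase (slot-index es a)) (bases-isBase es a∈))
  deg-base : ∀ {a} → a ∈ bases es → deg H (vertex a) ≡ suc (leavesAt es a)
  deg-base {a} a∈ = trans (∑-allFin-suc (slots es) _) (cong₂ _+_
    (cong ⟦_⟧ (trans (cong isBase (slot-index es a)) (bases-isBase es a∈)))
    (∑-cong (allFin (slots es)) λ {i} _ → cong ⟦_⟧ (trans
      (cong (λ a → link a (slot es i) ∨ link (slot es i) a) (slot-index es a))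
      (trans (cong (link a (slot es i) ∨_) (¬true⇒false λ l → true≢false (bases-isBase es a∈) (proj₁ (proj₂ (link-base (slot es i) a l)))))
        (∨-identityʳ _)))))
  degrees : map (deg H) (map vertex (bases es)) ≡ map suc es
  degrees = begin
    map (deg H) (map vertex (bases es))            ≡⟨ ≡-sym (map-∘ (bases es)) ⟩
    map (deg H ∘ vertex) (bases es)                ≡⟨ map-cong-∈ (bases es) deg-base ⟩
    map (suc ∘ leavesAt es) (bases es)             ≡⟨ map-∘ (bases es) ⟩
    map suc (map (leavesAt es) (bases es))         ≡⟨ cong (map suc) (leavesAt-bases es) ⟩
    map suc es                                     ∎
    where
    open ≡-Reasoning
    map-cong-∈ : ∀ {A B : Set} {f g : A → B} xs → (∀ {x} → x ∈ xs → f x ≡ g x) → map f xs ≡ map g xs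
    map-cong-∈ []       h = refl
    map-cong-∈ (x ∷ xs) h = cong₂ _∷_ (h (here refl)) (map-cong-∈ xs (h ∘ there))

-- A tree of radius at most 2 is determined by its rim degrees

module RadialIso {n : ℕ} (G : Graph n) (t : IsTree G) (c : Fin n) (near : ∀ v → Near G c v) where

  open Centred G t c near

  private
    isChild : Fin n → Fin n → Bool
    isChild b v = adj G b v ∧ not (does (v ≟ c))

  children : Fin n → List (Fin n)
  children b = filterᵇ (isChild b) (allFin n)

  private
    child-split : ∀ b v → isChild b v ≡ true → Adj G b v × v ≢ c
    child-split b v e with bv , e′ ← ∧-split (adj G b v) e with v ≟ c | e′
    ... | no v≢c | _ = bv , v≢c

    child-join : ∀ {b v} → Adj G b v → v ≢ c → isChild b v ≡ true
    child-join {b} {v} bv v≢c with v ≟ c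
    ... | yes e = contradiction e v≢c
    ... | no  _ rewrite bv = refl

    child-Outer : ∀ {b v} → Adj G c b → v ∈ children b → Adj G b v × Outer G c v
    child-Outer {b} {v} cb v∈ with bv , v≢c ← child-split b v (proj₂ (∈-filterᵇ⁻ (isChild b) (allFin n) v∈)) =
      bv , rim-child-Outer cb bv v≢c

  deg-children : ∀ {b} → Adj G c b → deg G b ≡ suc (length (children b))
  deg-children {b} cb = begin
    deg G b                                                  ≡⟨ ∑-cong (allFin n) (λ {v} _ → split v) ⟩
    ∑ (allFin n) (λ v → at-c v + ⟦ isChild b v ⟧)            ≡⟨ ∑-+ (allFin n) at-c (λ v → ⟦ isChild b v ⟧) ⟩
    ∑ (allFin n) at-c + ∑ (allFin n) (λ v → ⟦ isChild b v ⟧) ≡⟨ cong₂ _+_ (trans (∑-single (allFin⁺ n) (∈-allFin c) λ {v} _ v≢c → cong ⟦_⟧ (dec-false (v ≟ c) v≢c)) (cong ⟦_⟧ (dec-true (c ≟ c) refl)))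
                                                                  (≡-sym (length-filterᵇ (isChild b) (allFin n))) ⟩
    1 + length (children b)                                  ∎
    where
    open ≡-Reasoning
    at-c : Fin n → ℕ
    at-c v = ⟦ does (v ≟ c) ⟧
    split : ∀ v → ⟦ adj G b v ⟧ ≡ at-c v + ⟦ isChild b v ⟧
    split v with v ≟ c
    ... | yes refl rewrite Adj-sym G cb = refl
    ... | no  _ = cong ⟦_⟧ (≡-sym (∧-identityʳ (adj G b v)))

  shape : List (Fin n) → List ℕ
  shape = map (length ∘ children)

  place : ∀ bs → Slot (shape bs) → Fin n
  place (b ∷ bs) base      = b
  place (b ∷ bs) (leaf j)  = lookup (children b) j
  place (b ∷ bs) (later a) = place bs a

  private
    home : ∀ bs → Slot (shape bs) → Fin n
    home (b ∷ bs) base      = b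
    home (b ∷ bs) (leaf j)  = b
    home (b ∷ bs) (later a) = home bs a

    home∈ : ∀ bs a → home bs a ∈ bs
    home∈ (b ∷ bs) base      = here refl
    home∈ (b ∷ bs) (leaf j)  = here refl
    home∈ (b ∷ bs) (later a) = there (home∈ bs a)

    place-base : ∀ bs a → isBase a ≡ true → place bs a ≡ home bs a
    place-base (b ∷ bs) base      _ = refl
    place-base (b ∷ bs) (later a) e = place-base bs a e

    place-leaf : ∀ bs a → isBase a ≡ false → place bs a ∈ children (home bs a)
    place-leaf (b ∷ bs) (leaf j)  _ = ∈-lookup j
    place-leaf (b ∷ bs) (later a) e = place-leaf bs a e

    module _ {bs} (rims : ∀ {b} → b ∈ bs → Adj G c b) where

      place-rim : ∀ a → isBase a ≡ true → Adj G c (place bs a)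
      place-rim a e = subst (Adj G c) (≡-sym (place-base bs a e)) (rims (home∈ bs a))

      place-Outer : ∀ a → isBase a ≡ false → Adj G (home bs a) (place bs a) × Outer G c (place bs a)
      place-Outer a e = child-Outer (rims (home∈ bs a)) (place-leaf bs a e)

      -- The branch can be recovered from each of its vertices: a rim vertex is its own hub, and an
      -- outer vertex has only one neighbour. This separates the branches in `place-inj`.
      same-home : ∀ {b} → Adj G c b → ∀ {v} → v ≡ b ⊎ v ∈ children b → ∀ a → place bs a ≡ v → home bs a ≡ b
      same-home cb (inj₁ refl) a refl with isBase a in e
      ... | true  = ≡-sym (place-base bs a e)
      ... | false = contradiction cb (proj₂ (proj₂ (place-Outer a e)))
      same-home cb (inj₂ v∈) a refl with isBase a in e
      ... | true  = contradiction (place-rim a e) (proj₂ (proj₂ (child-Outer cb v∈)))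
      ... | false with av , o ← place-Outer a e =
            Outer-unique-neighbour o cb (Adj-sym G (proj₁ (child-Outer cb v∈))) (Adj-sym G av)

    place-inj : ∀ bs → (∀ {b} → b ∈ bs → Adj G c b) → Unique bs → ∀ a a′ → place bs a ≡ place bs a′ → a ≡ a′
    place-inj (b ∷ bs) rims (b∉ ∷ u) base base e = refl
    place-inj (b ∷ bs) rims (b∉ ∷ u) base (leaf j) e =
      contradiction (subst (Adj G b) (≡-sym e) (proj₁ (child-Outer {b} (rims (here refl)) (∈-lookup j)))) (λ d → Adj-≢ G d refl)
    place-inj (b ∷ bs) rims (b∉ ∷ u) (leaf j) base e =
      contradiction (subst (Adj G b) e (proj₁ (child-Outer {b} (rims (here refl)) (∈-lookup j)))) (λ d → Adj-≢ G d refl)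
    place-inj (b ∷ bs) rims (b∉ ∷ u) (leaf j) (leaf j′) e =
      cong leaf (Unique⇒lookup-injective (Unique-filterᵇ (isChild b) (allFin⁺ n)) e)
    place-inj (b ∷ bs) rims (b∉ ∷ u) (later a) (later a′) e = cong later (place-inj bs (rims ∘ there) u a a′ e)
    place-inj (b ∷ bs) rims (b∉ ∷ u) base (later a) e =
      contradiction (≡-sym (same-home (rims ∘ there) (rims (here refl)) (inj₁ refl) a (≡-sym e))) (All.lookup b∉ (home∈ bs a))
    place-inj (b ∷ bs) rims (b∉ ∷ u) (later a) base e =
      contradiction (≡-sym (same-home (rims ∘ there) (rims (here refl)) (inj₁ refl) a e)) (All.lookup b∉ (home∈ bs a))
    place-inj (b ∷ bs) rims (b∉ ∷ u) (leaf j) (later a) e =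
      contradiction (≡-sym (same-home (rims ∘ there) (rims (here refl)) (inj₂ (∈-lookup j)) a (≡-sym e))) (All.lookup b∉ (home∈ bs a))
    place-inj (b ∷ bs) rims (b∉ ∷ u) (later a) (leaf j) e =
      contradiction (≡-sym (same-home (rims ∘ there) (rims (here refl)) (inj₂ (∈-lookup j)) a e)) (All.lookup b∉ (home∈ bs a))

    find-base : ∀ bs {b} → b ∈ bs → ∃ λ a → place bs a ≡ b
    find-base (b ∷ bs) (here refl) = base , refl
    find-base (b ∷ bs) (there b∈) with a , e ← find-base bs b∈ = later a , e

    find-leaf : ∀ bs {b v} → b ∈ bs → v ∈ children b → ∃ λ a → place bs a ≡ v
    find-leaf (b ∷ bs) (here refl) v∈ = leaf (Any.index v∈) , ≡-sym (lookup-index v∈)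
    find-leaf (b ∷ bs) (there b∈) v∈ with a , e ← find-leaf bs b∈ v∈ = later a , e

    link-place : ∀ bs → (∀ {b} → b ∈ bs → Adj G c b) → ∀ a a′ → link a a′ ≡ true → Adj G (place bs a) (place bs a′)
    link-place (b ∷ bs) rims base (leaf j) _ = proj₁ (child-Outer (rims (here refl)) (∈-lookup j))
    link-place (b ∷ bs) rims (later a) (later a′) e = link-place bs (rims ∘ there) a a′ e

    home-link : ∀ bs → Unique bs → ∀ a a′ → isBase a ≡ true → isBase a′ ≡ false → home bs a ≡ home bs a′ → link a a′ ≡ true
    home-link (b ∷ bs) _ base (leaf j) _ _ _ = refl
    home-link (b ∷ bs) (b∉ ∷ _) base (later a′) _ _ e = contradiction e (All.lookup b∉ (home∈ bs a′))
    home-link (b ∷ bs) (b∉ ∷ _) (later a) (leaf j) _ _ e = contradiction (≡-sym e) (All.lookup b∉ (home∈ bs a))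
    home-link (b ∷ bs) (_ ∷ u) (later a) (later a′) p q e = home-link bs u a a′ p q e

  module _ (bs : List (Fin n)) (bs↭ : bs ↭ rim G c) where

    private
      es = shape bs
      H = radial es

      rims : ∀ {b} → b ∈ bs → Adj G c b
      rims b∈ = rim-Adj (∈-resp-↭ bs↭ b∈)

      ∈bs : ∀ {b} → Adj G c b → b ∈ bs
      ∈bs cb = ∈-resp-↭ (↭-sym bs↭) (∈-rim cb)

      Unique-bs : Unique bs
      Unique-bs = ↭ₛ.Unique-resp-↭ (↭⇒↭ₛ (↭-sym bs↭)) Unique-rim
        where
        import Data.List.Relation.Binary.Permutation.Setoid.Properties (setoid (Fin n)) as ↭ₛ

      -- Two rim vertices are not adjacent by `no-triangle`, nor are two outer vertices, whose only
      -- neighbours lie on the rim. In a mixed pair the rim vertex must be the hub of the other.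
      Adj-link : ∀ a a′ → Adj G (place bs a) (place bs a′) → link a a′ ∨ link a′ a ≡ true
      Adj-link a a′ d with isBase a in p | isBase a′ in p′
      ... | true | true = contradiction d (no-triangle (place-rim rims a p) (place-rim rims a′ p′))
      ... | true | false with av , o ← place-Outer rims a′ p′ = cong (_∨ link a′ a) (home-link bs Unique-bs a a′ p p′
              (trans (≡-sym (place-base bs a p)) (Outer-unique-neighbour o (rims (home∈ bs a′)) (Adj-sym G av) (Adj-sym G d))))
      ... | false | true with av , o ← place-Outer rims a p = trans (cong (link a a′ ∨_) (home-link bs Unique-bs a′ a p′ p
              (trans (≡-sym (place-base bs a′ p′)) (Outer-unique-neighbour o (rims (home∈ bs a)) (Adj-sym G av) d)))) (∨-zeroʳ _)
      ... | false | false with av , o ← place-Outer rims a p = ⊥-elim (proj₂ (proj₂ (place-Outer rims a′ p′))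
              (subst (Adj G c) (≡-sym (Outer-unique-neighbour o (rims (home∈ bs a)) (Adj-sym G av) d)) (rims (home∈ bs a))))

      image : Fin (suc (slots es)) → Fin n
      image zero    = c
      image (suc i) = place bs (slot es i)

      image-adj : ∀ i j → adj G (image i) (image j) ≡ adj H i j
      image-adj zero    zero    = irrefl G c
      image-adj zero    (suc j) = at-centre (slot es j)
        where
        at-centre : ∀ a → adj G c (place bs a) ≡ isBase a
        at-centre a with isBase a in e
        ... | true  = place-rim rims a e
        ... | false = ¬true⇒false (proj₂ (proj₂ (place-Outer rims a e)))
      image-adj (suc i) zero    = trans (sym G _ c) (image-adj zero (suc i))
      image-adj (suc i) (suc j) = bool-ext (Adj-link (slot es i) (slot es j)) λ e → case ∨-split (link (slot es i) (slot es j)) e of λ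
        { (inj₁ l) → link-place bs rims (slot es i) (slot es j) l
        ; (inj₂ l) → Adj-sym G (link-place bs rims (slot es j) (slot es i) l) }

      not-centre : ∀ a → c ≢ place bs a
      not-centre a e with isBase a in p
      ... | true  = Adj-≢ G (place-rim rims a p) e
      ... | false = proj₁ (proj₂ (place-Outer rims a p)) (≡-sym e)

      image-inj : ∀ i j → image i ≡ image j → i ≡ j
      image-inj zero    zero    e = refl
      image-inj zero    (suc j) e = contradiction e (not-centre (slot es j))
      image-inj (suc i) zero    e = contradiction (≡-sym e) (not-centre (slot es i))
      image-inj (suc i) (suc j) e = cong suc (trans (≡-sym (index-slot es i))
        (trans (cong (index es) (place-inj bs rims Unique-bs (slot es i) (slot es j) e)) (index-slot es j)))

      preimage : ∀ v → ∃ λ i → image i ≡ v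
      preimage v = cases (near v) (v ≟ c)
        where
        at : ∀ {v} → (∃ λ a → place bs a ≡ v) → ∃ λ i → image i ≡ v
        at (a , e) = suc (index es a) , trans (cong (place bs) (slot-index es a)) e
        cases : Near G c v → Dec (v ≡ c) → ∃ λ i → image i ≡ v
        cases _                             (yes refl) = zero , refl
        cases (inj₁ refl)                   (no _)     = zero , refl
        cases (inj₂ (inj₁ cv))              (no _)     = at (find-base bs (∈bs cv))
        cases (inj₂ (inj₂ (b , cb , bv)))   (no v≢c)   =
          at (find-leaf bs (∈bs cb) (∈-filterᵇ⁺ (isChild b) (∈-allFin v) (child-join bv v≢c)))

    radial-iso : Σ (Fin n ↔ Fin (suc (slots es))) λ f → ∀ i j → adj H (Inverse.to f i) (Inverse.to f j) ≡ adj G i j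
    radial-iso = mk↔ₛ′ (proj₁ ∘ preimage) image
        (λ i → image-inj _ _ (proj₂ (preimage (image i)))) (λ v → proj₂ (preimage v)) ,
      λ i j → trans (≡-sym (image-adj (proj₁ (preimage i)) (proj₁ (preimage j)))) (cong₂ (adj G) (proj₂ (preimage i)) (proj₂ (preimage j)))

-- The permutation of degree lists is lifted to a reordering `bs` of the rim. Along `bs` the numbers
-- of children are literally `es`, so `radial-iso` for `bs` has the desired target.
≅-radial : ∀ es (G : Graph (suc (slots es))) → IsTree G → ∀ c → (∀ v → Near G c v) →
           rimDegrees G c ↭ map suc es → G ≅ radial es
≅-radial es G t c near p with bs , eq , q ← ↭-map-inv (deg G) p = aligned (shape bs) shape≡ (radial-iso bs (↭-sym q))
  where
  open RadialIso G t c near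
  open Centred G t c near
  map-suc-inj : ∀ {xs ys : List ℕ} → map suc xs ≡ map suc ys → xs ≡ ys
  map-suc-inj {[]}     {[]}     _ = refl
  map-suc-inj {x ∷ xs} {y ∷ ys} e = cong₂ _∷_ (suc-injective (∷-injectiveˡ e)) (map-suc-inj (∷-injectiveʳ e))
  degrees : ∀ {xs} → (∀ {b} → b ∈ xs → Adj G c b) → map (deg G) xs ≡ map suc (shape xs)
  degrees {[]}     h = refl
  degrees {x ∷ xs} h = cong₂ _∷_ (deg-children (h (here refl))) (degrees (h ∘ there))
  shape≡ : shape bs ≡ es
  shape≡ = ≡-sym (map-suc-inj (trans eq (degrees λ b∈ → rim-Adj (∈-resp-↭ (↭-sym q) b∈))))
  -- Generalised over `es′`, so that matching on `refl` also replaces the number of vertices in the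
  -- type.
  aligned : ∀ es′ → es′ ≡ es →
    Σ (Fin (suc (slots es)) ↔ Fin (suc (slots es′))) (λ f → ∀ i j → adj (radial es′) (Inverse.to f i) (Inverse.to f j) ≡ adj G i j) → G ≅ radial es
  aligned _ refl iso = iso

-- Comparison of all trees

module _ {n : ℕ} (G : Graph n) where

  record Diameter4 (c : Fin n) : Set where
    field
      near : ∀ v → Near G c v
      {p q} : Fin n
      cp : Adj G c p
      cq : Adj G c q
      p≢q : p ≢ q
      2≤p : 2 ≤ deg G p
      2≤q : 2 ≤ deg G q

  record DoubleStar (c : Fin n) : Set where
    field
      near : ∀ v → Near G c v
      {p q x} : Fin n
      cp : Adj G c p
      cq : Adj G c q
      p≢q : p ≢ q
      qx : Adj G q x
      x≢c : x ≢ c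
      leaves : ∀ {b} → Adj G c b → b ≢ q → deg G b ≡ 1

  Spread : Set
  Spread = ∀ c → ∃ λ v → ¬ Near G c v

starValue≤target : ∀ s → starValue s ≤ target s
starValue≤target s with s ≤? 14
... | yes h = ≤-reflexive (≡-sym (target-small h))
... | no  h = subst (starValue s ≤_) (≡-sym (target-large (≰⇒> h))) (<⇒≤ (starValue<Φ (≰⇒> h)))

module _ {n : ℕ} (G : Graph n) where

  private

    adj? : ∀ u v → Dec (Adj G u v)
    adj? u v = adj G u v ≟ᵇ true

    near? : ∀ c v → Dec (Near G c v)
    near? c v = (c ≟ v) ⊎-dec (adj? c v ⊎-dec any? (λ b → adj? c b ×-dec adj? b v))

    -- The cases are the numbers of rim vertices of degree at least 2: none gives a star at c and
    -- two give diameter 4. A single one, q, gives a double star, unless q is the whole rim; then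
    -- the tree is a star at q.
    centred : ∀ c → (∀ v → Near G c v) → ∃ (StarAt G) ⊎ ∃ (Diameter4 G) ⊎ ∃ (DoubleStar G)
    centred c near with any? (λ q → adj? c q ×-dec (2 ≤? deg G q))
    ... | no none = inj₁ (c , λ v v≢c → direct v v≢c (near v))
      where
      direct : ∀ v → v ≢ c → Near G c v → Adj G c v
      direct v v≢c (inj₁ refl)                   = contradiction refl v≢c
      direct v v≢c (inj₂ (inj₁ cv))              = cv
      direct v v≢c (inj₂ (inj₂ (b , cb , bv)))   =
        contradiction (b , cb , two-neighbours G {u = c} (λ { refl → v≢c refl }) (Adj-sym G cb) bv) none
    ... | yes (q , cq , 2≤q) with any? (λ p → adj? c p ×-dec (¬? (p ≟ q) ×-dec (2 ≤? deg G p)))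
    ...   | yes (p , cp , p≢q , 2≤p) = inj₂ (inj₁ (c , record { near = near ; cp = cp ; cq = cq ; p≢q = p≢q ; 2≤p = 2≤p ; 2≤q = 2≤q }))
    ...   | no others with any? (λ p → adj? c p ×-dec ¬? (p ≟ q))
    ...     | yes (p , cp , p≢q) = let x , qx , x≢c = other-neighbour G {c = c} 2≤q in
      inj₂ (inj₂ (c , record { near = near ; cp = cp ; cq = cq ; p≢q = p≢q ; qx = qx ; x≢c = x≢c ; leaves = leaves }))
      where
      leaves : ∀ {b} → Adj G c b → b ≢ q → deg G b ≡ 1
      leaves {b} cb b≢q = ≤-antisym (≤-pred (≰⇒> λ 2≤b → others (b , cb , b≢q , 2≤b))) (Adj⇒deg≥1 G (Adj-sym G cb))
    ...     | no only = inj₁ (q , λ v v≢q → direct v v≢q (near v))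
      where
      direct : ∀ v → v ≢ q → Near G c v → Adj G q v
      direct v v≢q (inj₁ refl)                 = Adj-sym G cq
      direct v v≢q (inj₂ (inj₁ cv))            = contradiction (v , cv , v≢q) only
      direct v v≢q (inj₂ (inj₂ (b , cb , bv))) with b ≟ q
      ... | yes refl = bv
      ... | no  b≢q  = contradiction (b , cb , b≢q) only

  classification : (∃ (StarAt G) ⊎ ∃ (Diameter4 G) ⊎ ∃ (DoubleStar G)) ⊎ Spread G
  classification with any? (λ c → all? (near? c))
  ... | yes (c , near) = inj₁ (centred c near)
  ... | no none = inj₂ λ c → ¬∀⟶∃¬ n (Near G c) (near? c) λ near → none (c , near)

module _ {s : ℕ} (G : Graph (suc s)) (t : IsTree G) (1≤s : 1 ≤ s) where

  spread-ecc : Spread G → ∀ u → 3 ≤ ecc G u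
  spread-ecc spread u with v , ¬near ← spread u with x , ux ← walk-first G (proj₂ (proj₁ t u v)) (¬near ∘ inj₁) =
    ecc-≥ G v (Unique⇒length≤ {xs = u ∷ x ∷ v ∷ []}
      ((Adj-≢ G ux ∷ (¬near ∘ inj₁) ∷ []) ∷ ((λ { refl → ¬near (inj₂ (inj₁ ux)) }) ∷ []) ∷ [] ∷ [])) none
    where
    none : ∀ {i} → i < 3 → ¬ Walk G u v i
    none _ here                        = ¬near (inj₁ refl)
    none _ (step e here)               = ¬near (inj₂ (inj₁ e))
    none _ (step e (step d here))      = ¬near (inj₂ (inj₂ (_ , e , d)))
    none (s≤s (s≤s (s≤s ()))) (step _ (step _ (step _ _)))

  spread-bound : Spread G → ∃ λ m → m < target s × xi G ≤ℚ over12 m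
  spread-bound spread = _ , far-M-bound G t 1≤s , xi-upper G (λ _ → 4) λ u → scaled (ecc G u) (spread-ecc spread u)
    where
    scaled : ∀ e → 3 ≤ e → 12 ≤ 4 * suc (e ∸ 1)
    scaled (suc e) (s≤s 2≤e) = *-monoʳ-≤ 4 (s≤s 2≤e)

  trichotomy : ∃ (StarAt G) ⊎ ∃ (Diameter4 G) ⊎ (∃ λ m → m < target s × xi G ≤ℚ over12 m)
  trichotomy = bound (classification G)
    where
    double-star : ∀ {c} → DoubleStar G c → ∃ λ m → m < target s × xi G ≤ℚ over12 m
    double-star {c} d =
      let m , m< , le = Eccentricity.double-star-bound G t c near cp cq p≢q qx x≢c leaves
          sum≡ = suc-injective (Centred.sum-rimDegrees G t c near)
      in m , <-≤-trans m< (≤-trans (≤-reflexive (cong starValue sum≡)) (starValue≤target s)) , le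
      where open DoubleStar d
    bound : (∃ (StarAt G) ⊎ ∃ (Diameter4 G) ⊎ ∃ (DoubleStar G)) ⊎ Spread G →
            ∃ (StarAt G) ⊎ ∃ (Diameter4 G) ⊎ (∃ λ m → m < target s × xi G ≤ℚ over12 m)
    bound (inj₁ (inj₁ star-at))             = inj₁ star-at
    bound (inj₁ (inj₂ (inj₁ diameter-4)))   = inj₂ (inj₁ diameter-4)
    bound (inj₁ (inj₂ (inj₂ (_ , d))))      = inj₂ (inj₂ (double-star d))
    bound (inj₂ spread)                     = inj₂ (inj₂ (spread-bound spread))

Diameter4-xi : ∀ {s} (G : Graph (suc s)) → IsTree G → ∀ {c} → Diameter4 G c →
  Positive (rimDegrees G c) × sum (rimDegrees G c) ≡ s × xi G ≡ over12 (Φ (rimDegrees G c))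
Diameter4-xi G t {c} d = positive , suc-injective sum-rimDegrees , Eccentricity.xi-diameter-4 G t c near cp cq p≢q 2≤p 2≤q
  where
  open Diameter4 d
  open Centred G t c near
  positive : Positive (rimDegrees G c)
  positive = All.tabulate λ d∈ → case ∈-map⁻ (deg G) d∈ of λ { (b , b∈ , refl) → Adj⇒deg≥1 G (Adj-sym G (rim-Adj b∈)) }

-- Extremality and uniqueness of the maximiser

Maximal : ∀ {n} → Graph n → Set
Maximal {n} H = ∀ (T : Graph n) → IsTree T → (xi T ≤ℚ xi H) × ((xi T ≡ xi H) ⇔ (T ≅ H))

-- The equality clause needs strictness for every tree not isomorphic to `H`; this is why all
-- earlier bounds on competitors are strict.
maximal : ∀ {n} (H : Graph n) → (∀ (T : Graph n) → IsTree T → T ≅ H ⊎ xi T <ℚ xi H) → Maximal H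
maximal H dichotomy T t = [ equal , smaller ]′ (dichotomy T t)
  where
  equal : T ≅ H → (xi T ≤ℚ xi H) × ((xi T ≡ xi H) ⇔ (T ≅ H))
  equal iso = ℚ.≤-reflexive (xi-iso iso) , mk⇔ (λ _ → iso) (λ _ → xi-iso iso)
  smaller : xi T <ℚ xi H → (xi T ≤ℚ xi H) × ((xi T ≡ xi H) ⇔ (T ≅ H))
  smaller lt = ℚ.<⇒≤ lt , mk⇔ (λ eq → contradiction lt (ℚ.<-irrefl eq)) (λ iso → contradiction lt (ℚ.<-irrefl (xi-iso iso)))

star-maximal : ∀ s → 1 ≤ s → s ≤ 14 → Maximal (star (suc s))
star-maximal s 1≤s s≤14 = maximal (star (suc s)) λ T t → compare T t (trichotomy T t 1≤s)
  where
  value≤ = star-lower (star (suc s)) (star-IsTree s) zero (star-StarAt s)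
  compare : ∀ (T : Graph (suc s)) → IsTree T →
            ∃ (StarAt T) ⊎ ∃ (Diameter4 T) ⊎ (∃ λ m → m < target s × xi T ≤ℚ over12 m) → T ≅ star (suc s) ⊎ xi T <ℚ xi (star (suc s))
  compare T t (inj₁ (c , star-c)) = inj₁ (StarAt⇒≅star T t star-c)
  compare T t (inj₂ (inj₁ (c , d))) = let pos , eq , value = Diameter4-xi T t d in
    inj₂ (ℚ.<-≤-trans (subst (_<ℚ over12 (starValue s)) (≡-sym value) (/12-< (Φ<starValue _ pos eq s≤14))) value≤)
  compare T t (inj₂ (inj₂ (m , m< , le))) =
    inj₂ (ℚ.≤-<-trans le (ℚ.<-≤-trans (/12-< (subst (m <_) (target-small s≤14) m<)) value≤))

balanced-parts : ∀ s → 2 ≤ s → All (λ d → 2 ≤ d × d ≤ 3) (balanced s)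
balanced-parts 1 (s≤s ())
balanced-parts 2 _ = (≤-refl , ≤ᵇ⇒≤ 2 3 _) ∷ []
balanced-parts 3 _ = (≤ᵇ⇒≤ 2 3 _ , ≤-refl) ∷ []
balanced-parts 4 _ = (≤-refl , ≤ᵇ⇒≤ 2 3 _) ∷ (≤-refl , ≤ᵇ⇒≤ 2 3 _) ∷ []
balanced-parts (suc (suc (suc s@(suc (suc _))))) _ = (≤ᵇ⇒≤ 2 3 _ , ≤-refl) ∷ balanced-parts s (s≤s (s≤s z≤n))

-- With n = s + 1 the right side is ⌈(n - 1) / 3⌉, the degree of the centre of the extremal tree.
length-balanced : ∀ s → length (balanced s) ≡ (suc s + 1) / 3
length-balanced 0 = refl
length-balanced 1 = refl
length-balanced 2 = refl
length-balanced 3 = refl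
length-balanced 4 = refl
length-balanced (suc (suc (suc s@(suc (suc _))))) = trans (cong suc (length-balanced s))
  (≡-sym (m/n≡1+[m∸n]/n {3 + (suc s + 1)} {3} (m≤m+n 3 (suc s + 1))))

-- `H` enters through its rim degrees alone; the last hypothesis is the uniqueness of the balanced
-- tree up to isomorphism.
balanced-maximal : ∀ {s} (H : Graph (suc s)) (t : IsTree H) c (near : ∀ v → Near H c v) →
  rimDegrees H c ↭ balanced s → 15 ≤ s →
  (∀ (T : Graph (suc s)) → IsTree T → ∀ c → (∀ v → Near T c v) → rimDegrees T c ↭ balanced s → T ≅ H) →
  DegreeBalanced H ((suc s + 1) / 3) × Maximal H
balanced-maximal {s} H t c near degrees 15≤s unique =
  (diameter≡4 cp cq p≢q 2≤p 2≤q , c , ecc-centre-min cp cq p≢q 2≤p 2≤q , degree ,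
   λ u v cu cv → ≤-trans (proj₂ (parts cu)) (≤-trans (≤-reflexive (+-comm 1 2)) (+-monoˡ-≤ 1 (proj₁ (parts cv))))) ,
  maximal H λ T t → compare T t (trichotomy T t (≤-trans (≤ᵇ⇒≤ 1 15 _) 15≤s))
  where
  open Centred H t c near
  open Eccentricity H t c near
  degree : deg H c ≡ (suc s + 1) / 3
  degree = trans (≡-sym length-rimDegrees) (trans (↭-length degrees) (length-balanced s))
  parts : ∀ {b} → Adj H c b → 2 ≤ deg H b × deg H b ≤ 3
  parts cb = All.lookup (balanced-parts s (≤-trans (≤ᵇ⇒≤ 2 15 _) 15≤s)) (∈-resp-↭ degrees (∈-map⁺ (deg H) (∈-rim cb)))
  -- Parts of at most 3 with sum at least 15 force two rim vertices, the p and q required for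
  -- diameter 4.
  two : ∀ {xs} → Unique xs → (∀ {b} → b ∈ xs → Adj H c b) → ∑ xs (deg H) ≡ s → ∃₂ λ p q → Adj H c p × Adj H c q × p ≢ q
  two {[]} _ _ e = contradiction (≤-trans 15≤s (≤-reflexive (≡-sym e))) λ ()
  two {b ∷ []} _ h e = contradiction (≤-trans 15≤s (≤-trans (≤-reflexive (trans (≡-sym e) (+-identityʳ _))) (proj₂ (parts (h (here refl)))))) λ { (s≤s (s≤s (s≤s ()))) }
  two {p ∷ q ∷ _} ((p≢q ∷ _) ∷ _) h _ = p , q , h (here refl) , h (there (here refl)) , p≢q
  found = two Unique-rim rim-Adj (suc-injective sum-rimDegrees)
  cp = proj₁ (proj₂ (proj₂ found))
  cq = proj₁ (proj₂ (proj₂ (proj₂ found)))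
  p≢q = proj₂ (proj₂ (proj₂ (proj₂ found)))
  2≤p = proj₁ (parts cp)
  2≤q = proj₁ (parts cq)
  value : over12 (Φ (balanced s)) ≡ xi H
  value = ≡-sym (trans (xi-diameter-4 cp cq p≢q 2≤p 2≤q) (cong over12 (Φ-↭ degrees)))
  below : ∀ {T : Graph (suc s)} {m} → xi T ≤ℚ over12 m → m < Φ (balanced s) → xi T <ℚ xi H
  below le m< = subst (_ <ℚ_) value (ℚ.≤-<-trans le (/12-< m<))
  compare : ∀ (T : Graph (suc s)) → IsTree T →
            ∃ (StarAt T) ⊎ ∃ (Diameter4 T) ⊎ (∃ λ m → m < target s × xi T ≤ℚ over12 m) → T ≅ H ⊎ xi T <ℚ xi H
  compare T t (inj₁ (c , star-c)) = inj₂ (below {T} (star-upper T t c star-c (≤-trans (≤ᵇ⇒≤ 2 15 _) 15≤s)) (starValue<Φ 15≤s))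
  compare T t (inj₂ (inj₂ (m , m< , le))) = inj₂ (below {T} le (subst (m <_) (target-large 15≤s) m<))
  compare T t (inj₂ (inj₁ (c , d))) = let pos , eq , val = Diameter4-xi T t d in
    [ (λ lt → inj₂ (below {T} (ℚ.≤-reflexive val) (subst (λ s → Φ (rimDegrees T c) < Φ (balanced s)) eq lt)))
    , (λ p → inj₁ (unique T t c (Diameter4.near d) (subst (λ s → rimDegrees T c ↭ balanced s) eq p)))
    ]′ (Φ-maximal (rimDegrees T c) pos (subst (15 ≤_) (≡-sym eq) 15≤s))

radial-maximal : ∀ es → map suc es ≡ balanced (slots es) → 15 ≤ slots es →
  Σ (Graph (suc (slots es))) λ TB → IsTree TB × DegreeBalanced TB ((suc (slots es) + 1) / 3) × Maximal TB
radial-maximal es bal 15≤s = radial es , radial-IsTree es ,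
  balanced-maximal (radial es) (radial-IsTree es) zero (radial-near es)
    (subst (rimDegrees (radial es) zero ↭_) bal (rimDegrees-radial es)) 15≤s
    λ T t c near p → ≅-radial es T t c near (subst (rimDegrees T c ↭_) (≡-sym bal) p)

theorem11 : (n : ℕ) → 2 ≤ n →
    ((n ≤ 15) →
    ∀ (T : Graph n) → IsTree T →
    (xi T ≤ℚ xi (star n)) × ((xi T ≡ xi (star n)) ⇔ (T ≅ star n)))
    × ((16 ≤ n) →
    Σ (Graph n) λ TB → IsTree TB × DegreeBalanced TB ((n + 1) / 3) ×
    (∀ (T : Graph n) → IsTree T →
    (xi T ≤ℚ xi TB) × ((xi T ≡ xi TB) ⇔ (T ≅ TB))))
theorem11 (suc s) (s≤s 1≤s) = (λ { (s≤s s≤14) → star-maximal s 1≤s s≤14 }) , λ { (s≤s 15≤s) → large 15≤s }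
  where
  es = map pred (balanced s)
  map-suc-pred : ∀ {ds} → All (λ d → 2 ≤ d × d ≤ 3) ds → map suc (map pred ds) ≡ ds
  map-suc-pred []                       = refl
  map-suc-pred {suc d ∷ ds} (_ ∷ a) = cong (suc d ∷_) (map-suc-pred a)
  Goal : ℕ → Set
  Goal s = Σ (Graph (suc s)) λ TB → IsTree TB × DegreeBalanced TB ((suc s + 1) / 3) × Maximal TB
  large : 15 ≤ s → Goal s
  -- `radial es` has `suc (slots es)` vertices, equal to `suc s` only by a proof, so the whole goal
  -- is transported at once.
  large 15≤s = subst Goal slots≡ (radial-maximal es (trans suc-es (cong balanced (≡-sym slots≡))) (subst (15 ≤_) (≡-sym slots≡) 15≤s))
    where
    suc-es : map suc es ≡ balanced s
    suc-es = map-suc-pred (balanced-parts s (≤-trans (≤ᵇ⇒≤ 2 15 _) 15≤s))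
    slots≡ : slots es ≡ s
    slots≡ = trans (cong sum suc-es) (sum-balanced s)
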